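{- For any $k\geq 2$ and positive integers $m_1,\dots,m_k$, the numbers of equivalent embeddings of the cubic caterpillar-Halin graph $H_{m_1,\dots,m_k}$ into surfaces of Euler-genus $0$ and $1$ are $$\varepsilon_{m_1,\dots,m_k}(0)=2,\qquad \varepsilon_{m_1,\dots,m_k}(1)=8(m_1+m_2+\cdots+m_k+k)-10.$$
   Context: Counting embeddings. The Euler-genus of a closed surface is $2j$ for the orientable surface with $j$ handles and $c$ for the non-orientable surface with $c$ crosscaps. A pure rotation system of a graph $G$ assigns to every vertex a cyclic permutation of its incident edges; a general rotation system is a pure rotation system together with a map $\tau:E(G)\to\{0,1\}$ (an edge $e$ is twisted if $\tau(e)=1$, untwisted otherwise); it determines a cellular embedding of $G$ in a closed surface. For a fixed spanning tree $T$ of $G$, a $T$-rotation system is a general rotation system with $\tau(e)=0$ for all $e\in E(T)$. Embeddings with equivalent $T$-rotation systems are identified, so the number $\varepsilon_G(i)$ of equivalent embeddings of $G$ into surfaces of Euler-genus $i$ is the number of $T$-rotation systems whose embedding surface has Euler-genus $i$. The graphs $H_{m_1,\dots,m_k}$. Let $k\ge 2$, $m_1,\dots,m_k\ge 1$. Put $n_1=m_1$, $n_i=m_i+1$ for $1<i<k$, $n_k=m_k$, and $\ell=n_1+\dots+n_k$. Take the path $v_0v_1\cdots v_{\ell+1}$ drawn horizontally and attach to each $v_i$ ($1\le i\le\ell$) a leaf $u_i$; the first $n_1$ of the leaves $u_i$ are drawn above the path, the next $n_2$ below, the next $n_3$ above, and so on alternately. Add a cycle $C$ through all leaves of this tree in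 their planar order: $v_0$, then the upper leaves $u_i$ in increasing order of index, then $v_{\ell+1}$, then the lower leaves $u_i$ in decreasing order of index. The resulting cubic graph is the cubic caterpillar-Halin graph $H_{m_1,\dots,m_k}$. Write $\varepsilon_{m_1,\dots,m_k}(j)=\varepsilon_{H_{m_1,\dots,m_k}}(j)$. -}

module Defs where

open import Level using (0ℓ)
open import Data.Bool using (Bool; true; false; not; _xor_; if_then_else_)
open import Data.Fin using (Fin; zero; suc; inject₁; fromℕ)
open import Data.Fin.Properties using (+↔⊎)
open import Data.Integer as ℤ using (ℤ; +_)
open import Data.List as List using (List; []; _∷_; filterᵇ; allFin; reverse; zip; length)
open import Data.List.Relation.Unary.Unique.Propositional using (Unique)
open import Data.Nat using (ℕ; suc; _+_; _*_; NonZero)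
open import Data.Nat.GeneralisedArithmetic using (iterate)
open import Data.Product using (∃-syntax; Σ-syntax; _×_; _,_; proj₁; proj₂)
open import Data.Sum using (_⊎_; inj₁; inj₂)
open import Data.Sum.Function.Propositional using (_⊎-↔_)
open import Data.Vec as Vec using (Vec; []; _∷_; sum; lookup; replicate)
open import Function.Bundles using (Inverse; _↔_)
open import Function.Construct.Composition using (_↔-∘_)
open import Function.Construct.Identity using (↔-id)
open import Function.Construct.Symmetry using (↔-sym)
open import Relation.Binary.Bundles using (Setoid)
import Relation.Binary.Construct.Closure.Equivalence as EqClosure
import Relation.Binary.Construct.On as On
open import Relation.Binary.PropositionalEquality as ≡ using (_≡_)
open import Relation.Nullary using (¬_)

-- "S has exactly n elements", counted up to the equality of S.
HasCardinality : Setoid 0ℓ 0ℓ → ℕ → Set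
HasCardinality S n = Inverse S (≡.setoid (Fin n))

record Graph : Set₁ where
  field
    V E       : Set
    order     : ℕ
    size      : ℕ
    V-finite  : V ↔ Fin order
    E-finite  : E ↔ Fin size
    ends      : E → V × V

  -- An edge together with one of its two ends: (e , false) starts at the first
  -- end of e, (e , true) at the second.
  Dart : Set
  Dart = E × Bool

  origin : Dart → V
  origin (e , false) = proj₁ (ends e)
  origin (e , true)  = proj₂ (ends e)

  edge : Dart → E
  edge = proj₁

  rev : Dart → Dart
  rev (e , b) = e , not b

  target : Dart → V
  target d = origin (rev d)

module _ (G : Graph) where
  open Graph G

  data Walk (T : E → Bool) : V → V → Set where
    nil  : ∀ {v} → Walk T v v
    cons : ∀ {u w} (d : Dart) → origin d ≡ u → T (edge d) ≡ true →
           Walk T (target d) w → Walk T u w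

  darts : ∀ {T u w} → Walk T u w → List Dart
  darts nil            = []
  darts (cons d _ _ p) = d ∷ darts p

  Connected : (E → Bool) → Set
  Connected T = ∀ u v → Walk T u v

  -- The origins of the darts of a closed walk list each visited vertex once
  -- per visit, the start/end vertex being listed only at the start.
  IsCycle : ∀ {T v} → Walk T v v → Set
  IsCycle p = ¬ (darts p ≡ []) × Unique (List.map edge (darts p))
                               × Unique (List.map origin (darts p))

  Acyclic : (E → Bool) → Set
  Acyclic T = ∀ {v} (p : Walk T v v) → ¬ IsCycle p

  IsSpanningTree : (E → Bool) → Set
  IsSpanningTree T = Connected T × Acyclic T

  -- The cyclic permutations at the individual vertices are assembled into one
  -- permutation of the darts, whose orbits are the sets of darts with a common
  -- origin.
  record PureRotationSystem : Set where
    field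
      rotation  : Dart ↔ Dart
    next : Dart → Dart
    next = Inverse.to rotation
    field
      fixes-origin : ∀ d → origin (next d) ≡ origin d
      cyclic       : ∀ d d′ → origin d ≡ origin d′ → ∃[ n ] iterate next d n ≡ d′

  record RotationSystem : Set where
    field
      pure : PureRotationSystem
      τ    : E → Bool
    open PureRotationSystem pure public

  -- Rotation systems are data up to pointwise equality of their functions.
  RotationSystems : Setoid 0ℓ 0ℓ
  RotationSystems = record
    { Carrier = RotationSystem
    ; _≈_     = λ R R′ → (∀ d → next R d ≡ next R′ d) × (∀ e → τ R e ≡ τ R′ e)
    ; isEquivalence = record
      { refl  = (λ _ → ≡.refl) , (λ _ → ≡.refl)
      ; sym   = λ (p , q) → (λ d → ≡.sym (p d)) , (λ e → ≡.sym (q e))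
      ; trans = λ (p , q) (p′ , q′) →
          (λ d → ≡.trans (p d) (p′ d)) , (λ e → ≡.trans (q e) (q′ e))
      }
    }
    where open RotationSystem

  IsTRotationSystem : (E → Bool) → RotationSystem → Set
  IsTRotationSystem T R = ∀ e → T e ≡ true → RotationSystem.τ R e ≡ false

  -- A dart with one of its two sides, as seen when leaving its origin: true is
  -- the side facing the next dart in the rotation, false the other one.
  Flag : Set
  Flag = Dart × Bool

  -- Walking along the boundary of a face.  Seen from its other end, the same
  -- side of an untwisted edge has the opposite name; a twist cancels this.
  data FaceStep (R : RotationSystem) : Flag → Flag → Set where
    along  : ∀ d s → FaceStep R (d , s)
                       (rev d , (if RotationSystem.τ R (edge d) then s else not s))
    corner : ∀ d → FaceStep R (d , true) (RotationSystem.next R d , false)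

  Faces : RotationSystem → Setoid 0ℓ 0ℓ
  Faces R = EqClosure.setoid (FaceStep R)

  HasEulerCharacteristic : RotationSystem → ℤ → Set
  HasEulerCharacteristic R χ =
    ∃[ f ] HasCardinality (Faces R) f × + order ℤ.- + size ℤ.+ + f ≡ χ

  -- The rotations can be reversed at some of the vertices (those with s v ≡ true)
  -- so that all edges become untwisted: reversing the rotation at a vertex changes
  -- the twist of every edge once for each of its ends at that vertex.
  Orientable : RotationSystem → Set
  Orientable R = Σ[ s ∈ (V → Bool) ] ∀ e →
    RotationSystem.τ R e ≡ s (proj₁ (ends e)) xor s (proj₂ (ends e))

-- Closed connected surfaces up to homeomorphism.
data Surface : Set where
  orientable    : (handles : ℕ) → Surface
  nonOrientable : (crosscaps : ℕ) → .{{NonZero crosscaps}} → Surface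

eulerGenus : Surface → ℕ
eulerGenus (orientable j)    = 2 * j
eulerGenus (nonOrientable c) = c

module _ (G : Graph) where
  open Graph G

  -- The surface of the embedding determined by a rotation system, identified
  -- through the classification of surfaces by orientability and Euler
  -- characteristic.  Meaningful for connected G with at least one edge.
  EmbedsIn : RotationSystem G → Surface → Set
  EmbedsIn R (orientable j) =
    Orientable G R × HasEulerCharacteristic G R (+ 2 ℤ.- + (2 * j))
  EmbedsIn R (nonOrientable c) =
    ¬ Orientable G R × HasEulerCharacteristic G R (+ 2 ℤ.- + c)

  HasEulerGenus : RotationSystem G → ℕ → Set
  HasEulerGenus R i = ∃[ S ] EmbedsIn R S × eulerGenus S ≡ i

  -- Equality only compares the rotation systems, not the accompanying proofs.
  TRotationSystems : (T : E → Bool) (i : ℕ) → Setoid 0ℓ 0ℓ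
  TRotationSystems T i =
    On.setoid (RotationSystems G) (proj₁ {B = λ R → IsTRotationSystem G T R × HasEulerGenus R i})

  -- ε_G(i) = N, computed with the spanning tree T.
  NumberOfEmbeddings : (T : E → Bool) (i N : ℕ) → Set
  NumberOfEmbeddings T i N = HasCardinality (TRotationSystems T i) N

data Side : Set where
  above below : Side

opposite : Side → Side
opposite above = below
opposite below = above

isAbove isBelow : Side → Bool
isAbove above = true
isAbove below = false
isBelow s     = isAbove (opposite s)

-- The cubic Halin graph of the caterpillar with path v₀ … v_{ℓ+1} and leaves
-- u₁ … u_ℓ, where u_{i+1} is drawn on side lookup sides i.
module CaterpillarHalin {ℓ : ℕ} (sides : Vec Side ℓ) where

  Vertex : Set
  Vertex = Fin (2 + ℓ) ⊎ Fin ℓ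

  pattern v i = inj₁ i
  -- Indices are shifted: u i is the leaf attached to v (suc (inject₁ i)).
  pattern u i = inj₂ i

  leavesOn : (Side → Bool) → List Vertex
  leavesOn p = List.map (λ i → u i) (filterᵇ (λ i → p (lookup sides i)) (allFin ℓ))

  -- The vertices of the cycle C after v₀, in cyclic order.
  rim : List Vertex
  rim = leavesOn isAbove List.++ v (fromℕ (suc ℓ)) ∷ reverse (leavesOn isBelow)

  rimEdges : List (Vertex × Vertex)
  rimEdges = zip (v zero ∷ rim) (rim List.++ v zero ∷ [])

  Edge : Set
  Edge = Fin (suc ℓ) ⊎ Fin ℓ ⊎ Fin (length rimEdges)

  pattern pathEdge i = inj₁ i
  pattern leafEdge i = inj₂ (inj₁ i)
  pattern rimEdge i  = inj₂ (inj₂ i)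

  edgeEnds : Edge → Vertex × Vertex
  edgeEnds (pathEdge i) = v (inject₁ i) , v (suc i)
  edgeEnds (leafEdge i) = v (suc (inject₁ i)) , u i
  edgeEnds (rimEdge i)  = List.lookup rimEdges i

  graph : Graph
  graph = record
    { V        = Vertex
    ; E        = Edge
    ; order    = (2 + ℓ) + ℓ
    ; size     = suc ℓ + (ℓ + length rimEdges)
    ; V-finite = ↔-sym +↔⊎
    ; E-finite = ↔-sym +↔⊎ ↔-∘ (↔-id _ ⊎-↔ ↔-sym +↔⊎)
    ; ends     = edgeEnds
    }

-- (m₁ , … , m_k) ↦ (n₁ , … , n_k): every entry except the first and the last
-- is increased by one.
blocks : ∀ {k} → Vec ℕ k → Vec ℕ k
blocks []       = []
blocks (m ∷ ms) = m ∷ afterFirst ms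
  where
  afterFirst : ∀ {k} → Vec ℕ k → Vec ℕ k
  afterFirst []             = []
  afterFirst (m ∷ [])       = m ∷ []
  afterFirst (m ∷ m′ ∷ ms)  = suc m ∷ afterFirst (m′ ∷ ms)

alternate : ∀ {k} → Side → (n : Vec ℕ k) → Vec Side (sum n)
alternate s []       = []
alternate s (n ∷ ns) = replicate n s Vec.++ alternate (opposite s) ns

-- The graph H_{m₁,…,m_k}.
H : ∀ {k} → Vec ℕ k → Graph
H m = CaterpillarHalin.graph (alternate above (blocks m))

{-# OPTIONS --safe #-}

-- Reversing rotations at vertices turns every rotation system of the planar
-- cubic graph G = H m into the clockwise one of its plane embedding, twisted
-- along a set A of edges; given a spanning tree T, every A arises from exactly
-- two T-rotation systems.  Counting 0-1 colourings of the flags that are constant on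
-- faces shows that the number of faces is the corank over GF(2) of the
-- Laplacian of the dual edges in A, so the Euler genus is its rank.  Rank 0
-- means that A is empty.  A symmetric matrix of rank one is w wᵀ, so for rank 1
-- A is the edge set of a clique of even order in the dual graph, that is, of an
-- edge or a tetrahedron.  The dual is the cone from the outer face over a strip
-- of triangles; adding the inner faces one by one, each new face is joined to
-- the outer face and to two adjacent faces, whence 3ℓ + 3 edges and ℓ tetrahedra.

module Submission where

open import Defs
open import Algebra.Bundles using (CommutativeRing)
open import Data.Bool using (Bool; true; false; not; _xor_; _∧_; if_then_else_)
open import Data.Bool.Properties as Boolₚ using (xor-∧-commutativeRing)
open import Data.Bool.Solver using (module xor-∧-Solver)
open import Data.Empty using (⊥; ⊥-elim)
open import Data.Fin as Fin
  using (Fin; zero; suc; punchOut; punchIn; combine; remQuot; _↑ˡ_; _↑ʳ_; funToFin; finToFun; splitAt; toℕ; fromℕ; inject₁)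
import Data.Fin.Induction as FinInduction
open import Data.Fin.Patterns using (0F; 1F; 2F)
open import Data.Fin.Permutation using (↔⇒≡)
import Data.Fin.Properties as Finₚ
open import Data.Fin.Relation.Unary.Top using (View; view; view-fromℕ; view-inject₁; ‵fromℕ; ‵inj₁)
open import Data.Integer as ℤ using (+_)
import Data.Integer.Properties as ℤₚ
import Data.Integer.Solver as ℤSolver
open import Data.List as List using (List; []; _∷_)
import Data.List.Properties as Listₚ
open import Data.List.Membership.DecPropositional using (_∈?_)
open import Data.List.Membership.Propositional using (_∈_)
open import Data.List.Membership.Propositional.Properties
  using (∈-map⁺; ∈-map⁻; ∈-++⁺ˡ; ∈-++⁺ʳ; ∈-++⁻; ∈-tabulate⁺; ∈-lookup)
open import Data.List.Relation.Binary.Permutation.Propositional using (↭-sym; ↭⇒↭ₛ)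
open import Data.List.Relation.Binary.Permutation.Propositional.Properties using (∷↭∷ʳ; ↭-reverse; ∈-resp-↭)
open import Data.List.Relation.Binary.Permutation.Setoid.Properties using (Unique-resp-↭)
open import Data.List.Relation.Unary.All as All using ([]; _∷_)
open import Data.List.Relation.Unary.All.Properties as Allₚ using (¬Any⇒All¬; All¬⇒¬Any)
open import Data.List.Relation.Unary.AllPairs using ([]; _∷_)
open import Data.List.Relation.Unary.Any as Any using (here; there)
import Data.List.Relation.Unary.Any.Properties as Anyₚ
open import Data.List.Relation.Unary.Unique.Propositional using (Unique)
import Data.List.Relation.Unary.Unique.Propositional.Properties as Uniqueₚ
open import Data.Maybe using (Maybe; just; nothing; maybe)
open import Data.Nat as ℕ using (ℕ; zero; suc; _+_; _*_; _∸_; _≤_; _<_; _^_)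
open import Data.Nat.GeneralisedArithmetic using (iterate)
import Data.Nat.Properties as ℕₚ
import Data.Nat.Solver as ℕSolver
open import Data.Product using (Σ-syntax; ∃; ∃-syntax; _×_; _,_; proj₁; proj₂; swap)
open import Data.Product.Function.NonDependent.Propositional using (_×-↔_)
open import Data.Sum using (_⊎_; inj₁; inj₂; [_,_]′)
open import Data.Sum.Function.Propositional using (_⊎-↔_)
open import Data.Unit using (tt)
open import Data.Vec as Vec using (Vec; []; _∷_; lookup; sum)
open import Data.Vec.Relation.Unary.All using (All)
open import Function using (_∘_; id; case_of_; Injective)
open import Function.Bundles using (Inverse; _↔_; mk↔ₛ′)
open import Function.Construct.Composition using (_↔-∘_)
open import Function.Construct.Identity using (↔-id)
open import Function.Construct.Symmetry using (↔-sym)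
open import Function.Properties.Inverse using (↔⇒↣)
open import Level using (0ℓ)
open import Relation.Binary using (Rel; IsEquivalence; Setoid; DecidableEquality)
import Relation.Binary.Construct.Closure.Equivalence as EqClosure
open import Relation.Binary.PropositionalEquality
open import Relation.Nullary using (¬_; Dec; yes; no; does; contradiction)
open import Relation.Nullary.Decidable using (dec-true; dec-false)

open xor-∧-Solver using (solve; con; _:=_; _:+_; _:*_)
open import Algebra.Properties.CommutativeMonoid.Sum (CommutativeRing.+-commutativeMonoid xor-∧-commutativeRing)
  using (sum-cong-≗; sum-replicate-zero; ∑-distrib-+; sum-permute) renaming (sum to xorSum)

-- Linear algebra over GF(2)

-- Why the corank counts faces: let `h` be a 0-1 function of the flags that is constant on the faces
-- of the twisted embedding. Its jumps across the edges form a cycle of the graph, hence equal `δ x`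
-- for a colouring `x` of the plane faces, and what remains of `h` is a function `y` of the
-- vertices. Constancy of `h` along the edges becomes `∂ y` = A · `δ x`. This has a solution `y`
-- exactly when A · `δ x` is orthogonal to every cycle `δ z`, that is, when `x` lies in the kernel
-- of `form A`. No bases are chosen: dimensions are compared by injections between sets of 2 ^ n
-- functions. In the rank one case the dual graph is simple, so the off-diagonal entries of the
-- Laplacian are the adjacency of A, and w wᵀ makes the support of w a clique. The Laplacian kills
-- constants, so this support is even. The definition of H names rim edges by positions in a list.
-- The geometry is therefore done on an isomorphic graph whose rim edges are named by the inner
-- faces, and carried over afterwards.

xor≡false⇒≡ : ∀ {a b} → a xor b ≡ false → a ≡ b
xor≡false⇒≡ {true}  {true}  _ = refl
xor≡false⇒≡ {false} {false} _ = refl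

sum-zero : ∀ {n} {f : Fin n → Bool} → (∀ i → f i ≡ false) → xorSum f ≡ false
sum-zero {n} f≗0 = trans (sum-cong-≗ f≗0) (sum-replicate-zero n)

sum-split : ∀ m {n} (f : Fin (m + n) → Bool) →
            xorSum f ≡ xorSum (f ∘ (_↑ˡ n)) xor xorSum (f ∘ (m ↑ʳ_))
sum-split zero    f = refl
sum-split (suc m) f =
  trans (cong (f zero xor_) (sum-split m (f ∘ suc))) (sym (Boolₚ.xor-assoc (f zero) _ _))

sum-point : ∀ {n} (f : Fin n → Bool) k → (∀ i → i ≢ k → f i ≡ false) → xorSum f ≡ f k
sum-point f zero    off =
  trans (cong (f zero xor_) (sum-zero (λ i → off (suc i) λ ()))) (Boolₚ.xor-identityʳ _)
sum-point f (suc k) off =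
  cong₂ _xor_ (off zero λ ()) (sum-point (f ∘ suc) k (λ i i≢k → off (suc i) (i≢k ∘ Finₚ.suc-injective)))

indicator : ∀ {n} → Fin n → Fin n → Bool
indicator w i = does (w Fin.≟ i)

indicator-same : ∀ {n} (w : Fin n) → indicator w w ≡ true
indicator-same zero    = refl
indicator-same (suc w) = indicator-same w

indicator-other : ∀ {n} {w i : Fin n} → i ≢ w → indicator w i ≡ false
indicator-other {w = zero}  {zero}  i≢w = contradiction refl i≢w
indicator-other {w = zero}  {suc i} i≢w = refl
indicator-other {w = suc w} {zero}  i≢w = refl
indicator-other {w = suc w} {suc i} i≢w = indicator-other (i≢w ∘ cong suc)

indicator⁻ : ∀ {n} (w i : Fin n) → indicator w i ≡ true → i ≡ w
indicator⁻ zero    zero    _  = refl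
indicator⁻ (suc w) (suc i) eq = cong suc (indicator⁻ w i eq)

-- Linear forms over GF(2). Vectors are functions compared pointwise, so respecting `_≗_` is part of
-- the notion.
Additive : ∀ {n} → ((Fin n → Bool) → Bool) → Set
Additive φ = (∀ {x y} → x ≗ y → φ x ≡ φ y) × (∀ x y → φ (λ i → x i xor y i) ≡ φ x xor φ y)

additive-zero : ∀ {n} {φ : (Fin n → Bool) → Bool} → Additive φ → φ (λ _ → false) ≡ false
additive-zero {φ = φ} (ext , add) = trans (add _ _) (Boolₚ.xor-same (φ (λ _ → false)))

-- Coordinate zero is split off, and the rest is the linear form `φ ∘ extend` in one variable fewer.
-- Applied later to the all-one vector, which yields parity, and to a vector where `φ` does not
-- vanish, which yields a basis vector with that property.
additive-expand : ∀ {n} {φ : (Fin n → Bool) → Bool} → Additive φ →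
                  ∀ x → φ x ≡ xorSum (λ i → x i ∧ φ (indicator i))
additive-expand {zero}  φ-add x = trans (proj₁ φ-add λ ()) (additive-zero φ-add)
additive-expand {suc n} {φ} φ-add@(ext , add) x = begin
  φ x                                                                    ≡⟨ ext (λ { zero → sym (Boolₚ.xor-identityʳ _) ; (suc i) → refl }) ⟩
  φ (λ i → head (x zero) i xor extend (x ∘ suc) i)                         ≡⟨ add _ _ ⟩
  φ (head (x zero)) xor φ (extend (x ∘ suc))                               ≡⟨ cong₂ _xor_ (φ-head (x zero)) (additive-expand ψ-add (x ∘ suc)) ⟩
  (x zero ∧ φ (indicator zero)) xor xorSum (λ i → x (suc i) ∧ φ (extend (indicator i)))
    ≡⟨ cong ((x zero ∧ φ (indicator zero)) xor_) (sum-cong-≗ λ i → cong (x (suc i) ∧_) (ext λ { zero → refl ; (suc j) → refl })) ⟩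
  xorSum (λ i → x i ∧ φ (indicator i))                                      ∎
  where
  open ≡-Reasoning
  head : Bool → Fin (suc n) → Bool
  head b zero    = b
  head b (suc i) = false
  extend : (Fin n → Bool) → Fin (suc n) → Bool
  extend y zero    = false
  extend y (suc i) = y i
  φ-head : ∀ b → φ (head b) ≡ b ∧ φ (indicator zero)
  φ-head true  = ext λ { zero → refl ; (suc i) → refl }
  φ-head false = trans (ext λ { zero → refl ; (suc i) → refl }) (additive-zero φ-add)
  ψ-add : Additive (φ ∘ extend)
  ψ-add = (λ x≗y → ext λ { zero → refl ; (suc i) → x≗y i })
        , (λ y z → trans (ext λ { zero → refl ; (suc i) → refl }) (add (extend y) (extend z)))

-- Counting 0-1 functions

open Inverse Finₚ.2↔Bool using () renaming (to to toBool; from to fromBool)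

encode : ∀ {n} → (Fin n → Bool) → Fin (2 ^ n)
encode c = funToFin (fromBool ∘ c)

decode : ∀ {n} → Fin (2 ^ n) → Fin n → Bool
decode k = toBool ∘ finToFun k

decode-encode : ∀ {n} (c : Fin n → Bool) → decode (encode c) ≗ c
decode-encode c i =
  trans (cong toBool (Finₚ.finToFun-funToFin (fromBool ∘ c) i)) (Inverse.strictlyInverseˡ Finₚ.2↔Bool (c i))

funToFin-cong : ∀ {m n} {f g : Fin m → Fin n} → f ≗ g → funToFin f ≡ funToFin g
funToFin-cong {zero}  f≗g = refl
funToFin-cong {suc m} f≗g = cong₂ combine (f≗g zero) (funToFin-cong (f≗g ∘ suc))

encode-decode : ∀ {n} (k : Fin (2 ^ n)) → encode {n} (decode k) ≡ k
encode-decode {n} k =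
  trans (funToFin-cong (λ i → Inverse.strictlyInverseʳ Finₚ.2↔Bool (finToFun {2} {n} k i))) (Finₚ.funToFin-finToFin {n} k)

encode-injective : ∀ {n} {c c′ : Fin n → Bool} → encode c ≡ encode c′ → c ≗ c′
encode-injective {c = c} {c′} eq i =
  trans (sym (decode-encode c i)) (trans (cong (λ k → decode k i) eq) (decode-encode c′ i))

decode-injective : ∀ {n} {k l : Fin (2 ^ n)} → decode {n} k ≗ decode l → k ≡ l
decode-injective {n} {k} {l} eq =
  trans (sym (encode-decode {n} k)) (trans (funToFin-cong (cong fromBool ∘ eq)) (encode-decode {n} l))

-- The substitute for a dimension count: `k` disjoint copies of a space of dimension `m`, in
-- practice translates by coset representatives, have to fit into a space of dimension `n`.
injection-bound : ∀ k {m n} (F : Fin k → (Fin m → Bool) → Fin n → Bool) →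
  (∀ {i j c d} → F i c ≗ F j d → i ≡ j × c ≗ d) → k * 2 ^ m ≤ 2 ^ n
injection-bound k {m} {n} F inj = Finₚ.injective⇒≤ {f = f} f-injective
  where
  f : Fin (k * 2 ^ m) → Fin (2 ^ n)
  f t = encode (F (proj₁ (remQuot {k} (2 ^ m) t)) (decode (proj₂ (remQuot {k} (2 ^ m) t))))
  f-injective : Injective _≡_ _≡_ f
  f-injective {s} {t} eq with inj (encode-injective eq)
  ... | i≡j , c≗d = trans (sym (Finₚ.combine-remQuot {k} (2 ^ m) s))
    (trans (cong₂ combine i≡j (decode-injective {m} c≗d)) (Finₚ.combine-remQuot {k} (2 ^ m) t))

2^-cancel-≤ : ∀ {m n} → 2 ^ m ≤ 2 ^ n → m ≤ n
2^-cancel-≤ le = ℕₚ.≮⇒≥ (λ n<m → ℕₚ.<⇒≱ (ℕₚ.^-monoʳ-< 2 (ℕ.s≤s (ℕ.s≤s ℕ.z≤n)) n<m) le)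

-- Only the functions `decode k` are tested; `resp` carries the outcome to the others.
allFunctions? : ∀ n {P : (Fin n → Bool) → Set} → (∀ {x y} → x ≗ y → P x → P y) →
                (∀ x → Dec (P x)) → (∀ x → P x) ⊎ (∃ λ x → ¬ P x)
allFunctions? n {P} resp P? with Finₚ.all? (λ k → P? (decode {n} k))
... | yes all = inj₁ λ x → resp (decode-encode x) (all (encode x))
... | no ¬all with Finₚ.¬∀⟶∃¬ _ (P ∘ decode {n}) (λ k → P? (decode k)) ¬all
...   | k , ¬Pk = inj₂ (decode k , ¬Pk)

-- Quotients of finite sets by finitely generated equivalences

module _ {A : Set} {_~_ : Rel A 0ℓ} (~-equiv : IsEquivalence _~_) where
  private module ~ = IsEquivalence ~-equiv

  -- The classes are counted without deciding `_~_`. Elements of one class are related, while only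
  -- the listed pairs are promised to share a class; when these pairs generate `_~_`, `class` is a
  -- complete invariant.
  record Quotient (pairs : List (A × A)) : Set where
    field
      classes    : ℕ
      class      : A → Fin classes
      member     : Fin classes → A
      class∘member : ∀ i → class (member i) ≡ i
      member∘class : ∀ a → member (class a) ~ a
      identifies : ∀ {p} → p ∈ pairs → class (proj₁ p) ≡ class (proj₂ p)

  -- If `a` and `b` lie in different classes, the class of `a` is deleted by `punchOut` and its
  -- elements are sent to the class of `b`.
  merge : ∀ {pairs a b} → a ~ b → Quotient pairs → Quotient ((a , b) ∷ pairs)
  merge {pairs} {a} {b} a~b Q with Quotient.class Q a Finₚ.≟ Quotient.class Q b
  ... | yes eq = record
    { Quotient Q hiding (identifies)
    ; identifies = λ { (here refl) → eq ; (there p∈) → Quotient.identifies Q p∈ } }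
  ... | no a≢b with Quotient.classes Q in eqn | Quotient.class Q | Quotient.member Q
                 | Quotient.class∘member Q | Quotient.member∘class Q | Quotient.identifies Q
  ...   | suc n | cl | mem | cm | mc | ident = record
    { classes = n
    ; class = λ t → collapse (cl t)
    ; member = λ i → mem (punchIn (cl a) i)
    ; class∘member = λ i → trans (cong collapse (cm _)) (collapse-punchIn i)
    ; member∘class = λ t → rep t
    ; identifies = λ { (here refl) → same ; (there p∈) → cong collapse (ident p∈) }
    }
    where
    collapse : Fin (suc n) → Fin n
    collapse t with cl a Finₚ.≟ t
    ... | yes _  = punchOut a≢b
    ... | no a≢t = punchOut a≢t
    collapse-punchIn : ∀ i → collapse (punchIn (cl a) i) ≡ i
    collapse-punchIn i with cl a Finₚ.≟ punchIn (cl a) i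
    ... | yes eq = contradiction (sym eq) (Finₚ.punchInᵢ≢i (cl a) i)
    ... | no ne  = trans (Finₚ.punchOut-cong (cl a) refl) (Finₚ.punchOut-punchIn (cl a))
    rep : ∀ t → mem (punchIn (cl a) (collapse (cl t))) ~ t
    rep t with cl a Finₚ.≟ cl t
    ... | yes eq = ~.trans (~.reflexive (cong mem (Finₚ.punchIn-punchOut a≢b)))
            (~.trans (mc b) (~.trans (~.sym a~b) (~.trans (~.sym (mc a)) (~.trans (~.reflexive (cong mem eq)) (mc t)))))
    ... | no ne  = ~.trans (~.reflexive (cong mem (Finₚ.punchIn-punchOut ne))) (mc t)
    same : collapse (cl a) ≡ collapse (cl b)
    same with cl a Finₚ.≟ cl a | cl a Finₚ.≟ cl b
    ... | yes _  | yes eq = contradiction eq a≢b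
    ... | yes _  | no ne  = Finₚ.punchOut-cong (cl a) refl
    ... | no a≢a | _      = contradiction refl a≢a
  ...   | zero | cl | _ | _ | _ | _ = case cl a of λ ()

  quotient : ∀ {n} → A ↔ Fin n → (pairs : List (A × A)) →
             (∀ {p} → p ∈ pairs → proj₁ p ~ proj₂ p) → Quotient pairs
  quotient {n} A↔Fin [] _ = record
    { classes = n
    ; class = Inverse.to A↔Fin
    ; member = Inverse.from A↔Fin
    ; class∘member = Inverse.strictlyInverseˡ A↔Fin
    ; member∘class = ~.reflexive ∘ Inverse.strictlyInverseʳ A↔Fin
    ; identifies = λ ()
    }
  quotient A↔Fin (p ∷ pairs) rel = merge (rel (here refl)) (quotient A↔Fin pairs (rel ∘ there))

-- Walk sums and spanning trees

V-≟ : (G : Graph) → DecidableEquality (Graph.V G)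
V-≟ G = Finₚ.inj⇒≟ (↔⇒↣ (Graph.V-finite G))

E-≟ : (G : Graph) → DecidableEquality (Graph.E G)
E-≟ G = Finₚ.inj⇒≟ (↔⇒↣ (Graph.E-finite G))

module WalkSum (G : Graph) (g : Graph.E G → Bool) where
  open Graph G

  walkSum : ∀ {T u w} → Walk G T u w → Bool
  walkSum nil            = false
  walkSum (cons d _ _ p) = g (edge d) xor walkSum p

  _▷_ : ∀ {T u v w} → Walk G T u v → Walk G T v w → Walk G T u w
  nil          ▷ q = q
  cons d o t p ▷ q = cons d o t (p ▷ q)

  walkSum-▷ : ∀ {T u v w} (p : Walk G T u v) (q : Walk G T v w) →
              walkSum (p ▷ q) ≡ walkSum p xor walkSum q
  walkSum-▷ nil            q = refl
  walkSum-▷ (cons d _ _ p) q =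
    trans (cong (g (edge d) xor_) (walkSum-▷ p q)) (sym (Boolₚ.xor-assoc (g (edge d)) _ _))

  visits : ∀ {T u w} → Walk G T u w → List V
  visits {w = w} nil    = w ∷ []
  visits (cons d _ _ p) = origin d ∷ visits p

  visits-∷ʳ : ∀ {T u w} (p : Walk G T u w) → visits p ≡ List.map origin (darts G p) List.∷ʳ w
  visits-∷ʳ nil            = refl
  visits-∷ʳ (cons d _ _ p) = cong (origin d ∷_) (visits-∷ʳ p)

  start∈visits : ∀ {T u w} (p : Walk G T u w) → u ∈ visits p
  start∈visits nil               = here refl
  start∈visits (cons d refl _ p) = here refl

  end∈visits : ∀ {T u w} (p : Walk G T u w) → w ∈ visits p
  end∈visits nil            = here refl
  end∈visits (cons d _ _ p) = there (end∈visits p)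

  rev-rev : ∀ d → rev (rev d) ≡ d
  rev-rev (e , b) = cong (e ,_) (Boolₚ.not-involutive b)

  same-edge : ∀ d d′ → edge d ≡ edge d′ → d ≡ d′ ⊎ d ≡ rev d′
  same-edge (e , false) (_ , false) refl = inj₁ refl
  same-edge (e , false) (_ , true)  refl = inj₂ refl
  same-edge (e , true)  (_ , false) refl = inj₂ refl
  same-edge (e , true)  (_ , true)  refl = inj₁ refl

  dart∈⇒visited : ∀ {T u w} (p : Walk G T u w) {d} → d ∈ darts G p →
                  origin d ∈ visits p × target d ∈ visits p
  dart∈⇒visited (cons d _ _ p) (here refl) = here refl , there (start∈visits p)
  dart∈⇒visited (cons _ _ _ p) (there d∈)  with dart∈⇒visited p d∈
  ... | o∈ , t∈ = there o∈ , there t∈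

  edge∈⇒visited : ∀ {T u w} (p : Walk G T u w) d → edge d ∈ List.map edge (darts G p) →
                  origin d ∈ visits p × target d ∈ visits p
  edge∈⇒visited p d e∈ with ∈-map⁻ edge e∈
  ... | d′ , d′∈ , eq with same-edge d d′ eq | dart∈⇒visited p d′∈
  ... | inj₁ refl | o∈ , t∈ = o∈ , t∈
  ... | inj₂ refl | o∈ , t∈ = t∈ , subst (λ x → origin x ∈ visits p) (sym (rev-rev d′)) o∈

  IsPath : ∀ {T u w} → Walk G T u w → Set
  IsPath p = Unique (visits p)

  path-edges : ∀ {T u w} (p : Walk G T u w) → IsPath p → Unique (List.map edge (darts G p))
  path-edges nil            _         = []
  path-edges (cons d _ _ p) (o∉ ∷ pp) =
    ¬Any⇒All¬ _ (λ e∈ → All¬⇒¬Any o∉ (proj₁ (edge∈⇒visited p d e∈))) ∷ path-edges p pp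

  closed-path-sum : ∀ {T u} (p : Walk G T u u) → IsPath p → walkSum p ≡ false
  closed-path-sum nil               _        = refl
  closed-path-sum (cons d refl _ p) (o∉ ∷ _) = contradiction (end∈visits p) (All¬⇒¬Any o∉)

  record Split {T u w} (p : Walk G T u w) (x : V) : Set where
    field
      fore      : Walk G T u x
      aft       : Walk G T x w
      fore-path : IsPath fore
      aft-path  : IsPath aft
      fore⊆     : ∀ {y} → y ∈ visits fore → y ∈ visits p
      sum-fore-aft : walkSum p ≡ walkSum fore xor walkSum aft

  split : ∀ {T u w x} (p : Walk G T u w) → IsPath p → x ∈ visits p → Split p x
  split nil pp (here refl) = record
    { fore = nil ; aft = nil ; fore-path = pp ; aft-path = pp ; fore⊆ = id ; sum-fore-aft = refl }
  split (cons d refl t p) pp (here refl) = record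
    { fore = nil ; aft = cons d refl t p ; fore-path = [] ∷ [] ; aft-path = pp
    ; fore⊆ = λ { (here refl) → here refl } ; sum-fore-aft = refl }
  split (cons d o t p) (o∉ ∷ pp) (there x∈) = record
    { fore = cons d o t S.fore ; aft = S.aft
    ; fore-path = ¬Any⇒All¬ _ (All¬⇒¬Any o∉ ∘ S.fore⊆) ∷ S.fore-path
    ; aft-path = S.aft-path
    ; fore⊆ = λ { (here eq) → here eq ; (there y∈) → there (S.fore⊆ y∈) }
    ; sum-fore-aft = trans (cong (g (edge d) xor_) S.sum-fore-aft) (sym (Boolₚ.xor-assoc (g (edge d)) _ _))
    }
    where module S = Split (split p pp x∈)

  module _ {T} (acyclic : Acyclic G T) where

    -- If the path `q` back to the origin avoided the edge of `d`, then `d` followed by `q` would be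
    -- a cycle of T.
    dart-then-path : ∀ d → T (edge d) ≡ true → (q : Walk G T (target d) (origin d)) → IsPath q →
                     edge d ∈ List.map edge (darts G q)
    dart-then-path d t q qp with _∈?_ (E-≟ G) (edge d) (List.map edge (darts G q))
    ... | yes e∈ = e∈
    ... | no e∉  = contradiction closed (acyclic (cons d refl t q))
      where
      closed : IsCycle G (cons d refl t q)
      closed = (λ ()) , (¬Any⇒All¬ _ e∉ ∷ path-edges q qp)
             -- `visits q` ends with `origin d`; moved to the front it gives the origins of the
             -- closed walk.
             , Unique-resp-↭ (setoid V) (↭⇒↭ₛ (↭-sym (∷↭∷ʳ (origin d) _))) (subst Unique (visits-∷ʳ q) qp)

    -- A path from the target to the origin of `d` that uses the edge of `d` can only consist of the
    -- reverse of `d`, so that edge is counted twice. The end vertices are variables with equations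
    -- to allow matching on `q`.
    retraced-sum : ∀ {x w} d → x ≡ target d → w ≡ origin d → (q : Walk G T x w) → IsPath q →
                   edge d ∈ List.map edge (darts G q) → g (edge d) xor walkSum q ≡ false
    retraced-sum d x≡ w≡ (cons d₁ o₁ t₁ q) (o₁∉ ∷ qp) (there e∈) =
      contradiction (subst (_∈ visits q) (sym (trans o₁ x≡)) (proj₂ (edge∈⇒visited q d e∈))) (All¬⇒¬Any o₁∉)
    retraced-sum d x≡ w≡ (cons d₁ o₁ t₁ q) (o₁∉ ∷ qp) (here eq) with same-edge d₁ d (sym eq)
    ... | inj₁ refl = contradiction (subst (_∈ visits q) w≡ (end∈visits q)) (All¬⇒¬Any o₁∉)
    ... | inj₂ refl = trans (cong (λ s → g (edge d) xor (g (edge d) xor s)) (rest (trans (cong origin (rev-rev d)) (sym w≡)) q qp))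
                        (solve 1 (λ a → a :+ (a :+ con false) := con false) refl (g (edge d)))
      where
      rest : ∀ {x w} → x ≡ w → (q : Walk G T x w) → IsPath q → walkSum q ≡ false
      rest refl = closed-path-sum

    -- Loop erasure. In an acyclic edge set a loop closed by prepending `d` to a path merely goes
    -- forth and back along one edge, so erasing it does not change the sum.
    walk⇒path : ∀ {u w} (p : Walk G T u w) →
                Σ[ q ∈ Walk G T u w ] IsPath q × walkSum p ≡ walkSum q
    walk⇒path nil = nil , [] ∷ [] , refl
    walk⇒path (cons d refl t p) with walk⇒path p
    ... | q , qp , p≡q with _∈?_ (V-≟ G) (origin d) (visits q)
    ...   | no o∉  = cons d refl t q , ¬Any⇒All¬ _ o∉ ∷ qp , cong (g (edge d) xor_) p≡q
    ...   | yes o∈ = S.aft , S.aft-path , (begin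
      g (edge d) xor walkSum p                             ≡⟨ cong (g (edge d) xor_) (trans p≡q S.sum-fore-aft) ⟩
      g (edge d) xor (walkSum S.fore xor walkSum S.aft)    ≡⟨ Boolₚ.xor-assoc (g (edge d)) _ _ ⟨
      (g (edge d) xor walkSum S.fore) xor walkSum S.aft    ≡⟨ cong (_xor walkSum S.aft) (retraced-sum d refl refl S.fore S.fore-path (dart-then-path d t S.fore S.fore-path)) ⟩
      walkSum S.aft                                        ∎)
      where
      module S = Split (split q qp o∈)
      open ≡-Reasoning

    closed-sum : ∀ {u} (p : Walk G T u u) → walkSum p ≡ false
    closed-sum p with walk⇒path p
    ... | q , qp , p≡q = trans p≡q (closed-path-sum q qp)

-- The coboundary over GF(2): `Orientable` says that `τ` is of this form, and reversing the
-- rotations at the vertices in `y` changes the twists by `∂ G y`.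
∂ : (G : Graph) → (Graph.V G → Bool) → Graph.E G → Bool
∂ G y e = y (proj₁ (Graph.ends G e)) xor y (proj₂ (Graph.ends G e))

dart-∂ : ∀ G y d → ∂ G y (Graph.edge G d) ≡ y (Graph.origin G d) xor y (Graph.target G d)
dart-∂ G y (e , false) = refl
dart-∂ G y (e , true)  = Boolₚ.xor-comm (y (proj₁ (Graph.ends G e))) _

module _ (G : Graph) {T : Graph.E G → Bool} where
  open Graph G

  potential-difference : ∀ {g} (y : V → Bool) → (∀ e → T e ≡ true → ∂ G y e ≡ g e) →
                         ∀ {u w} (p : Walk G T u w) → y u xor y w ≡ WalkSum.walkSum G g p
  potential-difference y ∂y≡g {u} nil = Boolₚ.xor-same (y u)
  potential-difference {g} y ∂y≡g {w = w} (cons d refl t p) = begin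
    y (origin d) xor y w                                              ≡⟨ solve 3 (λ a b c → a :+ c := (a :+ b) :+ (b :+ c)) refl (y (origin d)) (y (target d)) (y w) ⟩
    (y (origin d) xor y (target d)) xor (y (target d) xor y w)        ≡⟨ cong₂ _xor_ (trans (sym (dart-∂ G y d)) (∂y≡g (edge d) t)) (potential-difference y ∂y≡g p) ⟩
    g (edge d) xor WalkSum.walkSum G g p                              ∎
    where open ≡-Reasoning

  potential-unique : Connected G T → ∀ {y y′ : V → Bool} → (∀ e → T e ≡ true → ∂ G y e ≡ ∂ G y′ e) →
                     ∀ {r} → y r ≡ y′ r → ∀ v → y v ≡ y′ v
  potential-unique conn {y} {y′} eq {r} root v = xor≡false⇒≡ (begin
    y v xor y′ v                                  ≡⟨ solve 4 (λ a b c d → a :+ b := (c :+ a) :+ ((d :+ b) :+ (c :+ d))) refl (y v) (y′ v) (y r) (y′ r) ⟩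
    (y r xor y v) xor ((y′ r xor y′ v) xor (y r xor y′ r))
      ≡⟨ cong₂ (λ a b → a xor ((y′ r xor y′ v) xor b)) (potential-difference y eq (conn r v)) (trans (cong (_xor y′ r) root) (Boolₚ.xor-same (y′ r))) ⟩
    S xor ((y′ r xor y′ v) xor false)             ≡⟨ cong (λ a → S xor (a xor false)) (potential-difference y′ (λ _ _ → refl) (conn r v)) ⟩
    S xor (S xor false)                           ≡⟨ solve 1 (λ a → a :+ (a :+ con false) := con false) refl S ⟩
    false                                         ∎)
    where
    open ≡-Reasoning
    S = WalkSum.walkSum G (∂ G y′) (conn r v)

  -- Sums of `g` along walks in a tree depend only on the ends, since closed walks have sum zero.
  -- The free value `b` at the root is the source of the factor two in the final counts.
  potential-exists : IsSpanningTree G T → ∀ (g : E → Bool) (r : V) (b : Bool) →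
                     Σ[ y ∈ (V → Bool) ] y r ≡ b × (∀ e → T e ≡ true → ∂ G y e ≡ g e)
  potential-exists (conn , acyclic) g r b =
    y , trans (cong (b xor_) (closed (conn r r))) (Boolₚ.xor-identityʳ b) , step
    where
    open WalkSum G g
    closed = closed-sum acyclic
    y : V → Bool
    y v = b xor walkSum (conn r v)
    step : ∀ e → T e ≡ true → ∂ G y e ≡ g e
    step e t = xor≡false⇒≡ (begin
      ((b xor s₁) xor (b xor s₂)) xor g e              ≡⟨ solve 5 (λ b s₁ s₂ s₃ g → ((b :+ s₁) :+ (b :+ s₂)) :+ g := (s₁ :+ (g :+ s₃)) :+ (s₂ :+ s₃)) refl b s₁ s₂ s₃ (g e) ⟩
      (s₁ xor (g e xor s₃)) xor (s₂ xor s₃)            ≡⟨ cong₂ _xor_ around there-and-back ⟩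
      false                                            ∎)
      where
      open ≡-Reasoning
      e₁ = proj₁ (ends e)
      e₂ = proj₂ (ends e)
      s₁ = walkSum (conn r e₁)
      s₂ = walkSum (conn r e₂)
      s₃ = walkSum (conn e₂ r)
      around : s₁ xor (g e xor s₃) ≡ false
      around = trans (sym (walkSum-▷ (conn r e₁) (cons (e , false) refl t (conn e₂ r)))) (closed (conn r e₁ ▷ cons (e , false) refl t (conn e₂ r)))
      there-and-back : s₂ xor s₃ ≡ false
      there-and-back = trans (sym (walkSum-▷ (conn r e₂) (conn e₂ r))) (closed (conn r e₂ ▷ conn e₂ r))

-- Rotation systems of a cubic plane graph

-- The two cyclic permutations of three darts, clockwise for `false`. That there are only two is
-- where the degree three enters: a rotation system amounts to one bit per vertex and one per edge.
turn : Bool → Fin 3 → Fin 3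
turn false 0F = 1F
turn false 1F = 2F
turn false 2F = 0F
turn true  0F = 2F
turn true  1F = 0F
turn true  2F = 1F

turn-turn-not : ∀ b k → turn b (turn (not b) k) ≡ k
turn-turn-not true  0F = refl
turn-turn-not true  1F = refl
turn-turn-not true  2F = refl
turn-turn-not false 0F = refl
turn-turn-not false 1F = refl
turn-turn-not false 2F = refl

turn-not-turn : ∀ b k → turn (not b) (turn b k) ≡ k
turn-not-turn b k = subst (λ c → turn (not b) (turn c k) ≡ k) (Boolₚ.not-involutive b) (turn-turn-not (not b) k)

turn-transitive : ∀ b k l → ∃[ n ] iterate (turn b) k n ≡ l
turn-transitive false 0F 0F = 0 , refl
turn-transitive false 0F 1F = 1 , refl
turn-transitive false 0F 2F = 2 , refl
turn-transitive false 1F 0F = 2 , refl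
turn-transitive false 1F 1F = 0 , refl
turn-transitive false 1F 2F = 1 , refl
turn-transitive false 2F 0F = 1 , refl
turn-transitive false 2F 1F = 2 , refl
turn-transitive false 2F 2F = 0 , refl
turn-transitive true  0F 0F = 0 , refl
turn-transitive true  0F 1F = 2 , refl
turn-transitive true  0F 2F = 1 , refl
turn-transitive true  1F 0F = 1 , refl
turn-transitive true  1F 1F = 0 , refl
turn-transitive true  1F 2F = 2 , refl
turn-transitive true  2F 0F = 2 , refl
turn-transitive true  2F 1F = 1 , refl
turn-transitive true  2F 2F = 0 , refl

reverses : (Fin 3 → Fin 3) → Bool
reverses ρ = not (does (ρ 0F Fin.≟ 1F))

-- Permutations of three points without fixed points are 3-cycles, and the image of `0F` tells them
-- apart.
derangement : ∀ (ρ : Fin 3 → Fin 3) → (∀ {k l} → ρ k ≡ ρ l → k ≡ l) → (∀ k → ρ k ≢ k) →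
              ∀ k → ρ k ≡ turn (reverses ρ) k
derangement ρ inj fix k with ρ 0F in e₀ | ρ 1F in e₁ | ρ 2F in e₂
... | 0F | _  | _  = contradiction e₀ (fix 0F)
... | 1F | 1F | _  = contradiction e₁ (fix 1F)
... | 2F | 1F | _  = contradiction e₁ (fix 1F)
... | 1F | _  | 2F = contradiction e₂ (fix 2F)
... | 2F | _  | 2F = contradiction e₂ (fix 2F)
... | 1F | 0F | 0F = case inj (trans e₁ (sym e₂)) of λ ()
... | 2F | 0F | 0F = case inj (trans e₁ (sym e₂)) of λ ()
... | 1F | 0F | 1F = case inj (trans e₀ (sym e₂)) of λ ()
... | 1F | 2F | 1F = case inj (trans e₀ (sym e₂)) of λ ()
... | 2F | 2F | _  = case inj (trans e₀ (sym e₁)) of λ ()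
derangement ρ inj fix 0F | 1F | 2F | 0F = e₀
derangement ρ inj fix 1F | 1F | 2F | 0F = e₁
derangement ρ inj fix 2F | 1F | 2F | 0F = e₂
derangement ρ inj fix 0F | 2F | 0F | 1F = e₀
derangement ρ inj fix 1F | 2F | 0F | 1F = e₁
derangement ρ inj fix 2F | 2F | 0F | 1F = e₂

iterate-fixed : ∀ {A : Set} (f : A → A) {x} → f x ≡ x → ∀ n → iterate f x n ≡ x
iterate-fixed f fx≡x zero    = refl
iterate-fixed f fx≡x (suc n) = trans (cong (λ y → iterate f y n) fx≡x) (iterate-fixed f fx≡x n)

iterate-invariant : ∀ {A B : Set} (f : A → A) (k : A → B) → (∀ x → k (f x) ≡ k x) →
                    ∀ x n → k (iterate f x n) ≡ k x
iterate-invariant f k inv x zero    = refl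
iterate-invariant f k inv x (suc n) = trans (iterate-invariant f k inv (f x) n) (inv x)

iterate-conjugate : ∀ {A B : Set} {f : A → A} {g : B → B} (k : A → B) → (∀ x → g (k x) ≡ k (f x)) →
                    ∀ x n → iterate g (k x) n ≡ k (iterate f x n)
iterate-conjugate k conj x zero    = refl
iterate-conjugate {f = f} {g} k conj x (suc n) =
  trans (cong (λ y → iterate g y n) (conj x)) (iterate-conjugate k conj (f x) n)

-- An embedding of a cubic graph in an oriented surface, given by the three
-- darts at every vertex in clockwise order and the face on the left of every
-- dart.
record CubicMap (G : Graph) : Set where
  open Graph G
  field
    spoke        : V → Fin 3 → Dart
    place        : Dart → Fin 3
    spoke-place  : ∀ d → spoke (origin d) (place d) ≡ d
    origin-spoke : ∀ v k → origin (spoke v k) ≡ v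
    place-spoke  : ∀ v k → place (spoke v k) ≡ k

  turnAt : Bool → Dart → Dart
  turnAt b d = spoke (origin d) (turn b (place d))

  field
    faces     : ℕ
    left      : Dart → Fin faces
    left-turn : ∀ d → left (turnAt false d) ≡ left (rev d)
    edges     : ℕ
    enumerate : E ↔ Fin edges

  sumE : (E → Bool) → Bool
  sumE g = xorSum (g ∘ Inverse.from enumerate)

  -- The coboundary of the dual graph: `left (e , true)` is the face on the right of `e`. As an edge
  -- set of G it is the boundary of the region coloured by `x`, hence a cycle.
  δ : (Fin faces → Bool) → E → Bool
  δ x e = x (left (e , false)) xor x (left (e , true))

module CubicMapProperties {G : Graph} (M : CubicMap G) where
  open Graph G
  open CubicMap M

  spoke-injective : ∀ {v k l} → spoke v k ≡ spoke v l → k ≡ l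
  spoke-injective {v} {k} {l} eq = trans (sym (place-spoke v k)) (trans (cong place eq) (place-spoke v l))

  spoke-place′ : ∀ {d v} → origin d ≡ v → spoke v (place d) ≡ d
  spoke-place′ refl = spoke-place _

  turnAt-spoke : ∀ b v k → turnAt b (spoke v k) ≡ spoke v (turn b k)
  turnAt-spoke b v k = cong₂ (λ u l → spoke u (turn b l)) (origin-spoke v k) (place-spoke v k)

  origin-turnAt : ∀ b d → origin (turnAt b d) ≡ origin d
  origin-turnAt b d = origin-spoke _ _

  turnAt-cancel : ∀ b d → turnAt b (turnAt (not b) d) ≡ d
  turnAt-cancel b d = trans (turnAt-spoke b _ _) (trans (cong (spoke (origin d)) (turn-turn-not b (place d))) (spoke-place d))

  turnAt-cancel′ : ∀ b d → turnAt (not b) (turnAt b d) ≡ d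
  turnAt-cancel′ b d = trans (turnAt-spoke (not b) _ _) (trans (cong (spoke (origin d)) (turn-not-turn b (place d))) (spoke-place d))

  δ-dart : ∀ x d → δ x (edge d) ≡ x (left d) xor x (left (rev d))
  δ-dart x (e , false) = refl
  δ-dart x (e , true)  = Boolₚ.xor-comm (x (left (e , false))) _

  sumE-cong : ∀ {f g : E → Bool} → f ≗ g → sumE f ≡ sumE g
  sumE-cong f≗g = sum-cong-≗ (f≗g ∘ Inverse.from enumerate)

  sumE-xor : ∀ (f g : E → Bool) → sumE (λ e → f e xor g e) ≡ sumE f xor sumE g
  sumE-xor f g = ∑-distrib-+ (f ∘ Inverse.from enumerate) (g ∘ Inverse.from enumerate)

  sumE-point : ∀ (f : E → Bool) e → sumE (λ e′ → does (E-≟ G e e′) ∧ f e′) ≡ f e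
  sumE-point f e = trans (sum-point _ (Inverse.to enumerate e) off) on
    where
    e≡ = Inverse.strictlyInverseʳ enumerate e
    on = trans (cong (_∧ f _) (dec-true (E-≟ G e _) (sym e≡))) (cong f e≡)
    off : ∀ i → i ≢ Inverse.to enumerate e → does (E-≟ G e (Inverse.from enumerate i)) ∧ f (Inverse.from enumerate i) ≡ false
    off i i≢ = cong (_∧ f _) (dec-false (E-≟ G e _)
      (λ { refl → i≢ (sym (Inverse.strictlyInverseˡ enumerate i)) }))

  Dart↔Fin : Dart ↔ Fin (edges + edges)
  Dart↔Fin = ↔-sym Finₚ.+↔⊎ ↔-∘ mk↔ₛ′ to from to-from from-to
    where
    to : Dart → Fin edges ⊎ Fin edges
    to (e , false) = inj₁ (Inverse.to enumerate e)
    to (e , true)  = inj₂ (Inverse.to enumerate e)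
    from : Fin edges ⊎ Fin edges → Dart
    from (inj₁ i) = Inverse.from enumerate i , false
    from (inj₂ i) = Inverse.from enumerate i , true
    to-from : ∀ i → to (from i) ≡ i
    to-from (inj₁ i) = cong inj₁ (Inverse.strictlyInverseˡ enumerate i)
    to-from (inj₂ i) = cong inj₂ (Inverse.strictlyInverseˡ enumerate i)
    from-to : ∀ d → from (to d) ≡ d
    from-to (e , false) = cong (_, false) (Inverse.strictlyInverseʳ enumerate e)
    from-to (e , true)  = cong (_, true) (Inverse.strictlyInverseʳ enumerate e)

  sumD : (Dart → Bool) → Bool
  sumD f = xorSum (f ∘ Inverse.from Dart↔Fin)

  sumD-sumE : ∀ f → sumD f ≡ sumE (λ e → f (e , false) xor f (e , true))
  sumD-sumE f = begin
    sumD f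
      ≡⟨ sum-split edges (f ∘ Inverse.from Dart↔Fin) ⟩
    xorSum (λ i → f (Inverse.from Dart↔Fin (i ↑ˡ edges))) xor xorSum (λ i → f (Inverse.from Dart↔Fin (edges ↑ʳ i)))
      ≡⟨ cong₂ _xor_ (sum-cong-≗ firsts) (sum-cong-≗ seconds) ⟩
    sumE (λ e → f (e , false)) xor sumE (λ e → f (e , true))
      ≡⟨ sumE-xor (λ e → f (e , false)) (λ e → f (e , true)) ⟨
    sumE (λ e → f (e , false) xor f (e , true)) ∎
    where
    open ≡-Reasoning
    firsts : ∀ i → f (Inverse.from Dart↔Fin (i ↑ˡ edges)) ≡ f (Inverse.from enumerate i , false)
    firsts i rewrite Finₚ.splitAt-↑ˡ edges i edges = refl
    seconds : ∀ i → f (Inverse.from Dart↔Fin (edges ↑ʳ i)) ≡ f (Inverse.from enumerate i , true)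
    seconds i rewrite Finₚ.splitAt-↑ʳ edges edges i = refl

  sumD-turn : ∀ f → sumD (f ∘ turnAt false) ≡ sumD f
  sumD-turn f = sym (trans (sum-permute (f ∘ Inverse.from Dart↔Fin) π)
    (sum-cong-≗ λ i → cong f (Inverse.strictlyInverseʳ Dart↔Fin (turnAt false (Inverse.from Dart↔Fin i)))))
    where
    turning : Dart ↔ Dart
    turning = mk↔ₛ′ (turnAt false) (turnAt true) (turnAt-cancel false) (turnAt-cancel true)
    π : Fin (edges + edges) ↔ Fin (edges + edges)
    π = Dart↔Fin ↔-∘ (turning ↔-∘ ↔-sym Dart↔Fin)

  -- A cut meets a cycle evenly. Written as a sum over darts, the terms with the face on the right
  -- are those with the face on the left after one clockwise turn, and turning permutes the darts
  -- without changing origins.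
  cut-orthogonal : ∀ y z → sumE (λ e → ∂ G y e ∧ δ z e) ≡ false
  cut-orthogonal y z = begin
    sumE (λ e → ∂ G y e ∧ δ z e)                             ≡⟨ sumE-cong regroup ⟩
    sumE (λ e → f (e , false) xor f (e , true))              ≡⟨ sumD-sumE f ⟨
    sumD f                                                   ≡⟨ ∑-distrib-+ (f₁ ∘ Inverse.from Dart↔Fin) (f₂ ∘ Inverse.from Dart↔Fin) ⟩
    sumD f₁ xor sumD f₂                                      ≡⟨ cong (sumD f₁ xor_) (trans (sum-cong-≗ (f₂≗ ∘ Inverse.from Dart↔Fin)) (sumD-turn f₁)) ⟩
    sumD f₁ xor sumD f₁                                      ≡⟨ Boolₚ.xor-same (sumD f₁) ⟩
    false                                                    ∎
    where
    open ≡-Reasoning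
    f₁ f₂ f : Dart → Bool
    f₁ d = y (origin d) ∧ z (left d)
    f₂ d = y (origin d) ∧ z (left (rev d))
    f d = f₁ d xor f₂ d
    regroup : ∀ e → ∂ G y e ∧ δ z e ≡ f (e , false) xor f (e , true)
    regroup e = solve 4 (λ a b l r → (a :+ b) :* (l :+ r) := ((a :* l) :+ (a :* r)) :+ ((b :* r) :+ (b :* l))) refl
      (y (origin (e , false))) (y (origin (e , true))) (z (left (e , false))) (z (left (e , true)))
    f₂≗ : ∀ d → f₂ d ≡ f₁ (turnAt false d)
    f₂≗ d = cong₂ (λ v w → y v ∧ z w) (sym (origin-turnAt false d)) (sym (left-turn d))

-- The map is plane: the cellular complex is connected and has no homology over
-- GF(2).  Moreover an edge is determined by its two faces.
record PlaneCubic (G : Graph) : Set where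
  open Graph G
  field
    cubicMap : CubicMap G
  open CubicMap cubicMap public
  field
    euler          : order + faces ≡ 2 + size
    base           : V
    connected      : ∀ {y} → (∀ e → ∂ G y e ≡ false) → ∀ v → y v ≡ y base
    dual-connected : ∀ {x} → (∀ e → δ x e ≡ false) → ∀ w → x w ≡ x (left (spoke base 0F))
    cycle-is-δ     : ∀ (c : E → Bool) →
      (∀ v → c (edge (spoke v 0F)) xor (c (edge (spoke v 1F)) xor c (edge (spoke v 2F))) ≡ false) →
      ∀ b → Σ[ x ∈ (Fin faces → Bool) ] x (left (spoke base 0F)) ≡ b × (∀ e → δ x e ≡ c e)
    cut-is-∂       : ∀ (g : E → Bool) → (∀ z → sumE (λ e → g e ∧ δ z e) ≡ false) →
      Σ[ y ∈ (V → Bool) ] y base ≡ false × (∀ e → ∂ G y e ≡ g e)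
    separate       : ∀ e → ∃[ x ] ∃[ z ] ∀ e′ → δ x e′ ∧ δ z e′ ≡ does (E-≟ G e e′)

module PlaneCubicProperties {G : Graph} (P : PlaneCubic G) where
  open CubicMapProperties (PlaneCubic.cubicMap P) public

-- Colourings of the flags and the set of twisted edges

module Twisting {G : Graph} (P : PlaneCubic G) where
  open Graph G
  open PlaneCubic P
  open PlaneCubicProperties P

  flippedBy : (V → Bool) → (E → Bool) → RotationSystem G
  flippedBy s τ = record
    { pure = record
      { rotation     = mk↔ₛ′ (λ d → turnAt (s (origin d)) d) (λ d → turnAt (not (s (origin d))) d) to-from from-to
      ; fixes-origin = λ d → origin-turnAt (s (origin d)) d
      ; cyclic       = cyclic
      }
    ; τ = τ
    }
    where
    to-from : ∀ d → turnAt (s (origin (turnAt (not (s (origin d))) d))) (turnAt (not (s (origin d))) d) ≡ d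
    to-from d = trans (cong (λ v → turnAt (s v) (turnAt (not (s (origin d))) d)) (origin-turnAt (not (s (origin d))) d)) (turnAt-cancel (s (origin d)) d)
    from-to : ∀ d → turnAt (not (s (origin (turnAt (s (origin d)) d)))) (turnAt (s (origin d)) d) ≡ d
    from-to d = trans (cong (λ v → turnAt (not (s v)) (turnAt (s (origin d)) d)) (origin-turnAt (s (origin d)) d)) (turnAt-cancel′ (s (origin d)) d)
    cyclic : ∀ d d′ → origin d ≡ origin d′ → ∃[ n ] iterate (λ c → turnAt (s (origin c)) c) d n ≡ d′
    cyclic d d′ eq with turn-transitive (s (origin d)) (place d) (place d′)
    ... | n , reach = n , (begin
      iterate step d n                                                   ≡⟨ cong (λ c → iterate step c n) (spoke-place d) ⟨
      iterate step (spoke v (place d)) n                                 ≡⟨ iterate-conjugate (spoke v) conj (place d) n ⟩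
      spoke v (iterate (turn (s v)) (place d) n)                         ≡⟨ cong (spoke v) reach ⟩
      spoke v (place d′)                                                 ≡⟨ spoke-place′ (sym eq) ⟩
      d′                                                                 ∎)
      where
      open ≡-Reasoning
      v = origin d
      step : Dart → Dart
      step c = turnAt (s (origin c)) c
      conj : ∀ k → step (spoke v k) ≡ spoke v (turn (s v) k)
      conj k = trans (cong (λ u → turnAt (s u) (spoke v k)) (origin-spoke v k)) (turnAt-spoke (s v) v k)

  planeFace : Dart → Bool → Fin faces
  planeFace d false = left d
  planeFace d true  = left (rev d)

  module _ (R : RotationSystem G) where
    open RotationSystem R

    private
      ρ : V → Fin 3 → Fin 3
      ρ v k = place (next (spoke v k))

      next-spoke : ∀ v k → next (spoke v k) ≡ spoke v (ρ v k)
      next-spoke v k = sym (spoke-place′ (trans (fixes-origin (spoke v k)) (origin-spoke v k)))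

      next-injective : ∀ {c d} → next c ≡ next d → c ≡ d
      next-injective {c} {d} eq = trans (sym (Inverse.strictlyInverseʳ rotation c))
        (trans (cong (Inverse.from rotation) eq) (Inverse.strictlyInverseʳ rotation d))

      ρ-injective : ∀ v {k l} → ρ v k ≡ ρ v l → k ≡ l
      ρ-injective v {k} {l} eq = spoke-injective (next-injective
        (trans (next-spoke v k) (trans (cong (spoke v) eq) (sym (next-spoke v l)))))

      ρ-moves : ∀ v k → ρ v k ≢ k
      ρ-moves v k eq with cyclic (spoke v k) (spoke v (turn false k)) (trans (origin-spoke v k) (sym (origin-spoke v _)))
      ... | n , reach = turn-moves k (spoke-injective (trans (sym reach) (iterate-fixed next (trans (next-spoke v k) (cong (spoke v) eq)) n)))
        where
        turn-moves : ∀ k → turn false k ≢ k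
        turn-moves 0F ()
        turn-moves 1F ()
        turn-moves 2F ()

    flip : V → Bool
    flip v = reverses (ρ v)

    next-turns : ∀ d → next d ≡ turnAt (flip (origin d)) d
    next-turns d = begin
      next d                                        ≡⟨ cong next (spoke-place d) ⟨
      next (spoke v (place d))                      ≡⟨ next-spoke v (place d) ⟩
      spoke v (ρ v (place d))                       ≡⟨ cong (spoke v) (derangement (ρ v) (ρ-injective v) (ρ-moves v) (place d)) ⟩
      spoke v (turn (flip v) (place d))             ∎
      where
      open ≡-Reasoning
      v = origin d

    -- The edges twisted after all rotations have been made clockwise.
    twist : E → Bool
    twist e = τ e xor ∂ G flip e

    twist-dart : ∀ d → twist (edge d) ≡ τ (edge d) xor (flip (origin d) xor flip (target d))
    twist-dart d = cong (τ (edge d) xor_) (dart-∂ G flip d)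

    -- The side `true` faces the next dart: this is the right side where the rotation is clockwise
    -- and the left side where it is flipped.
    face : Flag G → Fin faces
    face (d , t) = planeFace d (t xor flip (origin d))

    face-corner : ∀ d → face (next d , false) ≡ face (d , true)
    face-corner d rewrite next-turns d | origin-turnAt (flip (origin d)) d with flip (origin d)
    ... | false = left-turn d
    ... | true  = trans (sym (left-turn (turnAt true d))) (cong left (turnAt-cancel false d))

    -- The side `flip base` compensates the rotation at `base`, so this flag sees the left face for
    -- every `R`. It serves to normalise `x` and `y` together.
    base-face : face (spoke base 0F , flip base) ≡ left (spoke base 0F)
    base-face rewrite origin-spoke base 0F = cong (planeFace (spoke base 0F)) (Boolₚ.xor-same (flip base))

    -- A polynomial form of the choice of face, which turns `value-along` and `value-sides` into
    -- ring identities.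
    planeFace-xor : ∀ (x : Fin faces → Bool) d u → x (planeFace d u) ≡ x (left d) xor (u ∧ (x (left d) xor x (left (rev d))))
    planeFace-xor x d false = sym (Boolₚ.xor-identityʳ _)
    planeFace-xor x d true  = solve 2 (λ a b → b := a :+ (a :+ b)) refl (x (left d)) (x (left (rev d)))

    along-side : ∀ b (t : Bool) → (if b then t else not t) ≡ (true xor b) xor t
    along-side true  t = refl
    along-side false t = refl

    value : (Fin faces → Bool) → (V → Bool) → Flag G → Bool
    value x y (d , t) = y (origin d) xor x (face (d , t))

    -- The obstruction to constancy along an edge does not depend on the side `t`; its vanishing is
    -- the equation between `∂ y` and A · `δ x`.
    value-along : ∀ x y d t →
      value x y (d , t) xor value x y (rev d , (if τ (edge d) then t else not t)) ≡ ∂ G y (edge d) xor (twist (edge d) ∧ δ x (edge d))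
    value-along x y d t rewrite along-side (τ (edge d)) t
                              | planeFace-xor x d (t xor flip (origin d))
                              | planeFace-xor x (rev d) (((true xor τ (edge d)) xor t) xor flip (target d))
                              | WalkSum.rev-rev G (λ _ → false) d
                              | dart-∂ G y d | twist-dart d | δ-dart x d =
      solve 8 (λ y₁ y₂ X Y t f₁ f₂ τ →
        (y₁ :+ (X :+ ((t :+ f₁) :* (X :+ Y)))) :+ (y₂ :+ (Y :+ ((((con true :+ τ) :+ t) :+ f₂) :* (Y :+ X))))
          := (y₁ :+ y₂) :+ ((τ :+ (f₁ :+ f₂)) :* (X :+ Y)))
        refl (y (origin d)) (y (target d)) (x (left d)) (x (left (rev d))) t (flip (origin d)) (flip (target d)) (τ (edge d))

    value-sides : ∀ x y d → value x y (d , false) xor value x y (d , true) ≡ δ x (edge d)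
    value-sides x y d rewrite planeFace-xor x d (flip (origin d)) | planeFace-xor x d (not (flip (origin d))) | δ-dart x d =
      solve 4 (λ y X Y f → (y :+ (X :+ (f :* (X :+ Y)))) :+ (y :+ (X :+ ((con true :+ f) :* (X :+ Y)))) := X :+ Y)
        refl (y (origin d)) (x (left d)) (x (left (rev d))) (flip (origin d))

    Invariant : (Flag G → Bool) → Set
    Invariant h = ∀ {f f′} → FaceStep G R f f′ → h f ≡ h f′

    value-invariant : ∀ x y → (∀ e → ∂ G y e ≡ twist e ∧ δ x e) → Invariant (value x y)
    value-invariant x y ∂y (along d t) = xor≡false⇒≡ (trans (value-along x y d t)
      (trans (cong (_xor (twist (edge d) ∧ δ x (edge d))) (∂y (edge d))) (Boolₚ.xor-same (twist (edge d) ∧ δ x (edge d)))))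
    value-invariant x y ∂y (corner d) = cong₂ (λ v w → y v xor x w) (sym (fixes-origin d)) (sym (face-corner d))

    -- Adding 1 to both `x` and `y` leaves `value x y` unchanged; `y-base` removes this ambiguity.
    record Decomposition (h : Flag G → Bool) : Set where
      field
        x      : Fin faces → Bool
        y      : V → Bool
        y-base : y base ≡ false
        ∂y     : ∀ e → ∂ G y e ≡ twist e ∧ δ x e
        h≡     : ∀ f → h f ≡ value x y f

    -- Passing to the other end of an edge either keeps or exchanges the two sides, and their sum is
    -- symmetric.
    sides-edge : ∀ {h} → Invariant h → ∀ d →
      h ((edge d , false) , false) xor h ((edge d , false) , true) ≡ h (d , false) xor h (d , true)
    sides-edge inv (e , false) = refl
    sides-edge {h} inv (e , true) with τ e | inv (along (e , false) false) | inv (along (e , false) true)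
    ... | true  | p | q = cong₂ _xor_ p q
    ... | false | p | q = trans (cong₂ _xor_ p q) (Boolₚ.xor-comm (h ((e , true) , true)) _)

    -- Around a vertex every corner identifies two of the six sides, so the three jumps of `h`
    -- cancel: the jumps form a cycle and equal some `δ x`. Then `h` plus the pulled back `x` takes
    -- equal values on the two sides of a dart and on consecutive darts, so it is a function `y` of
    -- the vertex.
    decompose : ∀ {h} → Invariant h → Decomposition h
    decompose {h} inv with cycle-is-δ c c-cycle (h (spoke base 0F , flip base))
      where
      c : E → Bool
      c e = h ((e , false) , false) xor h ((e , false) , true)
      h-corner : ∀ v k → h (spoke v k , true) ≡ h (spoke v (turn (flip v) k) , false)
      h-corner v k = trans (inv (corner (spoke v k))) (cong (λ d → h (d , false))
        (trans (next-turns (spoke v k)) (trans (cong (λ u → turnAt (flip u) (spoke v k)) (origin-spoke v k)) (turnAt-spoke (flip v) v k))))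
      c-cycle : ∀ v → c (edge (spoke v 0F)) xor (c (edge (spoke v 1F)) xor c (edge (spoke v 2F))) ≡ false
      c-cycle v rewrite sides-edge inv (spoke v 0F) | sides-edge inv (spoke v 1F) | sides-edge inv (spoke v 2F)
                      | h-corner v 0F | h-corner v 1F | h-corner v 2F with flip v
      ... | false = solve 3 (λ a b c → (a :+ b) :+ ((b :+ c) :+ (c :+ a)) := con false) refl
                      (h (spoke v 0F , false)) (h (spoke v 1F , false)) (h (spoke v 2F , false))
      ... | true  = solve 3 (λ a b c → (a :+ c) :+ ((b :+ a) :+ (c :+ b)) := con false) refl
                      (h (spoke v 0F , false)) (h (spoke v 1F , false)) (h (spoke v 2F , false))
    ... | x , x-base , δx = record
      { x = x ; y = y
      ; y-base = y-base
      ; ∂y = λ e → ∂y e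
      ; h≡ = h≡
      }
      where
      open ≡-Reasoning
      k : Flag G → Bool
      k (d , t) = h (d , t) xor x (face (d , t))
      δx-dart : ∀ d → h (d , false) xor h (d , true) ≡ δ x (edge d)
      δx-dart d = trans (sym (sides-edge inv d)) (sym (δx (edge d)))
      k-side : ∀ d → k (d , false) ≡ k (d , true)
      k-side d = xor≡false⇒≡ (begin
        k (d , false) xor k (d , true)
          ≡⟨ solve 4 (λ a b p q → (a :+ p) :+ (b :+ q) := (a :+ b) :+ (p :+ q)) refl (h (d , false)) (h (d , true)) (x (face (d , false))) (x (face (d , true))) ⟩
        (h (d , false) xor h (d , true)) xor (x (face (d , false)) xor x (face (d , true)))
          ≡⟨ cong₂ _xor_ (δx-dart d) (value-sides x (λ _ → false) d) ⟩
        δ x (edge d) xor δ x (edge d)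
          ≡⟨ Boolₚ.xor-same (δ x (edge d)) ⟩
        false ∎)
      k-next : ∀ d → k (next d , false) ≡ k (d , false)
      k-next d = sym (trans (k-side d) (cong₂ _xor_ (inv (corner d)) (cong x (sym (face-corner d)))))
      y : V → Bool
      y v = k (spoke v 0F , false)
      k-vertex : ∀ d → k (d , false) ≡ y (origin d)
      k-vertex d with cyclic (spoke (origin d) 0F) d (origin-spoke (origin d) 0F)
      ... | n , reach = trans (cong (λ c → k (c , false)) (sym reach))
                              (iterate-invariant next (λ c → k (c , false)) k-next (spoke (origin d) 0F) n)
      k-flag : ∀ f → k f ≡ y (origin (proj₁ f))
      k-flag (d , false) = k-vertex d
      k-flag (d , true)  = trans (sym (k-side d)) (k-vertex d)
      h≡ : ∀ f → h f ≡ value x y f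
      h≡ (d , t) = begin
        h (d , t)                                          ≡⟨ solve 2 (λ a b → a := (a :+ b) :+ b) refl (h (d , t)) (x (face (d , t))) ⟩
        k (d , t) xor x (face (d , t))                     ≡⟨ cong (_xor x (face (d , t))) (k-flag (d , t)) ⟩
        value x y (d , t)                                  ∎
      ∂y : ∀ e → ∂ G y e ≡ twist e ∧ δ x e
      ∂y e = xor≡false⇒≡ (begin
        ∂ G y e xor (twist e ∧ δ x e)                       ≡⟨ value-along x y (e , false) false ⟨
        value x y ((e , false) , false) xor value x y ((e , true) , (if τ e then false else true))
          ≡⟨ cong₂ _xor_ (sym (h≡ _)) (sym (h≡ _)) ⟩
        h ((e , false) , false) xor h ((e , true) , (if τ e then false else true))
          ≡⟨ cong (h ((e , false) , false) xor_) (sym (inv (along (e , false) false))) ⟩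
        h ((e , false) , false) xor h ((e , false) , false) ≡⟨ Boolₚ.xor-same (h ((e , false) , false)) ⟩
        false ∎)
      y-base : y base ≡ false
      y-base = begin
        y base                                                ≡⟨ cong y (origin-spoke base 0F) ⟨
        y (origin (spoke base 0F))                            ≡⟨ k-flag (spoke base 0F , flip base) ⟨
        h (spoke base 0F , flip base) xor x (face (spoke base 0F , flip base)) ≡⟨ cong (λ w → h (spoke base 0F , flip base) xor x w) base-face ⟩
        h (spoke base 0F , flip base) xor x (left (spoke base 0F)) ≡⟨ cong (h (spoke base 0F , flip base) xor_) x-base ⟩
        h (spoke base 0F , flip base) xor h (spoke base 0F , flip base) ≡⟨ Boolₚ.xor-same (h (spoke base 0F , flip base)) ⟩
        false ∎

-- Euler characteristic and finiteness of the set of faces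

euler⇒ : ∀ o s f g → + o ℤ.- + s ℤ.+ + f ≡ + 2 ℤ.- + g → o + f + g ≡ 2 + s
euler⇒ o s f g eq = ℤₚ.+-injective (begin
  + (o + f + g)                                    ≡⟨⟩
  (+ o ℤ.+ + f) ℤ.+ + g                            ≡⟨ prove₁ (+ o) (+ s) (+ f) (+ g) ⟩
  ((+ o ℤ.- + s ℤ.+ + f) ℤ.+ + s) ℤ.+ + g          ≡⟨ cong (λ z → (z ℤ.+ + s) ℤ.+ + g) eq ⟩
  ((+ 2 ℤ.- + g) ℤ.+ + s) ℤ.+ + g                  ≡⟨ prove₂ (+ s) (+ g) ⟩
  + (2 + s)                                        ∎)
  where
  open ≡-Reasoning
  open ℤSolver.+-*-Solver renaming (solve to solveℤ; _:=_ to _:≡_; _:+_ to _⊕_; _:-_ to _⊖_; con to conℤ)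
  prove₁ : ∀ o s f g → (o ℤ.+ f) ℤ.+ g ≡ ((o ℤ.- s ℤ.+ f) ℤ.+ s) ℤ.+ g
  prove₁ = solveℤ 4 (λ o s f g → (o ⊕ f) ⊕ g :≡ (((o ⊖ s) ⊕ f) ⊕ s) ⊕ g) refl
  prove₂ : ∀ s g → ((+ 2 ℤ.- g) ℤ.+ s) ℤ.+ g ≡ + 2 ℤ.+ s
  prove₂ = solveℤ 2 (λ s g → ((conℤ (+ 2) ⊖ g) ⊕ s) ⊕ g :≡ conℤ (+ 2) ⊕ s) refl

euler⇐ : ∀ o s f g → o + f + g ≡ 2 + s → + o ℤ.- + s ℤ.+ + f ≡ + 2 ℤ.- + g
euler⇐ o s f g eq = begin
  + o ℤ.- + s ℤ.+ + f                              ≡⟨ prove₁ (+ o) (+ s) (+ f) (+ g) ⟩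
  (+ (o + f + g) ℤ.- + s) ℤ.- + g                  ≡⟨ cong (λ n → (+ n ℤ.- + s) ℤ.- + g) eq ⟩
  (+ (2 + s) ℤ.- + s) ℤ.- + g                      ≡⟨ prove₂ (+ s) (+ g) ⟩
  + 2 ℤ.- + g                                      ∎
  where
  open ≡-Reasoning
  open ℤSolver.+-*-Solver renaming (solve to solveℤ; _:=_ to _:≡_; _:+_ to _⊕_; _:-_ to _⊖_; con to conℤ)
  prove₁ : ∀ o s f g → o ℤ.- s ℤ.+ f ≡ (((o ℤ.+ f) ℤ.+ g) ℤ.- s) ℤ.- g
  prove₁ = solveℤ 4 (λ o s f g → (o ⊖ s) ⊕ f :≡ (((o ⊕ f) ⊕ g) ⊖ s) ⊖ g) refl
  prove₂ : ∀ s g → ((+ 2 ℤ.+ s) ℤ.- s) ℤ.- g ≡ + 2 ℤ.- g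
  prove₂ = solveℤ 2 (λ s g → ((conℤ (+ 2) ⊕ s) ⊖ s) ⊖ g :≡ conℤ (+ 2) ⊖ g) refl

module _ (G : Graph) (R : RotationSystem G) where
  open Graph G
  open RotationSystem R using (τ; next)

  private
    Flag↔Fin : Flag G ↔ Fin ((size * 2) * 2)
    Flag↔Fin = ↔-sym ((((↔-sym E-finite ×-↔ Finₚ.2↔Bool) ↔-∘ Finₚ.*↔×) ×-↔ Finₚ.2↔Bool) ↔-∘ Finₚ.*↔×)

    flags : List (Flag G)
    flags = List.tabulate (Inverse.from Flag↔Fin)

    flag∈ : ∀ f → f ∈ flags
    flag∈ f = subst (_∈ flags) (Inverse.strictlyInverseʳ Flag↔Fin f) (∈-tabulate⁺ (Inverse.to Flag↔Fin f))

    along-pair corner-pair : Flag G → Flag G × Flag G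
    along-pair (d , s) = (d , s) , (rev d , (if τ (edge d) then s else not s))
    corner-pair (d , _) = (d , true) , (next d , false)

    steps : List (Flag G × Flag G)
    steps = List.map along-pair flags List.++ List.map corner-pair flags

    steps-sound : ∀ {p} → p ∈ steps → EqClosure.EqClosure (FaceStep G R) (proj₁ p) (proj₂ p)
    steps-sound p∈ with ∈-++⁻ (List.map along-pair flags) p∈
    ... | inj₁ p∈a with ∈-map⁻ along-pair p∈a
    ...   | (d , s) , _ , refl = EqClosure.return (along d s)
    steps-sound p∈ | inj₂ p∈c with ∈-map⁻ corner-pair p∈c
    ...   | (d , s) , _ , refl = EqClosure.return (corner d)

    steps-complete : ∀ {f f′} → FaceStep G R f f′ → (f , f′) ∈ steps
    steps-complete (along d s) = ∈-++⁺ˡ (∈-map⁺ along-pair (flag∈ (d , s)))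
    steps-complete (corner d)  = ∈-++⁺ʳ (List.map along-pair flags) (∈-map⁺ corner-pair (flag∈ (d , true)))

  -- To show that a rotation system has a given genus, a number of faces has to be produced first;
  -- the flags are finitely many and `steps` lists all generating pairs.
  faces-finite : ∃[ f ] HasCardinality (Faces G R) f
  faces-finite = Q.classes , record
    { to = Q.class
    ; from = Q.member
    ; to-cong = class-cong
    ; from-cong = λ eq → IsEquivalence.reflexive ~-equiv (cong Q.member eq)
    ; inverse = (λ {i} f~ → trans (class-cong f~) (Q.class∘member i))
              , (λ {f} eq → IsEquivalence.trans ~-equiv (IsEquivalence.reflexive ~-equiv (cong Q.member eq)) (Q.member∘class f))
    }
    where
    ~-equiv = EqClosure.isEquivalence (FaceStep G R)
    module Q = Quotient (quotient ~-equiv Flag↔Fin steps steps-sound)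
    class-cong : ∀ {f f′} → EqClosure.EqClosure (FaceStep G R) f f′ → Q.class f ≡ Q.class f′
    class-cong = EqClosure.gfold isEquivalence Q.class (λ step → Q.identifies (steps-complete step))

-- Euler genus as the rank of a symmetric form

module Genus {G : Graph} (P : PlaneCubic G) where
  open Graph G
  open PlaneCubic P
  open PlaneCubicProperties P
  open Twisting P

  _⊕_ : (Fin faces → Bool) → (Fin faces → Bool) → Fin faces → Bool
  (x ⊕ z) w = x w xor z w

  δ-⊕ : ∀ x z e → δ (x ⊕ z) e ≡ δ x e xor δ z e
  δ-⊕ x z e = solve 4 (λ a b c d → (a :+ b) :+ (c :+ d) := (a :+ c) :+ (b :+ d)) refl
    (x (left (e , false))) (z (left (e , false))) (x (left (e , true))) (z (left (e , true)))

  δ-cong : ∀ {x z} → x ≗ z → ∀ e → δ x e ≡ δ z e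
  δ-cong x≗z e = cong₂ _xor_ (x≗z _) (x≗z _)

  -- For A = twist R the Gram matrix of form A is the Laplacian over GF(2) of the
  -- dual edges in A; its corank is the number of faces of R.
  form : (E → Bool) → (Fin faces → Bool) → (Fin faces → Bool) → Bool
  form A x z = sumE (λ e → (A e ∧ δ x e) ∧ δ z e)

  form-sym : ∀ A x z → form A x z ≡ form A z x
  form-sym A x z = sumE-cong λ e → solve 3 (λ a b c → (a :* b) :* c := (a :* c) :* b) refl (A e) (δ x e) (δ z e)

  form-additive : ∀ A x → Additive (form A x)
  form-additive A x = (λ eq → sumE-cong λ e → cong ((A e ∧ δ x e) ∧_) (δ-cong eq e))
    , λ z z′ → trans (sumE-cong λ e → trans (cong ((A e ∧ δ x e) ∧_) (δ-⊕ z z′ e)) (Boolₚ.∧-distribˡ-xor (A e ∧ δ x e) (δ z e) (δ z′ e)))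
                     (sumE-xor (λ e → (A e ∧ δ x e) ∧ δ z e) (λ e → (A e ∧ δ x e) ∧ δ z′ e))

  form-⊕ˡ : ∀ A x x′ z → form A (x ⊕ x′) z ≡ form A x z xor form A x′ z
  form-⊕ˡ A x x′ z = trans (form-sym A (x ⊕ x′) z) (trans (proj₂ (form-additive A z) x x′) (cong₂ _xor_ (form-sym A z x) (form-sym A z x′)))

  form-congˡ : ∀ A {x x′} → x ≗ x′ → ∀ z → form A x z ≡ form A x′ z
  form-congˡ A {x} {x′} eq z = trans (form-sym A x z) (trans (proj₁ (form-additive A z) eq) (form-sym A z x′))

  form-A-cong : ∀ {A A′} → (∀ e → A e ≡ A′ e) → ∀ x z → form A x z ≡ form A′ x z
  form-A-cong eq x z = sumE-cong λ e → cong (λ a → (a ∧ δ x e) ∧ δ z e) (eq e)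

  -- A record instead of a function type, so that unification recovers `A` and `x` from the type of
  -- a proof.
  record Kernel (A : E → Bool) (x : Fin faces → Bool) : Set where
    constructor kernel
    field annihilates : ∀ z → form A x z ≡ false
  open Kernel

  kernel-cong : ∀ A {x x′} → x ≗ x′ → Kernel A x → Kernel A x′
  kernel-cong A eq k = kernel λ z → trans (sym (form-congˡ A eq z)) (annihilates k z)

  kernel-⊕ : ∀ A {x x′} → Kernel A x → Kernel A x′ → Kernel A (x ⊕ x′)
  kernel-⊕ A {x} {x′} k k′ = kernel λ z → trans (form-⊕ˡ A x x′ z) (cong₂ _xor_ (annihilates k z) (annihilates k′ z))

  kernel-or-witness : ∀ A x → Kernel A x ⊎ ∃[ z ] form A x z ≡ true
  kernel-or-witness A x with allFunctions? faces
    (λ eq k → trans (sym (proj₁ (form-additive A x) eq)) k) (λ z → form A x z Boolₚ.≟ false)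
  ... | inj₁ k       = inj₁ (kernel k)
  ... | inj₂ (z , ≢) = inj₂ (z , Boolₚ.¬-not ≢)

  module _ (R : RotationSystem G) {f : ℕ} (I : HasCardinality (Faces G R) f) where
    private
      A = twist R
      module I = Inverse I

      colouring-invariant : ∀ (c : Fin f → Bool) → Invariant R (c ∘ I.to)
      colouring-invariant c step = cong c (I.to-cong (EqClosure.return step))

      Decomp : ∀ c → Decomposition R (c ∘ I.to)
      Decomp c = decompose R (colouring-invariant c)

    toKernel : (Fin f → Bool) → Fin faces → Bool
    toKernel c = Decomposition.x (Decomp c)

    -- A · `δ x` is the cut `∂ y`, and cuts are orthogonal to all `δ z`.
    toKernel-kernel : ∀ c → Kernel A (toKernel c)
    toKernel-kernel c = kernel λ z → trans (sumE-cong λ e → cong (_∧ δ z e) (sym (D.∂y e))) (cut-orthogonal D.y z)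
      where module D = Decomposition (Decomp c)

    -- The part `x` determines `∂ y`, and then `y` itself, because the graph is connected and `y`
    -- vanishes at `base`.
    toKernel-injective : ∀ {c d} → toKernel c ≗ toKernel d → c ≗ d
    toKernel-injective {c} {d} x≗ i = begin
      c i                                ≡⟨ cong c (I.strictlyInverseˡ i) ⟨
      c (I.to (I.from i))                ≡⟨ C.h≡ (I.from i) ⟩
      value R C.x C.y (I.from i)         ≡⟨ cong₂ _xor_ (y≗ (origin (proj₁ (I.from i)))) (x≗ (face R (I.from i))) ⟩
      value R D.x D.y (I.from i)         ≡⟨ D.h≡ (I.from i) ⟨
      d (I.to (I.from i))                ≡⟨ cong d (I.strictlyInverseˡ i) ⟩
      d i                                ∎
      where
      open ≡-Reasoning
      module C = Decomposition (Decomp c)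
      module D = Decomposition (Decomp d)
      ∂-sum : ∀ e → ∂ G (λ v → C.y v xor D.y v) e ≡ false
      ∂-sum e = begin
        ∂ G (λ v → C.y v xor D.y v) e          ≡⟨ solve 4 (λ a b c d → (a :+ b) :+ (c :+ d) := (a :+ c) :+ (b :+ d)) refl (C.y _) (D.y _) (C.y _) (D.y _) ⟩
        ∂ G C.y e xor ∂ G D.y e                ≡⟨ cong₂ _xor_ (trans (C.∂y e) (cong (A e ∧_) (δ-cong x≗ e))) (D.∂y e) ⟩
        (A e ∧ δ D.x e) xor (A e ∧ δ D.x e)    ≡⟨ Boolₚ.xor-same (A e ∧ δ D.x e) ⟩
        false                                  ∎
      y≗ : ∀ v → C.y v ≡ D.y v
      y≗ v = xor≡false⇒≡ (trans (connected ∂-sum v) (cong₂ _xor_ C.y-base D.y-base))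

    -- Membership in the kernel is precisely the orthogonality that `cut-is-∂` asks for in order to
    -- supply `y`.
    fromKernel : ∀ x → Kernel A x → Fin f → Bool
    fromKernel x k i = value R x (proj₁ (cut-is-∂ (λ e → A e ∧ δ x e) (annihilates k))) (I.from i)

    -- The jumps of the colouring across the edges give back `δ x`, and its value at the flag of
    -- `base-face` gives back `x` at one face.
    fromKernel-injective : ∀ {x z} (k : Kernel A x) (l : Kernel A z) → fromKernel x k ≗ fromKernel z l → x ≗ z
    fromKernel-injective {x} {z} k l eq w =
      xor≡false⇒≡ (trans (dual-connected δ-sum w) base-value)
      where
      open ≡-Reasoning
      y  = proj₁ (cut-is-∂ (λ e → A e ∧ δ x e) (annihilates k))
      y′ = proj₁ (cut-is-∂ (λ e → A e ∧ δ z e) (annihilates l))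
      value-class : ∀ {x} (k : Kernel A x) φ → let y = proj₁ (cut-is-∂ (λ e → A e ∧ δ x e) (annihilates k)) in
                    value R x y (I.from (I.to φ)) ≡ value R x y φ
      value-class {x} k φ = EqClosure.gfold isEquivalence (value R x yₓ)
        (value-invariant R x yₓ ∂yₓ) (I.strictlyInverseʳ φ)
        where
        yₓ = proj₁ (cut-is-∂ (λ e → A e ∧ δ x e) (annihilates k))
        ∂yₓ = proj₂ (proj₂ (cut-is-∂ (λ e → A e ∧ δ x e) (annihilates k)))
      value≡ : ∀ φ → value R x y φ ≡ value R z y′ φ
      value≡ φ = trans (sym (value-class k φ)) (trans (eq (I.to φ)) (value-class l φ))
      δ-sum : ∀ e → δ (x ⊕ z) e ≡ false
      δ-sum e = begin
        δ (x ⊕ z) e            ≡⟨ δ-⊕ x z e ⟩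
        δ x e xor δ z e        ≡⟨ cong₂ _xor_ (sym (value-sides R x y (e , false))) (sym (value-sides R z y′ (e , false))) ⟩
        (value R x y φ xor value R x y φ′) xor (value R z y′ φ xor value R z y′ φ′)
                               ≡⟨ cong₂ (λ a b → (a xor b) xor (value R z y′ φ xor value R z y′ φ′)) (value≡ φ) (value≡ φ′) ⟩
        (value R z y′ φ xor value R z y′ φ′) xor (value R z y′ φ xor value R z y′ φ′)
                               ≡⟨ Boolₚ.xor-same (value R z y′ φ xor value R z y′ φ′) ⟩
        false ∎
        where
        φ φ′ : Flag G
        φ  = (e , false) , false
        φ′ = (e , false) , true
      base-value : (x ⊕ z) (left (spoke base 0F)) ≡ false
      base-value = begin
        (x ⊕ z) (left (spoke base 0F))          ≡⟨ cong (λ w → x w xor z w) (base-face R) ⟨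
        x (face R φ) xor z (face R φ)           ≡⟨ cong₂ _xor_ (at-base x y (proj₁ (proj₂ (cut-is-∂ (λ e → A e ∧ δ x e) (annihilates k))))) (at-base z y′ (proj₁ (proj₂ (cut-is-∂ (λ e → A e ∧ δ z e) (annihilates l))))) ⟨
        value R x y φ xor value R z y′ φ        ≡⟨ cong (_xor value R z y′ φ) (value≡ φ) ⟩
        value R z y′ φ xor value R z y′ φ       ≡⟨ Boolₚ.xor-same (value R z y′ φ) ⟩
        false                                   ∎
        where
        φ : Flag G
        φ = spoke base 0F , flip R base
        at-base : ∀ x y → y base ≡ false → value R x y φ ≡ x (face R φ)
        at-base x y y0 = cong (_xor x (face R φ)) (trans (cong y (origin-spoke base 0F)) y0)

    private
      shift-injective : ∀ {u c d} → (toKernel c ⊕ u) ≗ (toKernel d ⊕ u) → c ≗ d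
      shift-injective {u} {c} {d} eq = toKernel-injective λ w →
        trans (solve 2 (λ a b → a := (a :+ b) :+ b) refl (toKernel c w) (u w))
              (trans (cong (_xor u w) (eq w)) (solve 2 (λ a b → (a :+ b) :+ b := a) refl (toKernel d w) (u w)))

      disjoint-cosets : ∀ {u u′ c d} → (toKernel c ⊕ u) ≗ (toKernel d ⊕ u′) → Kernel A (u ⊕ u′)
      disjoint-cosets {u} {u′} {c} {d} eq = kernel-cong A (λ w → trans
        (solve 4 (λ a b u u′ → a :+ b := ((a :+ u) :+ (b :+ u′)) :+ (u :+ u′)) refl (toKernel c w) (toKernel d w) (u w) (u′ w))
        (trans (cong (λ t → (t xor (toKernel d w xor u′ w)) xor (u w xor u′ w)) (eq w))
               (cong (_xor (u w xor u′ w)) (Boolₚ.xor-same (toKernel d w xor u′ w)))))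
        (kernel-⊕ A (toKernel-kernel c) (toKernel-kernel d))

    -- The image of `toKernel` lies in the kernel, so its translates by representatives of different
    -- cosets of the kernel are disjoint.
    cosets-bound : ∀ {k} (u : Fin k → Fin faces → Bool) →
                   (∀ i j → i ≢ j → ¬ Kernel A (u i ⊕ u j)) → k * 2 ^ f ≤ 2 ^ faces
    cosets-bound u apart = injection-bound _ (λ i c → toKernel c ⊕ u i) inj
      where
      inj : ∀ {i j c d} → (toKernel c ⊕ u i) ≗ (toKernel d ⊕ u j) → i ≡ j × c ≗ d
      inj {i} {j} eq with i Fin.≟ j
      ... | yes refl = refl , shift-injective {u i} eq
      ... | no i≢j   = contradiction (disjoint-cosets {u i} {u j} eq) (apart i j i≢j)

    faces-all : (∀ x → Kernel A x) → f ≡ faces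
    faces-all k = ℕₚ.≤-antisym f≤ ≤f
      where
      f≤ : f ≤ faces
      f≤ = 2^-cancel-≤ (subst (_≤ 2 ^ faces) (ℕₚ.*-identityˡ (2 ^ f))
        (injection-bound 1 (λ _ → toKernel) λ { {0F} {0F} eq → refl , toKernel-injective eq }))
      ≤f : faces ≤ f
      ≤f = 2^-cancel-≤ (subst (_≤ 2 ^ f) (ℕₚ.*-identityˡ (2 ^ faces))
        (injection-bound 1 (λ _ x → fromKernel x (k x)) λ { {0F} {0F} eq → refl , fromKernel-injective (k _) (k _) eq }))

    -- Two cosets give one inequality. For the other, `x` is encoded by a bit naming its coset of
    -- the kernel and the colouring that belongs to `x` or to `x ⊕ u`.
    faces-index-two : ∀ u → ¬ Kernel A u → (∀ x → Kernel A x ⊎ Kernel A (x ⊕ u)) → f + 1 ≡ faces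
    faces-index-two u ¬ku split = trans (ℕₚ.+-comm f 1) (ℕₚ.≤-antisym 1+f≤ ≤1+f)
      where
      1+f≤ : suc f ≤ faces
      1+f≤ = 2^-cancel-≤ (cosets-bound u′ apart)
        where
        u′ : Fin 2 → Fin faces → Bool
        u′ 0F = λ _ → false
        u′ 1F = u
        apart : ∀ i j → i ≢ j → ¬ Kernel A (u′ i ⊕ u′ j)
        apart 0F 0F ne = contradiction refl ne
        apart 0F 1F _  = ¬ku
        apart 1F 0F _  = ¬ku ∘ kernel-cong A (λ w → Boolₚ.xor-identityʳ (u w))
        apart 1F 1F ne = contradiction refl ne
      mark : Bool → (Fin f → Bool) → Fin (suc f) → Bool
      mark b c zero    = b
      mark b c (suc i) = c i
      code : ∀ x → Kernel A x ⊎ Kernel A (x ⊕ u) → Fin (suc f) → Bool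
      code x (inj₁ k) = mark false (fromKernel x k)
      code x (inj₂ k) = mark true (fromKernel (x ⊕ u) k)
      code-injective : ∀ {x z} s t → code x s ≗ code z t → x ≗ z
      code-injective (inj₁ k) (inj₁ l) eq = fromKernel-injective k l (eq ∘ suc)
      code-injective {x} {z} (inj₂ k) (inj₂ l) eq w = trans (solve 2 (λ a b → a := (a :+ b) :+ b) refl (x w) (u w))
        (trans (cong (_xor u w) (fromKernel-injective k l (eq ∘ suc) w)) (solve 2 (λ a b → (a :+ b) :+ b := a) refl (z w) (u w)))
      code-injective (inj₁ _) (inj₂ _) eq = case eq zero of λ ()
      code-injective (inj₂ _) (inj₁ _) eq = case eq zero of λ ()
      ≤1+f : faces ≤ suc f
      ≤1+f = 2^-cancel-≤ (subst (_≤ 2 ^ suc f) (ℕₚ.*-identityˡ (2 ^ faces))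
        (injection-bound 1 (λ _ x → code x (split x)) λ { {0F} {0F} eq → refl , code-injective (split _) (split _) eq }))

  -- The Gram matrix is w wᵀ, where w has the entries `φ (indicator i)`.
  RankOne : (E → Bool) → Set
  RankOne A = Σ[ φ ∈ ((Fin faces → Bool) → Bool) ]
    Additive φ × (∃[ x ] φ x ≡ true) × (∀ x z → form A x z ≡ φ x ∧ φ z)

  -- Constants have zero coboundary, so they lie in the kernel. Expanded in the standard basis, this
  -- says that the support of w is even.
  rankOne-const : ∀ {A} ((φ , _) : RankOne A) → φ (λ _ → true) ≡ false
  rankOne-const {A} (φ , _ , (x , φx) , form≡) = begin
    φ (λ _ → true)                ≡⟨ trans (cong (φ (λ _ → true) ∧_) φx) (Boolₚ.∧-identityʳ _) ⟨
    φ (λ _ → true) ∧ φ x          ≡⟨ form≡ (λ _ → true) x ⟨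
    form A (λ _ → true) x         ≡⟨ sumE-cong (λ e → cong (_∧ δ x e) (Boolₚ.∧-zeroʳ (A e))) ⟩
    sumE (λ _ → false)            ≡⟨ sum-zero {edges} (λ _ → refl) ⟩
    false                         ∎
    where open ≡-Reasoning

  -- Only `e` contributes to the sum when `x` and `z` separate it from the other edges; so the form
  -- determines A.
  form-separate : ∀ A e → let (x , z , _) = separate e in form A x z ≡ A e
  form-separate A e = trans
    (sumE-cong λ e′ → trans (Boolₚ.∧-assoc (A e′) (δ x e′) (δ z e′)) (trans (cong (A e′ ∧_) (sep e′)) (Boolₚ.∧-comm (A e′) _)))
    (sumE-point A e)
    where
    x = proj₁ (separate e)
    z = proj₁ (proj₂ (separate e))
    sep = proj₂ (proj₂ (separate e))

  -- Order and size are those of the plane embedding, so the genus is the loss of faces compared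
  -- with it.
  genus⇒faces : ∀ {R i} → HasEulerGenus G R i → ∃[ f ] HasCardinality (Faces G R) f × f + i ≡ faces
  genus⇒faces {R} {i} (S , embeds , refl) with euler-characteristic S embeds
    where
    euler-characteristic : ∀ S → EmbedsIn G R S → HasEulerCharacteristic G R (+ 2 ℤ.- + eulerGenus S)
    euler-characteristic (orientable _)    = proj₂
    euler-characteristic (nonOrientable _) = proj₂
  ... | f , I , χ = f , I , ℕₚ.+-cancelˡ-≡ order (f + i) faces
    (trans (sym (ℕₚ.+-assoc order f i)) (trans (euler⇒ order size f i χ) (sym euler)))

  faces⇒characteristic : ∀ {R f i} → HasCardinality (Faces G R) f → f + i ≡ faces → HasEulerCharacteristic G R (+ 2 ℤ.- + i)
  faces⇒characteristic {f = f} {i} I eq = f , I , euler⇐ order size f i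
    (trans (ℕₚ.+-assoc order f i) (trans (cong (_+_ order) eq) euler))

  genus-zero⇒ : ∀ {R} → HasEulerGenus G R 0 → ∀ e → twist R e ≡ false
  genus-zero⇒ {R} genus e with genus⇒faces {R} genus
  ... | f , I , f+0≡ = trans (sym (form-separate (twist R) e)) (annihilates (kernel-all (proj₁ (separate e))) (proj₁ (proj₂ (separate e))))
    where
    f≡ : f ≡ faces
    f≡ = trans (sym (ℕₚ.+-identityʳ f)) f+0≡
    kernel-all : ∀ x → Kernel (twist R) x
    kernel-all x with kernel-or-witness (twist R) x
    ... | inj₁ k = k
    -- An `x` outside the kernel gives two cosets, which is too much when `f` equals `faces`.
    ... | inj₂ (z , form≡) = contradiction (subst (λ n → 2 * 2 ^ f ≤ 2 ^ n) (sym f≡) (cosets-bound R I u apart))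
            (ℕₚ.<⇒≱ (ℕₚ.^-monoʳ-< 2 (ℕ.s≤s (ℕ.s≤s ℕ.z≤n)) (ℕₚ.n<1+n f)))
      where
      ¬k : ¬ Kernel (twist R) x
      ¬k k = case trans (sym form≡) (annihilates k z) of λ ()
      u : Fin 2 → Fin faces → Bool
      u 0F = λ _ → false
      u 1F = x
      apart : ∀ i j → i ≢ j → ¬ Kernel (twist R) (u i ⊕ u j)
      apart 0F 0F ne = contradiction refl ne
      apart 0F 1F _  = ¬k
      apart 1F 0F _  = ¬k ∘ kernel-cong (twist R) (λ w → Boolₚ.xor-identityʳ (x w))
      apart 1F 1F ne = contradiction refl ne

  genus-zero⇐ : ∀ {R} → (∀ e → twist R e ≡ false) → HasEulerGenus G R 0
  genus-zero⇐ {R} untwisted with faces-finite G R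
  ... | f , I = orientable 0 , ((flip R , λ e → xor≡false⇒≡ (untwisted e)) , characteristic) , refl
    where
    kernel-all : ∀ x → Kernel (twist R) x
    kernel-all x = kernel λ z → sum-zero {edges} λ i → cong (λ a → (a ∧ δ x _) ∧ δ z (Inverse.from enumerate i)) (untwisted _)
    characteristic = faces⇒characteristic {R} {f} {0} I (trans (ℕₚ.+-identityʳ f) (faces-all R I kernel-all))

  -- With `x₀` outside the kernel, every `x` lies in the kernel or in its translate by `x₀`, so
  -- `form A x` is zero or `φ`. That `φ x` decides which requires `φ x₀` to be true: `z₀` lies
  -- outside the kernel as well, hence in the coset of `x₀`, and `form A x₀ x₀` equals
  -- `form A z₀ x₀`.
  index-two⇒rankOne : ∀ A → (∀ x y → Kernel A x ⊎ Kernel A y ⊎ Kernel A (x ⊕ y)) →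
                      ∀ {x₀ z₀} → form A x₀ z₀ ≡ true → RankOne A
  index-two⇒rankOne A split {x₀} {z₀} form≡ = φ , form-additive A x₀ , (z₀ , form≡) , factor
    where
    φ : (Fin faces → Bool) → Bool
    φ = form A x₀
    not-both : ∀ {x} z → Kernel A x → form A x z ≢ true
    not-both z k eq = case trans (sym eq) (annihilates k z) of λ ()
    same : ∀ {x} → Kernel A (x ⊕ x₀) → ∀ z → form A x z ≡ φ z
    same {x} k z = xor≡false⇒≡ (trans (sym (form-⊕ˡ A x x₀ z)) (annihilates k z))
    φx₀ : φ x₀ ≡ true
    φx₀ with split z₀ x₀
    ... | inj₁ k        = contradiction (trans (form-sym A z₀ x₀) form≡) (not-both x₀ k)
    ... | inj₂ (inj₁ k) = contradiction form≡ (not-both z₀ k)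
    ... | inj₂ (inj₂ k) = trans (sym (same {z₀} k x₀)) (trans (form-sym A z₀ x₀) form≡)
    factor : ∀ x z → form A x z ≡ φ x ∧ φ z
    factor x z with split x x₀
    ... | inj₁ k        = trans (annihilates k z) (cong (_∧ φ z) (sym (trans (form-sym A x₀ x) (annihilates k x₀))))
    ... | inj₂ (inj₁ k) = contradiction form≡ (not-both z₀ k)
    ... | inj₂ (inj₂ k) = trans (same {x} k z) (cong (_∧ φ z) (sym (trans (form-sym A x₀ x) (trans (same {x} k x₀) φx₀))))

  genus-one⇒ : ∀ {R} → HasEulerGenus G R 1 → RankOne (twist R)
  genus-one⇒ {R} genus with genus⇒faces {R} genus
  ... | f , I , f+1≡ = by-cases (allFunctions? faces (λ eq k → kernel-cong A eq k) kernel?)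
    where
    A = twist R
    kernel? : ∀ x → Dec (Kernel A x)
    kernel? x with kernel-or-witness A x
    ... | inj₁ k        = yes k
    ... | inj₂ (z , eq) = no λ k → case trans (sym eq) (annihilates k z) of λ ()
    split : ∀ x y → Kernel A x ⊎ Kernel A y ⊎ Kernel A (x ⊕ y)
    split x y with kernel? x | kernel? y | kernel? (x ⊕ y)
    ... | yes k | _     | _     = inj₁ k
    ... | no _  | yes k | _     = inj₂ (inj₁ k)
    ... | no _  | no _  | yes k = inj₂ (inj₂ k)
    -- The cosets of 0, `x` and `y` would be distinct, but 3 * 2 ^ f exceeds 2 ^ (f + 1).
    ... | no kx | no ky | no kxy = contradiction
            (subst (λ n → 3 * 2 ^ f ≤ 2 ^ n) (trans (sym f+1≡) (ℕₚ.+-comm f 1)) (cosets-bound R I u apart))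
            (ℕₚ.<⇒≱ (ℕₚ.*-monoˡ-< (2 ^ f) {{ℕₚ.m^n≢0 2 f}} (ℕₚ.n<1+n 2)))
      where
      u : Fin 3 → Fin faces → Bool
      u 0F = λ _ → false
      u 1F = x
      u 2F = y
      apart : ∀ i j → i ≢ j → ¬ Kernel A (u i ⊕ u j)
      apart 0F 0F ne = contradiction refl ne
      apart 0F 1F _  = kx
      apart 0F 2F _  = ky
      apart 1F 0F _  = kx ∘ kernel-cong A (λ w → Boolₚ.xor-identityʳ (x w))
      apart 1F 1F ne = contradiction refl ne
      apart 1F 2F _  = kxy
      apart 2F 0F _  = ky ∘ kernel-cong A (λ w → Boolₚ.xor-identityʳ (y w))
      apart 2F 1F _  = kxy ∘ kernel-cong A (λ w → Boolₚ.xor-comm (y w) (x w))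
      apart 2F 2F ne = contradiction refl ne
    by-cases : (∀ x → Kernel A x) ⊎ (∃[ x ] ¬ Kernel A x) → RankOne A
    by-cases (inj₁ all) = contradiction (trans f+1≡ (sym (faces-all R I all))) (ℕₚ.m+1+n≢m f)
    by-cases (inj₂ (x , ¬k)) with kernel-or-witness A x
    ... | inj₁ k        = contradiction k ¬k
    ... | inj₂ (z , eq) = index-two⇒rankOne A split {x} {z} eq

  genus-one⇐ : ∀ {R} → RankOne (twist R) → HasEulerGenus G R 1
  genus-one⇐ {R} (φ , (φ-cong , φ-add) , (u , φu) , form≡) with faces-finite G R
  ... | f , I = nonOrientable 1 , (non-orientable , faces⇒characteristic {R} {f} {1} I (faces-index-two R I u ¬ku split)) , refl
    where
    A = twist R
    φ≡false⇒kernel : ∀ {x} → φ x ≡ false → Kernel A x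
    φ≡false⇒kernel {x} φx = kernel λ z → trans (form≡ x z) (cong (_∧ φ z) φx)
    ¬ku : ¬ Kernel A u
    ¬ku k = case trans (sym (cong₂ _∧_ φu φu)) (trans (sym (form≡ u u)) (annihilates k u)) of λ ()
    split : ∀ x → Kernel A x ⊎ Kernel A (x ⊕ u)
    split x with φ x in eq
    ... | false = inj₁ (φ≡false⇒kernel eq)
    ... | true  = inj₂ (φ≡false⇒kernel (trans (φ-add x u) (cong₂ _xor_ eq φu)))
    -- An orientable R has twist R = ∂ y, but then form (twist R) u u would vanish.
    non-orientable : ¬ Orientable G R
    non-orientable (s , τ≡) = case trans (sym (cong₂ _∧_ φu φu)) (trans (sym (form≡ u u)) zero-form) of λ ()
      where
      y : V → Bool
      y v = s v xor flip R v
      A≡∂y : ∀ e → A e ≡ ∂ G y e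
      A≡∂y e = trans (cong (_xor ∂ G (flip R) e) (τ≡ e))
        (solve 4 (λ a b c d → (a :+ b) :+ (c :+ d) := (a :+ c) :+ (b :+ d)) refl (s _) (s _) (flip R _) (flip R _))
      zero-form : form A u u ≡ false
      zero-form = trans (sumE-cong λ e → trans (Boolₚ.∧-assoc (A e) (δ u e) (δ u e))
        (cong₂ _∧_ (A≡∂y e) (Boolₚ.∧-idem (δ u e)))) (cut-orthogonal y u)

-- Counting T-rotation systems by their sets of twisted edges

reverses-turn : ∀ b → reverses (turn b) ≡ b
reverses-turn false = refl
reverses-turn true  = refl

module Counting {G : Graph} (P : PlaneCubic G) {T : Graph.E G → Bool} (tree : IsSpanningTree G T) where
  open Graph G
  open PlaneCubic P
  open PlaneCubicProperties P
  open Twisting P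

  private
    module RS = RotationSystem

  flip-cong : ∀ {R R′ : RotationSystem G} → (∀ d → RS.next R d ≡ RS.next R′ d) → ∀ v → flip R v ≡ flip R′ v
  flip-cong eq v = cong (λ d → not (does (place d Fin.≟ 1F))) (eq (spoke v 0F))

  twist-cong : ∀ {R R′ : RotationSystem G} → (∀ d → RS.next R d ≡ RS.next R′ d) → (∀ e → RS.τ R e ≡ RS.τ R′ e) →
               ∀ e → twist R e ≡ twist R′ e
  twist-cong {R} {R′} next≡ τ≡ e = cong₂ _xor_ (τ≡ e) (cong₂ _xor_ (flip-cong {R} {R′} next≡ _) (flip-cong {R} {R′} next≡ _))

  flip-flippedBy : ∀ s τ v → flip (flippedBy s τ) v ≡ s v
  flip-flippedBy s τ v = trans (cong (λ k → not (does (k Fin.≟ 1F))) ρ₀) (reverses-turn (s v))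
    where
    ρ₀ : place (turnAt (s (origin (spoke v 0F))) (spoke v 0F)) ≡ turn (s v) 0F
    ρ₀ = trans (cong place (trans (cong (λ u → turnAt (s u) (spoke v 0F)) (origin-spoke v 0F)) (turnAt-spoke (s v) v 0F)))
               (place-spoke v _)

  module _ {i n : ℕ} {Code : Set} (Code↔Fin : Code ↔ Fin n) (pat : Code → E → Bool)
           (pat-injective : ∀ {c c′} → (∀ e → pat c e ≡ pat c′ e) → c ≡ c′)
           (complete : ∀ R → HasEulerGenus G R i → ∃[ c ] (∀ e → twist R e ≡ pat c e))
           (sound : ∀ R c → (∀ e → twist R e ≡ pat c e) → HasEulerGenus G R i) where

    private
      open Inverse Code↔Fin using () renaming (to to index; from to codeAt)

      flips : Bool → Code → V → Bool
      flips b c = proj₁ (potential-exists G tree (pat c) base b)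

      flips-base : ∀ b c → flips b c base ≡ b
      flips-base b c = proj₁ (proj₂ (potential-exists G tree (pat c) base b))

      flips-∂ : ∀ b c e → T e ≡ true → ∂ G (flips b c) e ≡ pat c e
      flips-∂ b c = proj₂ (proj₂ (potential-exists G tree (pat c) base b))

      -- Undoing the flips must leave the pattern, which forces this formula; `flips b c` is a
      -- potential of the pattern on T, so no edge of T is twisted.
      twists : Bool → Code → E → Bool
      twists b c e = pat c e xor ∂ G (flips b c) e

      system : Bool → Code → RotationSystem G
      system b c = flippedBy (flips b c) (twists b c)

      system-tree : ∀ b c → IsTRotationSystem G T (system b c)
      system-tree b c e t = trans (cong (pat c e xor_) (flips-∂ b c e t)) (Boolₚ.xor-same (pat c e))

      system-twist : ∀ b c e → twist (system b c) e ≡ pat c e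
      system-twist b c e = trans
        (cong (twists b c e xor_) (cong₂ _xor_ (flip-flippedBy (flips b c) (twists b c) _) (flip-flippedBy (flips b c) (twists b c) _)))
        (solve 2 (λ a b → (a :+ b) :+ b := a) refl (pat c e) (∂ G (flips b c) e))

      Embeddings = TRotationSystems G T i
      open Setoid Embeddings using (Carrier; _≈_)

      embedding : Bool → Code → Carrier
      embedding b c = system b c , system-tree b c , sound (system b c) c (system-twist b c)

      code : Carrier → Code
      code (R , _ , genus) = proj₁ (complete R genus)

      code-twist : ∀ R e → twist (proj₁ R) e ≡ pat (code R) e
      code-twist (R , _ , genus) = proj₂ (complete R genus)

      label : Carrier → Bool × Code
      label R = flip (proj₁ R) base , code R

      label-cong : ∀ R R′ → R ≈ R′ → label R ≡ label R′
      label-cong R R′ (next≡ , τ≡) = cong₂ _,_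
        (flip-cong {proj₁ R} {proj₁ R′} next≡ base)
        (pat-injective λ e → trans (sym (code-twist R e)) (trans (twist-cong {proj₁ R} {proj₁ R′} next≡ τ≡ e) (code-twist R′ e)))

      abstract
        Label↔Fin : (Bool × Code) ↔ Fin (2 * n)
        Label↔Fin = ↔-sym Finₚ.*↔× ↔-∘ (↔-sym Finₚ.2↔Bool ×-↔ Code↔Fin)

        labelled : Bool × Code → Carrier
        labelled (b , c) = embedding b c

        label-labelled : ∀ l → label (labelled l) ≡ l
        label-labelled (b , c) = cong₂ _,_
          (trans (flip-flippedBy (flips b c) (twists b c) base) (flips-base b c))
          (pat-injective λ e → trans (sym (code-twist (embedding b c) e)) (system-twist b c e))

        -- On T both `flips b c` and `flip R` have the pattern as coboundary, because `R` is
        -- untwisted there. They agree at `base` and T is connected, so they agree everywhere; the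
        -- twists follow.
        labelled-label : ∀ R → labelled (label R) ≈ R
        labelled-label (R , tree-R , genus) =
          (λ d → trans (cong (λ b → turnAt b d) (flips≡ (origin d))) (sym (next-turns R d))) , τ≡
          where
          c : Code
          c = code (R , tree-R , genus)
          b : Bool
          b = flip R base
          ∂flip : ∀ e → ∂ G (flip R) e ≡ RS.τ R e xor pat c e
          ∂flip e = trans (solve 2 (λ a b → b := a :+ (a :+ b)) refl (RS.τ R e) (∂ G (flip R) e))
                          (cong (RS.τ R e xor_) (code-twist (R , tree-R , genus) e))
          flips≡ : ∀ v → flips b c v ≡ flip R v
          flips≡ = potential-unique G (proj₁ tree)
            (λ e t → trans (flips-∂ b c e t) (sym (trans (∂flip e) (cong (_xor pat c e) (tree-R e t)))))
            (flips-base b c)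
          τ≡ : ∀ e → twists b c e ≡ RS.τ R e
          τ≡ e = trans (cong (pat c e xor_) (trans (cong₂ _xor_ (flips≡ (proj₁ (ends e))) (flips≡ (proj₂ (ends e)))) (∂flip e)))
                       (solve 2 (λ p t → p :+ (t :+ p) := t) refl (pat c e) (RS.τ R e))

      labelled-cong : ∀ {k l} → k ≡ l → labelled k ≈ labelled l
      labelled-cong {k} refl = Setoid.refl Embeddings {labelled k}

    number-of-embeddings : NumberOfEmbeddings G T i (2 * n)
    number-of-embeddings = record
      { to = λ R → J.to (label R)
      ; from = λ k → labelled (J.from k)
      ; to-cong = λ {R} {R′} R≈R′ → cong J.to (label-cong R R′ R≈R′)
      ; from-cong = λ {k} {l} k≡l → labelled-cong {J.from k} {J.from l} (cong J.from k≡l)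
      ; inverse = (λ {k} {R} R≈ → trans (cong J.to (trans (label-cong R (labelled (J.from k)) R≈) (label-labelled (J.from k)))) (J.strictlyInverseˡ k))
                , (λ {R} {k} k≡ → Setoid.trans Embeddings {labelled (J.from k)} {labelled (label R)} {R}
                    (labelled-cong {J.from k} {label R} (trans (cong J.from k≡) (J.strictlyInverseʳ (label R)))) (labelled-label R))
      }
      where module J = Inverse Label↔Fin

-- The faces of a caterpillar-Halin graph

_≟ˢ_ : DecidableEquality Side
above ≟ˢ above = yes refl
above ≟ˢ below = no λ ()
below ≟ˢ above = no λ ()
below ≟ˢ below = yes refl

lastFace : Side → Fin 2
lastFace above = 0F
lastFace below = 1F

-- An inner face is named after the right end of its rim edge: the face j ↑ˡ 2
-- ends at the leaf u j, the faces ℓ ↑ʳ lastFace s end at the last path vertex.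
-- facing s xs i is the face on side s of the path edge i.
first : ∀ {ℓ} → Side → Vec Side ℓ → Fin (ℓ + 2)
first s     []           = lastFace s
first above (above ∷ xs) = zero
first above (below ∷ xs) = suc (first above xs)
first below (above ∷ xs) = suc (first below xs)
first below (below ∷ xs) = zero

facing : ∀ {ℓ} → Side → Vec Side ℓ → Fin (suc ℓ) → Fin (ℓ + 2)
facing s xs       zero    = first s xs
facing s (x ∷ xs) (suc i) = suc (facing s xs i)

sideOf : ∀ {ℓ} → Vec Side ℓ → Fin (ℓ + 2) → Side
sideOf []       0F      = above
sideOf []       1F      = below
sideOf (x ∷ xs) zero    = x
sideOf (x ∷ xs) (suc w) = sideOf xs w

sideOf-first : ∀ {ℓ} s (xs : Vec Side ℓ) → sideOf xs (first s xs) ≡ s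
sideOf-first above []           = refl
sideOf-first below []           = refl
sideOf-first above (above ∷ xs) = refl
sideOf-first above (below ∷ xs) = sideOf-first above xs
sideOf-first below (above ∷ xs) = sideOf-first below xs
sideOf-first below (below ∷ xs) = refl

sideOf-facing : ∀ {ℓ} s (xs : Vec Side ℓ) i → sideOf xs (facing s xs i) ≡ s
sideOf-facing s xs       zero    = sideOf-first s xs
sideOf-facing s (x ∷ xs) (suc i) = sideOf-facing s xs i

-- At an inner path vertex the face changes only on the side of the leaf.
facing-stays : ∀ {ℓ} (xs : Vec Side ℓ) j → let s = opposite (lookup xs j) in
               facing s xs (inject₁ j) ≡ facing s xs (suc j)
facing-stays (above ∷ xs) zero    = refl
facing-stays (below ∷ xs) zero    = refl
facing-stays (x ∷ xs)     (suc j) = cong suc (facing-stays xs j)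

facing-leaf : ∀ {ℓ} (xs : Vec Side ℓ) j → facing (lookup xs j) xs (inject₁ j) ≡ j ↑ˡ 2
facing-leaf (above ∷ xs) zero    = refl
facing-leaf (below ∷ xs) zero    = refl
facing-leaf (x ∷ xs)     (suc j) = cong suc (facing-leaf xs j)

facing-last : ∀ {ℓ} s (xs : Vec Side ℓ) → facing s xs (fromℕ ℓ) ≡ ℓ ↑ʳ lastFace s
facing-last s []       = refl
facing-last s (x ∷ xs) = cong suc (facing-last s xs)

toℕ≤facing : ∀ {ℓ} s (xs : Vec Side ℓ) i → toℕ i ≤ toℕ (facing s xs i)
toℕ≤facing s xs       zero    = ℕ.z≤n
toℕ≤facing s (x ∷ xs) (suc i) = ℕ.s≤s (toℕ≤facing s xs i)

-- Along the path a face that has been left is never met again, and every inner vertex leaves one.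
facing-injective : ∀ {ℓ} (xs : Vec Side ℓ) {i j} →
  facing above xs i ≡ facing above xs j → facing below xs i ≡ facing below xs j → i ≡ j
facing-injective xs           {zero}  {zero}  p q = refl
facing-injective (x ∷ xs)     {suc i} {suc j} p q =
  cong suc (facing-injective xs (Finₚ.suc-injective p) (Finₚ.suc-injective q))
facing-injective (above ∷ xs) {zero}  {suc j} () q
facing-injective (below ∷ xs) {zero}  {suc j} p ()
facing-injective (above ∷ xs) {suc i} {zero}  () q
facing-injective (below ∷ xs) {suc i} {zero}  p ()

-- The face to the east of leaf edge `j`; the one to its west is `j ↑ˡ 2`.
leafFaceʳ : ∀ {ℓ} → Vec Side ℓ → Fin ℓ → Fin (ℓ + 2)
leafFaceʳ xs j = facing (lookup xs j) xs (suc j)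

leafFace-sides : ∀ {ℓ} (xs : Vec Side ℓ) j → sideOf xs (j ↑ˡ 2) ≡ lookup xs j
leafFace-sides (x ∷ xs) zero    = refl
leafFace-sides (x ∷ xs) (suc j) = leafFace-sides xs j

leafFace-< : ∀ {ℓ} (xs : Vec Side ℓ) j → toℕ (j ↑ˡ 2) < toℕ (leafFaceʳ xs j)
leafFace-< xs j = subst (_< toℕ (leafFaceʳ xs j)) (sym (Finₚ.toℕ-↑ˡ j 2)) (toℕ≤facing (lookup xs j) xs (suc j))

-- The leaf at the left end of a rim edge, if this is not v zero.
leftLeaf : ∀ {ℓ} → Vec Side ℓ → Fin (ℓ + 2) → Maybe (Fin ℓ)
leftLeaf []       w       = nothing
leftLeaf (x ∷ xs) zero    = nothing
leftLeaf (x ∷ xs) (suc w) with leftLeaf xs w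
... | just j  = just (suc j)
... | nothing = if does (sideOf xs w ≟ˢ x) then just zero else nothing

leftLeaf-first : ∀ {ℓ} s (xs : Vec Side ℓ) → leftLeaf xs (first s xs) ≡ nothing
leftLeaf-first s     []           = refl
leftLeaf-first above (above ∷ xs) = refl
leftLeaf-first above (below ∷ xs) rewrite leftLeaf-first above xs | sideOf-first above xs = refl
leftLeaf-first below (above ∷ xs) rewrite leftLeaf-first below xs | sideOf-first below xs = refl
leftLeaf-first below (below ∷ xs) = refl

leftLeaf-leafFaceʳ : ∀ {ℓ} (xs : Vec Side ℓ) j → leftLeaf xs (leafFaceʳ xs j) ≡ just j
leftLeaf-leafFaceʳ (above ∷ xs) zero rewrite leftLeaf-first above xs | sideOf-first above xs = refl
leftLeaf-leafFaceʳ (below ∷ xs) zero rewrite leftLeaf-first below xs | sideOf-first below xs = refl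
leftLeaf-leafFaceʳ (x ∷ xs) (suc j) rewrite leftLeaf-leafFaceʳ xs j = refl

-- Together with `RightEnd` this finds the two ends of the rim edge `w`, and so the place of its
-- darts among the spokes there.
data LeftEnd {ℓ} (xs : Vec Side ℓ) : Fin (ℓ + 2) → Set where
  start : ∀ s → LeftEnd xs (first s xs)
  leaf  : ∀ j → LeftEnd xs (leafFaceʳ xs j)

leftEnd : ∀ {ℓ} (xs : Vec Side ℓ) w → LeftEnd xs w
leftEnd []           0F      = start above
leftEnd []           1F      = start below
leftEnd (above ∷ xs) zero    = start above
leftEnd (below ∷ xs) zero    = start below
leftEnd (x ∷ xs)     (suc w) with leftEnd xs w
leftEnd (above ∷ xs) (suc _) | start above = leaf zero
leftEnd (above ∷ xs) (suc _) | start below = start below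
leftEnd (below ∷ xs) (suc _) | start above = start above
leftEnd (below ∷ xs) (suc _) | start below = leaf zero
leftEnd (x ∷ xs)     (suc _) | leaf j      = leaf (suc j)

data RightEnd {ℓ} : Fin (ℓ + 2) → Set where
  leaf : ∀ j → RightEnd (j ↑ˡ 2)
  end  : ∀ s → RightEnd (ℓ ↑ʳ lastFace s)

rightEnd : ∀ {ℓ} w → RightEnd {ℓ} w
rightEnd {zero}  0F      = end above
rightEnd {zero}  1F      = end below
rightEnd {suc ℓ} zero    = leaf zero
rightEnd {suc ℓ} (suc w) with rightEnd w
... | leaf j = leaf (suc j)
... | end s  = end s

sideOf-last : ∀ {ℓ} s (xs : Vec Side ℓ) → sideOf xs (ℓ ↑ʳ lastFace s) ≡ s
sideOf-last above []       = refl
sideOf-last below []       = refl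
sideOf-last s     (x ∷ xs) = sideOf-last s xs

-- The vertices are abstracted to `A`, since the induction in `pairs-facesOn` moves the start `a` to
-- a leaf and shifts `g`.
leftVertex : ∀ {ℓ} {A : Set} → A → (Fin ℓ → A) → Vec Side ℓ → Fin (ℓ + 2) → A
leftVertex a g xs w = maybe g a (leftLeaf xs w)

rightVertex : ∀ {ℓ} {A : Set} → (Fin ℓ → A) → A → Fin (ℓ + 2) → A
rightVertex {ℓ} g z w = [ g , (λ _ → z) ]′ (splitAt ℓ w)

-- H with its rim edges indexed by the inner faces, oriented along C.
module Strip {ℓ : ℕ} (xs : Vec Side ℓ) where
  open CaterpillarHalin xs using (Vertex; v; u; pathEdge; leafEdge; rimEdge)

  StripEdge : Set
  StripEdge = Fin (suc ℓ) ⊎ Fin ℓ ⊎ Fin (ℓ + 2)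

  first-v last-v : Vertex
  first-v = v zero
  last-v  = v (fromℕ (suc ℓ))

  westEnd eastEnd : Fin (ℓ + 2) → Vertex
  westEnd = leftVertex first-v (λ j → u j) xs
  eastEnd = rightVertex (λ j → u j) last-v

  -- C runs eastward above the path and westward below, so its left side is always the outer face.
  rimEnds : Side → Fin (ℓ + 2) → Vertex × Vertex
  rimEnds above w = westEnd w , eastEnd w
  rimEnds below w = eastEnd w , westEnd w

  stripEnds : StripEdge → Vertex × Vertex
  stripEnds (pathEdge i) = v (inject₁ i) , v (suc i)
  stripEnds (leafEdge j) = v (suc (inject₁ j)) , u j
  stripEnds (rimEdge w)  = rimEnds (sideOf xs w) w

  StripEdge↔Fin : StripEdge ↔ Fin (suc ℓ + (ℓ + (ℓ + 2)))
  StripEdge↔Fin = ↔-sym Finₚ.+↔⊎ ↔-∘ (↔-id _ ⊎-↔ ↔-sym Finₚ.+↔⊎)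

  strip : Graph
  strip = record
    { V        = Vertex
    ; E        = StripEdge
    ; order    = (2 + ℓ) + ℓ
    ; size     = suc ℓ + (ℓ + (ℓ + 2))
    ; V-finite = ↔-sym Finₚ.+↔⊎
    ; E-finite = StripEdge↔Fin
    ; ends     = stripEnds
    }

  open Graph strip using (Dart; origin; rev; edge)

  eastward westward : Fin (ℓ + 2) → Dart
  eastward w = rimEdge w , isBelow (sideOf xs w)
  westward w = rimEdge w , isAbove (sideOf xs w)

  origin-eastward : ∀ w → origin (eastward w) ≡ westEnd w
  origin-eastward w with sideOf xs w in eq
  ... | above = cong (λ s → proj₁ (rimEnds s w)) eq
  ... | below = cong (λ s → proj₂ (rimEnds s w)) eq

  origin-westward : ∀ w → origin (westward w) ≡ eastEnd w
  origin-westward w with sideOf xs w in eq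
  ... | above = cong (λ s → proj₂ (rimEnds s w)) eq
  ... | below = cong (λ s → proj₁ (rimEnds s w)) eq

  westEnd-first : ∀ s → westEnd (first s xs) ≡ first-v
  westEnd-first s = cong (maybe _ _) (leftLeaf-first s xs)

  westEnd-leafFaceʳ : ∀ j → westEnd (leafFaceʳ xs j) ≡ u j
  westEnd-leafFaceʳ j = cong (maybe _ _) (leftLeaf-leafFaceʳ xs j)

  eastEnd-leaf : ∀ j → eastEnd (j ↑ˡ 2) ≡ u j
  eastEnd-leaf j = cong [ _ , _ ]′ (Finₚ.splitAt-↑ˡ ℓ j 2)

  eastEnd-last : ∀ s → eastEnd (ℓ ↑ʳ lastFace s) ≡ last-v
  eastEnd-last s = cong [ _ , _ ]′ (Finₚ.splitAt-↑ʳ ℓ 2 (lastFace s))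

  -- Clockwise from the west: a leaf above comes before the eastern path edge, a leaf below after
  -- it.
  innerSpoke : Side → Fin ℓ → Fin 3 → Dart
  innerSpoke s     j 0F = pathEdge (inject₁ j) , true
  innerSpoke above j 1F = leafEdge j , false
  innerSpoke above j 2F = pathEdge (suc j) , false
  innerSpoke below j 1F = pathEdge (suc j) , false
  innerSpoke below j 2F = leafEdge j , false

  pathSpoke : ∀ {i : Fin (suc ℓ)} → View i → Fin 3 → Dart
  pathSpoke (‵inj₁ {i = j} _) k  = innerSpoke (lookup xs j) j k
  pathSpoke ‵fromℕ            0F = pathEdge (fromℕ ℓ) , true
  pathSpoke ‵fromℕ            1F = westward (ℓ ↑ʳ 0F)
  pathSpoke ‵fromℕ            2F = westward (ℓ ↑ʳ 1F)

  leafSpoke : Side → Fin ℓ → Fin 3 → Dart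
  leafSpoke s     j 0F = leafEdge j , true
  leafSpoke above j 1F = westward (j ↑ˡ 2)
  leafSpoke above j 2F = eastward (leafFaceʳ xs j)
  leafSpoke below j 1F = eastward (leafFaceʳ xs j)
  leafSpoke below j 2F = westward (j ↑ˡ 2)

  spoke : Vertex → Fin 3 → Dart
  spoke (v zero)    0F = eastward (first above xs)
  spoke (v zero)    1F = pathEdge zero , false
  spoke (v zero)    2F = eastward (first below xs)
  spoke (v (suc i)) k  = pathSpoke (view i) k
  spoke (u j)       k  = leafSpoke (lookup xs j) j k

  -- `second s` is the place of the leaf edge at its path vertex and of the westward rim dart at a
  -- leaf or at `last-v`; `third s` is that of the eastern path edge and of the eastward rim dart at
  -- a leaf.
  second third : Side → Fin 3
  second above = 1F
  second below = 2F
  third above = 2F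
  third below = 1F

  placeEast : Maybe (Fin ℓ) → Side → Fin 3
  placeEast nothing  above = 0F
  placeEast nothing  below = 2F
  placeEast (just _) s     = third s

  placeRim : Side → Bool → Fin (ℓ + 2) → Fin 3
  placeRim above false w = placeEast (leftLeaf xs w) above
  placeRim above true  w = second above
  placeRim below true  w = placeEast (leftLeaf xs w) below
  placeRim below false w = second below

  place : Dart → Fin 3
  place (pathEdge i       , true)  = 0F
  place (pathEdge zero    , false) = 1F
  place (pathEdge (suc j) , false) = third (lookup xs j)
  place (leafEdge j       , false) = second (lookup xs j)
  place (leafEdge j       , true)  = 0F
  place (rimEdge w        , b)     = placeRim (sideOf xs w) b w

  place-eastward : ∀ w → place (eastward w) ≡ placeEast (leftLeaf xs w) (sideOf xs w)
  place-eastward w with sideOf xs w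
  ... | above = refl
  ... | below = refl

  place-westward : ∀ w → place (westward w) ≡ second (sideOf xs w)
  place-westward w with sideOf xs w
  ... | above = refl
  ... | below = refl

  place-eastward-first : ∀ s → place (eastward (first s xs)) ≡ placeEast nothing s
  place-eastward-first s = trans (place-eastward (first s xs)) (cong₂ placeEast (leftLeaf-first s xs) (sideOf-first s xs))

  place-eastward-leaf : ∀ j → place (eastward (leafFaceʳ xs j)) ≡ third (lookup xs j)
  place-eastward-leaf j = trans (place-eastward (leafFaceʳ xs j)) (cong₂ placeEast (leftLeaf-leafFaceʳ xs j) (sideOf-facing (lookup xs j) xs (suc j)))

  place-westward-leaf : ∀ j → place (westward (j ↑ˡ 2)) ≡ second (lookup xs j)
  place-westward-leaf j = trans (place-westward (j ↑ˡ 2)) (cong second (leafFace-sides xs j))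

  place-westward-last : ∀ s → place (westward (ℓ ↑ʳ lastFace s)) ≡ second s
  place-westward-last s = trans (place-westward (ℓ ↑ʳ lastFace s)) (cong second (sideOf-last s xs))

  rim-dart : ∀ w b → (rimEdge w , b) ≡ eastward w ⊎ (rimEdge w , b) ≡ westward w
  rim-dart w b with sideOf xs w
  rim-dart w false | above = inj₁ refl
  rim-dart w false | below = inj₂ refl
  rim-dart w true  | above = inj₂ refl
  rim-dart w true  | below = inj₁ refl

  spoke-view : ∀ {i} (t : View i) k → spoke (v (suc i)) k ≡ pathSpoke t k
  spoke-view ‵fromℕ    k = cong (λ t → pathSpoke t k) (view-fromℕ ℓ)
  spoke-view (‵inj₁ {i = j} t) k rewrite view-inject₁ j = refl

  spoke-inner : ∀ j k → spoke (v (suc (inject₁ j))) k ≡ innerSpoke (lookup xs j) j k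
  spoke-inner j k rewrite view-inject₁ j = refl

  spoke-last : ∀ k → spoke last-v k ≡ pathSpoke ‵fromℕ k
  spoke-last k = spoke-view ‵fromℕ k

  spoke-placeEast-first : ∀ s → spoke first-v (placeEast nothing s) ≡ eastward (first s xs)
  spoke-placeEast-first above = refl
  spoke-placeEast-first below = refl

  leafSpoke-third : ∀ s j → leafSpoke s j (third s) ≡ eastward (leafFaceʳ xs j)
  leafSpoke-third above j = refl
  leafSpoke-third below j = refl

  leafSpoke-second : ∀ s j → leafSpoke s j (second s) ≡ westward (j ↑ˡ 2)
  leafSpoke-second above j = refl
  leafSpoke-second below j = refl

  spoke-place-eastward : ∀ {w} → LeftEnd xs w → spoke (origin (eastward w)) (place (eastward w)) ≡ eastward w
  spoke-place-eastward (start s) = trans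
    (cong₂ spoke (trans (origin-eastward (first s xs)) (westEnd-first s)) (place-eastward-first s)) (spoke-placeEast-first s)
  spoke-place-eastward (leaf j) = trans
    (cong₂ spoke (trans (origin-eastward (leafFaceʳ xs j)) (westEnd-leafFaceʳ j)) (place-eastward-leaf j)) (leafSpoke-third (lookup xs j) j)

  spoke-place-westward : ∀ {w} → RightEnd w → spoke (origin (westward w)) (place (westward w)) ≡ westward w
  spoke-place-westward (leaf j) = trans
    (cong₂ spoke (trans (origin-westward (j ↑ˡ 2)) (eastEnd-leaf j)) (place-westward-leaf j)) (leafSpoke-second (lookup xs j) j)
  spoke-place-westward (end s) = trans
    (cong₂ spoke (trans (origin-westward (ℓ ↑ʳ lastFace s)) (eastEnd-last s)) (place-westward-last s)) (trans (spoke-last (second s)) (lasts s))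
    where
    lasts : ∀ s → pathSpoke ‵fromℕ (second s) ≡ westward (ℓ ↑ʳ lastFace s)
    lasts above = refl
    lasts below = refl

  spoke-place : ∀ d → spoke (origin d) (place d) ≡ d
  spoke-place (pathEdge zero , false) = refl
  spoke-place (pathEdge (suc j) , false) = trans (spoke-inner j (third (lookup xs j))) (thirds (lookup xs j))
    where
    thirds : ∀ s → innerSpoke s j (third s) ≡ (pathEdge (suc j) , false)
    thirds above = refl
    thirds below = refl
  spoke-place (pathEdge i , true) = at (view i)
    where
    at : ∀ {i} → View i → spoke (v (suc i)) 0F ≡ (pathEdge i , true)
    at ‵fromℕ            = spoke-last 0F
    at (‵inj₁ {i = j} _) = spoke-inner j 0F
  spoke-place (leafEdge j , false) = trans (spoke-inner j (second (lookup xs j))) (seconds (lookup xs j))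
    where
    seconds : ∀ s → innerSpoke s j (second s) ≡ (leafEdge j , false)
    seconds above = refl
    seconds below = refl
  spoke-place (leafEdge j , true) = refl
  spoke-place (rimEdge w , b) with rim-dart w b
  ... | inj₁ eq = subst (λ d → spoke (origin d) (place d) ≡ d) (sym eq) (spoke-place-eastward (leftEnd xs w))
  ... | inj₂ eq = subst (λ d → spoke (origin d) (place d) ≡ d) (sym eq) (spoke-place-westward (rightEnd w))

  private
    Fits : Vertex → Fin 3 → Dart → Set
    Fits x k d = origin d ≡ x × place d ≡ k

  pathSpoke-fits : ∀ {i} (t : View i) k → Fits (v (suc i)) k (pathSpoke t k)
  pathSpoke-fits (‵inj₁ {i = j} _) 0F = refl , refl
  pathSpoke-fits (‵inj₁ {i = j} _) 1F with lookup xs j in eq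
  ... | above = refl , cong second eq
  ... | below = refl , cong third eq
  pathSpoke-fits (‵inj₁ {i = j} _) 2F with lookup xs j in eq
  ... | above = refl , cong third eq
  ... | below = refl , cong second eq
  pathSpoke-fits ‵fromℕ 0F = refl , refl
  pathSpoke-fits ‵fromℕ 1F = trans (origin-westward (ℓ ↑ʳ 0F)) (eastEnd-last above) , place-westward-last above
  pathSpoke-fits ‵fromℕ 2F = trans (origin-westward (ℓ ↑ʳ 1F)) (eastEnd-last below) , place-westward-last below

  leafSpoke-fits : ∀ {s} j → lookup xs j ≡ s → ∀ k → Fits (u j) k (leafSpoke s j k)
  leafSpoke-fits {s} j eq k = at s k eq
    where
    west : ∀ {s} → lookup xs j ≡ s → Fits (u j) (second s) (westward (j ↑ˡ 2))
    west eq = trans (origin-westward (j ↑ˡ 2)) (eastEnd-leaf j) , trans (place-westward-leaf j) (cong second eq)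
    east : ∀ {s} → lookup xs j ≡ s → Fits (u j) (third s) (eastward (leafFaceʳ xs j))
    east eq = trans (origin-eastward (leafFaceʳ xs j)) (westEnd-leafFaceʳ j) , trans (place-eastward-leaf j) (cong third eq)
    at : ∀ s k → lookup xs j ≡ s → Fits (u j) k (leafSpoke s j k)
    at s     0F eq = refl , refl
    at above 1F eq = west eq
    at above 2F eq = east eq
    at below 1F eq = east eq
    at below 2F eq = west eq

  spoke-fits : ∀ x k → Fits x k (spoke x k)
  spoke-fits (v zero) 0F = trans (origin-eastward (first above xs)) (westEnd-first above) , place-eastward-first above
  spoke-fits (v zero) 1F = refl , refl
  spoke-fits (v zero) 2F = trans (origin-eastward (first below xs)) (westEnd-first below) , place-eastward-first below
  spoke-fits (v (suc i)) k = pathSpoke-fits (view i) k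
  spoke-fits (u j) k = leafSpoke-fits j refl k

  -- The outer face is zero, the inner faces are suc w.
  left : Dart → Fin (suc (ℓ + 2))
  left (pathEdge i , false) = suc (facing above xs i)
  left (pathEdge i , true)  = suc (facing below xs i)
  left (leafEdge j , b)     = suc (if isAbove (lookup xs j) xor b then j ↑ˡ 2 else leafFaceʳ xs j)
  left (rimEdge w , false)  = zero
  left (rimEdge w , true)   = suc w

  private
    Meets : Dart → Dart → Set
    Meets d d′ = left d′ ≡ left (rev d)

    left-eastward : ∀ {w} s → sideOf xs w ≡ s →
      left (eastward w) ≡ (if isAbove s then zero else suc w) × left (rev (eastward w)) ≡ (if isAbove s then suc w else zero)
    left-eastward above eq rewrite eq = refl , refl
    left-eastward below eq rewrite eq = refl , refl

    left-westward : ∀ {w} s → sideOf xs w ≡ s →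
      left (westward w) ≡ (if isAbove s then suc w else zero) × left (rev (westward w)) ≡ (if isAbove s then zero else suc w)
    left-westward above eq rewrite eq = refl , refl
    left-westward below eq rewrite eq = refl , refl

    left-leaf : ∀ {s} j b → lookup xs j ≡ s → left (leafEdge j , b) ≡ suc (if isAbove s xor b then j ↑ˡ 2 else leafFaceʳ xs j)
    left-leaf j b eq = cong (λ s → suc (if isAbove s xor b then j ↑ˡ 2 else leafFaceʳ xs j)) eq

    facing-leaf′ : ∀ {s} j → lookup xs j ≡ s → facing s xs (inject₁ j) ≡ j ↑ˡ 2
    facing-leaf′ j refl = facing-leaf xs j

    facing-stays′ : ∀ {s} j → lookup xs j ≡ s → facing (opposite s) xs (inject₁ j) ≡ facing (opposite s) xs (suc j)
    facing-stays′ j refl = facing-stays xs j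

    leafFaceʳ′ : ∀ {s} j → lookup xs j ≡ s → leafFaceʳ xs j ≡ facing s xs (suc j)
    leafFaceʳ′ j refl = refl

  innerSpoke-left : ∀ s j → lookup xs j ≡ s → ∀ k → Meets (innerSpoke s j k) (innerSpoke s j (turn false k))
  innerSpoke-left above j eq 0F = trans (left-leaf j false eq) (cong suc (sym (facing-leaf′ j eq)))
  innerSpoke-left above j eq 1F = trans (cong suc (sym (leafFaceʳ′ j eq))) (sym (left-leaf j true eq))
  innerSpoke-left above j eq 2F = cong suc (facing-stays′ j eq)
  innerSpoke-left below j eq 0F = cong suc (sym (facing-stays′ j eq))
  innerSpoke-left below j eq 1F = trans (left-leaf j false eq) (cong suc (leafFaceʳ′ j eq))
  innerSpoke-left below j eq 2F = trans (cong suc (facing-leaf′ j eq)) (sym (left-leaf j true eq))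

  leafSpoke-left : ∀ s j → lookup xs j ≡ s → ∀ k → Meets (leafSpoke s j k) (leafSpoke s j (turn false k))
  leafSpoke-left s j eq = at s eq
    where
    west : ∀ {s} → lookup xs j ≡ s → sideOf xs (j ↑ˡ 2) ≡ s
    west eq = trans (leafFace-sides xs j) eq
    east : ∀ {s} → lookup xs j ≡ s → sideOf xs (leafFaceʳ xs j) ≡ s
    east eq = trans (sideOf-facing (lookup xs j) xs (suc j)) eq
    at : ∀ s → lookup xs j ≡ s → ∀ k → Meets (leafSpoke s j k) (leafSpoke s j (turn false k))
    at above eq 0F = trans (proj₁ (left-westward above (west eq))) (sym (left-leaf j false eq))
    at above eq 1F = trans (proj₁ (left-eastward above (east eq))) (sym (proj₂ (left-westward above (west eq))))
    at above eq 2F = trans (left-leaf j true eq) (sym (proj₂ (left-eastward above (east eq))))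
    at below eq 0F = trans (proj₁ (left-eastward below (east eq))) (sym (left-leaf j false eq))
    at below eq 1F = trans (proj₁ (left-westward below (west eq))) (sym (proj₂ (left-eastward below (east eq))))
    at below eq 2F = trans (left-leaf j true eq) (sym (proj₂ (left-westward below (west eq))))

  pathSpoke-left : ∀ {i} (t : View i) k → Meets (pathSpoke t k) (pathSpoke t (turn false k))
  pathSpoke-left (‵inj₁ {i = j} _) k = innerSpoke-left (lookup xs j) j refl k
  pathSpoke-left ‵fromℕ 0F = trans (proj₁ (left-westward above (sideOf-last above xs))) (cong suc (sym (facing-last above xs)))
  pathSpoke-left ‵fromℕ 1F = trans (proj₁ (left-westward below (sideOf-last below xs))) (sym (proj₂ (left-westward above (sideOf-last above xs))))
  pathSpoke-left ‵fromℕ 2F = trans (cong suc (facing-last below xs)) (sym (proj₂ (left-westward below (sideOf-last below xs))))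

  spoke-left : ∀ x k → Meets (spoke x k) (spoke x (turn false k))
  spoke-left (v zero) 0F = sym (proj₂ (left-eastward above (sideOf-first above xs)))
  spoke-left (v zero) 1F = proj₁ (left-eastward below (sideOf-first below xs))
  spoke-left (v zero) 2F = trans (proj₁ (left-eastward above (sideOf-first above xs))) (sym (proj₂ (left-eastward below (sideOf-first below xs))))
  spoke-left (v (suc i)) k = pathSpoke-left (view i) k
  spoke-left (u j) k = leafSpoke-left (lookup xs j) j refl k

-- Connectedness and vanishing homology of the strip

prefixXor : ∀ {n} → (Fin n → Bool) → Fin (suc n) → Bool
prefixXor             g zero    = false
prefixXor {n = suc n} g (suc i) = g zero xor prefixXor (g ∘ suc) i

prefixXor-step : ∀ {n} (g : Fin n → Bool) i → prefixXor g (inject₁ i) xor prefixXor g (suc i) ≡ g i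
prefixXor-step g zero    = Boolₚ.xor-identityʳ (g zero)
prefixXor-step g (suc i) = trans
  (solve 3 (λ a b c → (a :+ b) :+ (a :+ c) := b :+ c) refl (g zero) (prefixXor (g ∘ suc) (inject₁ i)) (prefixXor (g ∘ suc) (suc i)))
  (prefixXor-step (g ∘ suc) i)

does-unique : ∀ {A : Set} {b} (a? : Dec A) → (A → b ≡ true) → (b ≡ true → A) → b ≡ does a?
does-unique (yes a) ⇒ ⇐ = ⇒ a
does-unique {b = false} (no ¬a) ⇒ ⇐ = refl
does-unique {b = true}  (no ¬a) ⇒ ⇐ = contradiction (⇐ refl) ¬a

xor≡true : ∀ {a b} → a xor b ≡ true → a ≡ true ⊎ b ≡ true
xor≡true {true}  {false} _ = inj₁ refl
xor≡true {false} {true}  _ = inj₂ refl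

∧≡true : ∀ {a b} → a ∧ b ≡ true → a ≡ true × b ≡ true
∧≡true {true} {true} _ = refl , refl

module StripPlane {ℓ : ℕ} (xs : Vec Side ℓ) where
  open CaterpillarHalin xs using (Vertex; v; u; pathEdge; leafEdge; rimEdge)
  open Strip xs

  stripMap : CubicMap strip
  stripMap = record
    { spoke        = spoke
    ; place        = place
    ; spoke-place  = spoke-place
    ; origin-spoke = λ x k → proj₁ (spoke-fits x k)
    ; place-spoke  = λ x k → proj₂ (spoke-fits x k)
    ; faces        = suc (ℓ + 2)
    ; left         = left
    ; left-turn    = λ d → trans (spoke-left (origin d) (place d)) (cong (left ∘ rev) (spoke-place d))
    ; edges        = suc ℓ + (ℓ + (ℓ + 2))
    ; enumerate    = StripEdge↔Fin
    }
    where open Graph strip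

  open CubicMap stripMap using (δ; sumE)
  open CubicMapProperties stripMap using (cut-orthogonal; sumE-xor; sumE-cong)

  F : Set
  F = Fin (suc (ℓ + 2))

  dualEnds : StripEdge → F × F
  dualEnds (pathEdge i) = suc (facing above xs i) , suc (facing below xs i)
  dualEnds (leafEdge j) = suc (j ↑ˡ 2) , suc (leafFaceʳ xs j)
  dualEnds (rimEdge w)  = zero , suc w

  δ-dualEnds : ∀ x e → δ x e ≡ x (proj₁ (dualEnds e)) xor x (proj₂ (dualEnds e))
  δ-dualEnds x (pathEdge i) = refl
  δ-dualEnds x (rimEdge w)  = refl
  δ-dualEnds x (leafEdge j) = by-side (isAbove (lookup xs j))
    where
    by-side : ∀ b → x (suc (if b xor false then j ↑ˡ 2 else leafFaceʳ xs j)) xor x (suc (if b xor true then j ↑ˡ 2 else leafFaceʳ xs j))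
                    ≡ x (suc (j ↑ˡ 2)) xor x (suc (leafFaceʳ xs j))
    by-side true  = refl
    by-side false = Boolₚ.xor-comm (x (suc (leafFaceʳ xs j))) _

  dualEnds-distinct : ∀ e → proj₁ (dualEnds e) ≢ proj₂ (dualEnds e)
  dualEnds-distinct (pathEdge i) eq =
    case trans (sym (sideOf-facing above xs i)) (trans (cong (sideOf xs) (Finₚ.suc-injective eq)) (sideOf-facing below xs i)) of λ ()
  dualEnds-distinct (leafEdge j) eq = ℕₚ.<⇒≢ (leafFace-< xs j) (cong toℕ (Finₚ.suc-injective eq))
  dualEnds-distinct (rimEdge w) ()

  leafFace-side : ∀ j → sideOf xs (leafFaceʳ xs j) ≡ sideOf xs (j ↑ˡ 2)
  leafFace-side j = trans (sideOf-facing (lookup xs j) xs (suc j)) (sym (leafFace-sides xs j))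

  path≢leaf : ∀ {i : Fin (suc ℓ)} {a b : Fin (ℓ + 2)} → facing above xs i ≡ a → facing below xs i ≡ b →
              sideOf xs a ≡ sideOf xs b → ⊥
  path≢leaf {i} p q eq = case trans (sym (sideOf-facing above xs i)) (trans (cong (sideOf xs) p) (trans eq
    (trans (cong (sideOf xs) (sym q)) (sideOf-facing below xs i)))) of λ ()

  -- Path edges join inner faces on different sides, leaf edges join inner faces on one side, and
  -- rim edges involve the outer face. Within each kind the faces determine the index; for leaf
  -- edges, the increase from west to east excludes a swap.
  dual-simple : ∀ e e′ → (proj₁ (dualEnds e) ≡ proj₁ (dualEnds e′) × proj₂ (dualEnds e) ≡ proj₂ (dualEnds e′))
                       ⊎ (proj₁ (dualEnds e) ≡ proj₂ (dualEnds e′) × proj₂ (dualEnds e) ≡ proj₁ (dualEnds e′)) → e ≡ e′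
  dual-simple (pathEdge i) (pathEdge j) (inj₁ (p , q)) =
    cong (λ i → pathEdge i) (facing-injective xs (Finₚ.suc-injective p) (Finₚ.suc-injective q))
  dual-simple (pathEdge i) (pathEdge j) (inj₂ (p , q)) =
    case trans (sym (sideOf-facing above xs i)) (trans (cong (sideOf xs) (Finₚ.suc-injective p)) (sideOf-facing below xs j)) of λ ()
  dual-simple (pathEdge i) (leafEdge j) (inj₁ (p , q)) =
    ⊥-elim (path≢leaf {i} (Finₚ.suc-injective p) (Finₚ.suc-injective q) (sym (leafFace-side j)))
  dual-simple (pathEdge i) (leafEdge j) (inj₂ (p , q)) =
    ⊥-elim (path≢leaf {i} (Finₚ.suc-injective p) (Finₚ.suc-injective q) (leafFace-side j))
  dual-simple (leafEdge j) (pathEdge i) (inj₁ (p , q)) =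
    ⊥-elim (path≢leaf {i} (sym (Finₚ.suc-injective p)) (sym (Finₚ.suc-injective q)) (sym (leafFace-side j)))
  dual-simple (leafEdge j) (pathEdge i) (inj₂ (p , q)) =
    ⊥-elim (path≢leaf {i} (sym (Finₚ.suc-injective q)) (sym (Finₚ.suc-injective p)) (leafFace-side j))
  dual-simple (leafEdge i) (leafEdge j) (inj₁ (p , q)) =
    cong (λ j → leafEdge j) (Finₚ.↑ˡ-injective 2 i j (Finₚ.suc-injective p))
  dual-simple (leafEdge i) (leafEdge j) (inj₂ (p , q)) = ⊥-elim (ℕₚ.<-asym
    (subst₂ _<_ refl (cong toℕ (Finₚ.suc-injective q)) (leafFace-< xs i))
    (subst₂ _<_ refl (cong toℕ (sym (Finₚ.suc-injective p))) (leafFace-< xs j)))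
  dual-simple (rimEdge w) (rimEdge w′) (inj₁ (p , q)) = cong (λ w → rimEdge w) (Finₚ.suc-injective q)
  dual-simple (pathEdge i) (rimEdge w) (inj₁ (() , _))
  dual-simple (pathEdge i) (rimEdge w) (inj₂ (_ , ()))
  dual-simple (leafEdge i) (rimEdge w) (inj₁ (() , _))
  dual-simple (leafEdge i) (rimEdge w) (inj₂ (_ , ()))
  dual-simple (rimEdge w) (pathEdge i) (inj₁ (() , _))
  dual-simple (rimEdge w) (pathEdge i) (inj₂ (() , _))
  dual-simple (rimEdge w) (leafEdge i) (inj₁ (() , _))
  dual-simple (rimEdge w) (leafEdge i) (inj₂ (() , _))
  dual-simple (rimEdge w) (rimEdge w′) (inj₂ (() , _))

  incident : ∀ {w} e → δ (indicator w) e ≡ true → proj₁ (dualEnds e) ≡ w ⊎ proj₂ (dualEnds e) ≡ w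
  incident {w} e eq with xor≡true {indicator w (proj₁ (dualEnds e))} (trans (sym (δ-dualEnds (indicator w) e)) eq)
  ... | inj₁ p = inj₁ (indicator⁻ w _ p)
  ... | inj₂ p = inj₂ (indicator⁻ w _ p)

  separates : ∀ e e′ → δ (indicator (proj₁ (dualEnds e))) e′ ∧ δ (indicator (proj₂ (dualEnds e))) e′ ≡ does (E-≟ strip e e′)
  separates e e′ = does-unique (E-≟ strip e e′) (λ { refl → cong₂ _∧_ at-first at-second }) same
    where
    l r : F
    l = proj₁ (dualEnds e)
    r = proj₂ (dualEnds e)
    l≢r : l ≢ r
    l≢r = dualEnds-distinct e
    at-first : δ (indicator l) e ≡ true
    at-first = trans (δ-dualEnds (indicator l) e) (cong₂ _xor_ (indicator-same l) (indicator-other {w = l} (l≢r ∘ sym)))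
    at-second : δ (indicator r) e ≡ true
    at-second = trans (δ-dualEnds (indicator r) e) (cong₂ _xor_ (indicator-other {w = r} l≢r) (indicator-same r))
    same : δ (indicator l) e′ ∧ δ (indicator r) e′ ≡ true → e ≡ e′
    same eq with ∧≡true {δ (indicator l) e′} eq
    ... | p , q with incident e′ p | incident e′ q
    ...   | inj₁ a | inj₁ b = contradiction (trans (sym a) b) l≢r
    ...   | inj₁ a | inj₂ b = dual-simple e e′ (inj₁ (sym a , sym b))
    ...   | inj₂ a | inj₁ b = dual-simple e e′ (inj₂ (sym a , sym b))
    ...   | inj₂ a | inj₂ b = contradiction (trans (sym a) b) l≢r

  strip-connected : ∀ {y} → (∀ e → ∂ strip y e ≡ false) → ∀ x → y x ≡ y first-v
  strip-connected {y} ∂y (v i) = FinInduction.<-weakInduction (λ i → y (v i) ≡ y first-v) refl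
    (λ i ih → trans (sym (xor≡false⇒≡ (∂y (pathEdge i)))) ih) i
  strip-connected {y} ∂y (u j) = trans (sym (xor≡false⇒≡ (∂y (leafEdge j)))) (strip-connected {y} ∂y (v (suc (inject₁ j))))

  left-base : left (spoke first-v 0F) ≡ zero
  left-base = trans (spoke-left first-v 2F) (outer (sideOf-first below xs))
    where
    outer : sideOf xs (first below xs) ≡ below → left (Graph.rev strip (eastward (first below xs))) ≡ zero
    outer eq rewrite eq = refl

  strip-dual-connected : ∀ {x : F → Bool} → (∀ e → δ x e ≡ false) → ∀ w → x w ≡ x (left (spoke first-v 0F))
  strip-dual-connected {x} δx w = trans (to-outer w) (cong x (sym left-base))
    where
    to-outer : ∀ w → x w ≡ x zero
    to-outer zero    = refl
    to-outer (suc w) = sym (xor≡false⇒≡ (δx (rimEdge w)))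

  module _ (c : StripEdge → Bool)
           (closed : ∀ x → c (proj₁ (spoke x 0F)) xor (c (proj₁ (spoke x 1F)) xor c (proj₁ (spoke x 2F))) ≡ false) where

    private
      rim : Fin (ℓ + 2) → Bool
      rim w = c (rimEdge w)

    leaf-cycle : ∀ j → c (leafEdge j) ≡ rim (j ↑ˡ 2) xor rim (leafFaceʳ xs j)
    leaf-cycle j = xor≡false⇒≡ (trans (sym (by-side (lookup xs j))) (closed (u j)))
      where
      a = rim (j ↑ˡ 2)
      b = rim (leafFaceʳ xs j)
      by-side : ∀ s → c (proj₁ (leafSpoke s j 0F)) xor (c (proj₁ (leafSpoke s j 1F)) xor c (proj₁ (leafSpoke s j 2F)))
                      ≡ c (leafEdge j) xor (a xor b)
      by-side above = refl
      by-side below = cong (c (leafEdge j) xor_) (Boolₚ.xor-comm b a)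

    inner-cycle : ∀ j → c (pathEdge (suc j)) ≡ c (pathEdge (inject₁ j)) xor c (leafEdge j)
    inner-cycle j = xor≡false⇒≡ (trans (sym (by-side (lookup xs j))) 
      (trans (sym (cong₂ _xor_ (at 0F) (cong₂ _xor_ (at 1F) (at 2F)))) (closed (v (suc (inject₁ j))))))
      where
      p = c (pathEdge (inject₁ j))
      q = c (pathEdge (suc j))
      r = c (leafEdge j)
      at : ∀ k → c (proj₁ (spoke (v (suc (inject₁ j))) k)) ≡ c (proj₁ (innerSpoke (lookup xs j) j k))
      at k = cong (c ∘ proj₁) (spoke-inner j k)
      by-side : ∀ s → c (proj₁ (innerSpoke s j 0F)) xor (c (proj₁ (innerSpoke s j 1F)) xor c (proj₁ (innerSpoke s j 2F)))
                      ≡ q xor (p xor r)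
      by-side above = solve 3 (λ p q r → p :+ (r :+ q) := q :+ (p :+ r)) refl p q r
      by-side below = solve 3 (λ p q r → p :+ (q :+ r) := q :+ (p :+ r)) refl p q r

    -- Induction along the path: the cycle condition at an inner vertex adds the leaf value, which
    -- exchanges the face west of the leaf for the one east of it.
    path-cycle : ∀ i → c (pathEdge i) ≡ rim (facing above xs i) xor rim (facing below xs i)
    path-cycle = FinInduction.<-weakInduction (λ i → c (pathEdge i) ≡ rim (facing above xs i) xor rim (facing below xs i)) start-cycle step
      where
      start-cycle : c (pathEdge zero) ≡ rim (first above xs) xor rim (first below xs)
      start-cycle = xor≡false⇒≡ (trans
        (solve 3 (λ a p b → p :+ (a :+ b) := a :+ (p :+ b)) refl (rim (first above xs)) (c (pathEdge zero)) (rim (first below xs)))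
        (closed first-v))
      step : ∀ j → c (pathEdge (inject₁ j)) ≡ rim (facing above xs (inject₁ j)) xor rim (facing below xs (inject₁ j)) →
             c (pathEdge (suc j)) ≡ rim (facing above xs (suc j)) xor rim (facing below xs (suc j))
      step j ih = trans (inner-cycle j) (trans (cong₂ _xor_ ih (leaf-cycle j))
        (by-side (lookup xs j) (facing-leaf xs j) (facing-stays xs j)))
        where
        by-side : ∀ s → facing s xs (inject₁ j) ≡ j ↑ˡ 2 → facing (opposite s) xs (inject₁ j) ≡ facing (opposite s) xs (suc j) →
          (rim (facing above xs (inject₁ j)) xor rim (facing below xs (inject₁ j))) xor (rim (j ↑ˡ 2) xor rim (facing s xs (suc j)))
          ≡ rim (facing above xs (suc j)) xor rim (facing below xs (suc j))
        by-side above p q rewrite p | q = solve 3 (λ a b c → (a :+ b) :+ (a :+ c) := c :+ b) refl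
          (rim (j ↑ˡ 2)) (rim (facing below xs (suc j))) (rim (facing above xs (suc j)))
        by-side below p q rewrite p | q = solve 3 (λ a b c → (a :+ b) :+ (b :+ c) := a :+ c) refl
          (rim (facing above xs (suc j))) (rim (j ↑ˡ 2)) (rim (facing below xs (suc j)))

    -- Dually, the rim edges are a spanning star around the outer face, so `x` is read off from
    -- them; the other edges follow from the cycle conditions.
    strip-cycle-is-δ : ∀ b → Σ[ x ∈ (F → Bool) ] x (left (spoke first-v 0F)) ≡ b × (∀ e → δ x e ≡ c e)
    strip-cycle-is-δ b = x , cong x left-base , λ e → trans (δ-dualEnds x e) (δx e)
      where
      x : F → Bool
      x zero    = b
      x (suc w) = b xor rim w
      cancel : ∀ p q → (b xor p) xor (b xor q) ≡ p xor q
      cancel p q = solve 3 (λ b p q → (b :+ p) :+ (b :+ q) := p :+ q) refl b p q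
      δx : ∀ e → x (proj₁ (dualEnds e)) xor x (proj₂ (dualEnds e)) ≡ c e
      δx (pathEdge i) = trans (cancel (rim (facing above xs i)) _) (sym (path-cycle i))
      δx (leafEdge j) = trans (cancel (rim (j ↑ˡ 2)) _) (sym (leaf-cycle j))
      δx (rimEdge w)  = solve 2 (λ b p → b :+ (b :+ p) := p) refl b (rim w)

  sumE-split : ∀ g → sumE g ≡ xorSum (λ i → g (pathEdge i)) xor (xorSum (λ j → g (leafEdge j)) xor xorSum (λ w → g (rimEdge w)))
  sumE-split g = trans (sum-split (suc ℓ) (g ∘ Inverse.from StripEdge↔Fin)) (cong₂ _xor_ (sum-cong-≗ paths)
    (trans (sum-split ℓ (λ t → g (Inverse.from StripEdge↔Fin (suc ℓ ↑ʳ t)))) (cong₂ _xor_ (sum-cong-≗ leaves) (sum-cong-≗ rims))))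
    where
    paths : ∀ i → g (Inverse.from StripEdge↔Fin (i ↑ˡ _)) ≡ g (pathEdge i)
    paths i rewrite Finₚ.splitAt-↑ˡ (suc ℓ) i (ℓ + (ℓ + 2)) = refl
    leaves : ∀ j → g (Inverse.from StripEdge↔Fin (suc ℓ ↑ʳ (j ↑ˡ _))) ≡ g (leafEdge j)
    leaves j rewrite Finₚ.splitAt-↑ʳ (suc ℓ) (ℓ + (ℓ + 2)) (j ↑ˡ (ℓ + 2)) | Finₚ.splitAt-↑ˡ ℓ j (ℓ + 2) = refl
    rims : ∀ w → g (Inverse.from StripEdge↔Fin (suc ℓ ↑ʳ (ℓ ↑ʳ w))) ≡ g (rimEdge w)
    rims w rewrite Finₚ.splitAt-↑ʳ (suc ℓ) (ℓ + (ℓ + 2)) (ℓ ↑ʳ w) | Finₚ.splitAt-↑ʳ ℓ (ℓ + 2) w = refl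

  -- The path and leaf edges form a spanning tree, on which `y` is the potential of `g`. The
  -- difference `g′` lives on the rim and is still orthogonal to all face boundaries.
  strip-cut-is-∂ : ∀ (g : StripEdge → Bool) → (∀ z → sumE (λ e → g e ∧ δ z e) ≡ false) →
    Σ[ y ∈ (Vertex → Bool) ] y first-v ≡ false × (∀ e → ∂ strip y e ≡ g e)
  strip-cut-is-∂ g orthogonal = y , refl , ∂y
    where
    y : Vertex → Bool
    y (v i) = prefixXor (λ i → g (pathEdge i)) i
    y (u j) = prefixXor (λ i → g (pathEdge i)) (suc (inject₁ j)) xor g (leafEdge j)
    g′ : StripEdge → Bool
    g′ e = g e xor ∂ strip y e
    path : ∀ i → ∂ strip y (pathEdge i) ≡ g (pathEdge i)
    path i = prefixXor-step (λ i → g (pathEdge i)) i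
    leaf′ : ∀ j → ∂ strip y (leafEdge j) ≡ g (leafEdge j)
    leaf′ j = solve 2 (λ a b → a :+ (a :+ b) := b) refl (y (v (suc (inject₁ j)))) (g (leafEdge j))
    g′-vanishes : ∀ {e} → ∂ strip y e ≡ g e → g′ e ≡ false
    g′-vanishes {e} eq = trans (cong (g e xor_) eq) (Boolₚ.xor-same (g e))
    g′-orthogonal : ∀ z → sumE (λ e → g′ e ∧ δ z e) ≡ false
    g′-orthogonal z = trans (sumE-cong (λ e → Boolₚ.∧-distribʳ-xor (δ z e) (g e) (∂ strip y e)))
      (trans (sumE-xor (λ e → g e ∧ δ z e) (λ e → ∂ strip y e ∧ δ z e)) (cong₂ _xor_ (orthogonal z) (cut-orthogonal y z)))
    rim-vanishes : ∀ w → g′ (rimEdge w) ≡ false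
    rim-vanishes w = begin
      g′ (rimEdge w)                                               ≡⟨ trans (cong (g′ (rimEdge w) ∧_) (indicator-same w)) (Boolₚ.∧-identityʳ _) ⟨
      g′ (rimEdge w) ∧ indicator w w                               ≡⟨ sum-point (λ w′ → g′ (rimEdge w′) ∧ indicator w w′) w
                                                                        (λ i i≢w → trans (cong (g′ (rimEdge i) ∧_) (indicator-other i≢w)) (Boolₚ.∧-zeroʳ _)) ⟨
      xorSum (λ w′ → g′ (rimEdge w′) ∧ indicator w w′)                ≡⟨ cong₂ _xor_ (sum-zero {suc ℓ} (λ i → cong (_∧ δ z (pathEdge i)) (g′-vanishes (path i))))
                                                                        (cong (_xor xorSum (λ w′ → g′ (rimEdge w′) ∧ indicator w w′))
                                                                          (sum-zero {ℓ} (λ j → cong (_∧ δ z (leafEdge j)) (g′-vanishes (leaf′ j))))) ⟨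
      xorSum (λ i → g′ (pathEdge i) ∧ δ z (pathEdge i)) xor (xorSum (λ j → g′ (leafEdge j) ∧ δ z (leafEdge j)) xor xorSum (λ w → g′ (rimEdge w) ∧ δ z (rimEdge w)))
                                                                   ≡⟨ sumE-split (λ e → g′ e ∧ δ z e) ⟨
      sumE (λ e → g′ e ∧ δ z e)                                    ≡⟨ g′-orthogonal z ⟩
      false                                                        ∎
      where
      open ≡-Reasoning
      z : F → Bool
      -- The boundary of one inner face contains a single rim edge.
      z = indicator (suc w)
    ∂y : ∀ e → ∂ strip y e ≡ g e
    ∂y (pathEdge i) = path i
    ∂y (leafEdge j) = leaf′ j
    ∂y (rimEdge w)  = sym (xor≡false⇒≡ (rim-vanishes w))

  stripPlane : PlaneCubic strip
  stripPlane = record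
    { cubicMap       = stripMap
    ; euler          = solveℕ 1 (λ n → ((conℕ 2 ⊕ n) ⊕ n) ⊕ (conℕ 1 ⊕ (n ⊕ conℕ 2)) :≡ conℕ 2 ⊕ ((conℕ 1 ⊕ n) ⊕ (n ⊕ (n ⊕ conℕ 2)))) refl ℓ
    ; base           = first-v
    ; connected      = strip-connected
    ; dual-connected = λ {x} → strip-dual-connected {x}
    ; cycle-is-δ     = strip-cycle-is-δ
    ; cut-is-∂       = strip-cut-is-∂
    ; separate       = λ e → indicator (proj₁ (dualEnds e)) , indicator (proj₂ (dualEnds e)) , separates e
    }
    where open ℕSolver.+-*-Solver renaming (solve to solveℕ; _:=_ to _:≡_; _:+_ to _⊕_; con to conℕ)

-- Renumbering the edges of a plane cubic graph

module Renumbering {G : Graph} (P : PlaneCubic G)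
  {E′ : Set} {size′ : ℕ} (E′-finite : E′ ↔ Fin size′) (ends′ : E′ → Graph.V G × Graph.V G)
  (ε : E′ ↔ Graph.E G) (ends≡ : ∀ e → ends′ e ≡ Graph.ends G (Inverse.to ε e)) where

  open Graph G
  open PlaneCubic P
  open PlaneCubicProperties P
  private module ε = Inverse ε

  G′ : Graph
  G′ = record { V = V ; E = E′ ; order = order ; size = size′ ; V-finite = V-finite ; E-finite = E′-finite ; ends = ends′ }

  private
    module G′ = Graph G′

    there-dart : G′.Dart → Dart
    there-dart (e , b) = ε.to e , b

    back-dart : Dart → G′.Dart
    back-dart (e , b) = ε.from e , b

    there-back : ∀ d → there-dart (back-dart d) ≡ d
    there-back (e , b) = cong (_, b) (ε.strictlyInverseˡ e)

    back-there : ∀ d → back-dart (there-dart d) ≡ d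
    back-there (e , b) = cong (_, b) (ε.strictlyInverseʳ e)

    origin≡ : ∀ d → G′.origin d ≡ origin (there-dart d)
    origin≡ (e , false) = cong proj₁ (ends≡ e)
    origin≡ (e , true)  = cong proj₂ (ends≡ e)

    origin-back : ∀ d → G′.origin (back-dart d) ≡ origin d
    origin-back d = trans (origin≡ (back-dart d)) (cong origin (there-back d))

    ∂≡ : ∀ y e → ∂ G′ y e ≡ ∂ G y (ε.to e)
    ∂≡ y e = cong (λ (a , b) → y a xor y b) (ends≡ e)

    E-≟-to : ∀ e e′ → does (E-≟ G (ε.to e) (ε.to e′)) ≡ does (E-≟ G′ e e′)
    E-≟-to e e′ = does-unique (E-≟ G′ e e′) (λ { refl → dec-true (E-≟ G (ε.to e) (ε.to e)) refl })
      (λ eq → trans (sym (ε.strictlyInverseʳ e)) (trans (cong ε.from (decided (E-≟ G (ε.to e) (ε.to e′)) eq)) (ε.strictlyInverseʳ e′)))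
      where
      decided : ∀ {A : Set} (a? : Dec A) → does a? ≡ true → A
      decided (yes a) _ = a

  renumberedMap : CubicMap G′
  renumberedMap = record
    { spoke        = λ v k → back-dart (spoke v k)
    ; place        = λ d → place (there-dart d)
    ; spoke-place  = λ d → trans (cong back-dart (spoke-place′ (sym (origin≡ d)))) (back-there d)
    ; origin-spoke = λ v k → trans (origin-back (spoke v k)) (origin-spoke v k)
    ; place-spoke  = λ v k → trans (cong place (there-back (spoke v k))) (place-spoke v k)
    ; faces        = faces
    ; left         = λ d → left (there-dart d)
    ; left-turn    = λ d → trans (cong left (there-back _)) (trans (cong (λ v → left (spoke v (turn false (place (there-dart d))))) (origin≡ d))
                             (left-turn (there-dart d)))
    ; edges        = edges
    ; enumerate    = enumerate ↔-∘ ε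
    }

  private
    module M′ = CubicMap renumberedMap

    all-edges : ∀ {h : E → Bool} → (∀ e → h (ε.to e) ≡ false) → ∀ e → h e ≡ false
    all-edges {h} eq e = trans (cong h (sym (ε.strictlyInverseˡ e))) (eq (ε.from e))

    left-base : ∀ (x : Fin faces → Bool) → x (M′.left (M′.spoke base 0F)) ≡ x (left (spoke base 0F))
    left-base x = cong (x ∘ left) (there-back (spoke base 0F))

  renumbered : size′ ≡ size → PlaneCubic G′
  renumbered size≡ = record
    { cubicMap       = renumberedMap
    ; euler          = trans euler (cong (_+_ 2) (sym size≡))
    ; base           = base
    ; connected      = λ {y} ∂y → connected (all-edges {∂ G y} λ e → trans (sym (∂≡ y e)) (∂y e))
    ; dual-connected = λ {x} δx w → trans (dual-connected {x} (all-edges {δ x} δx) w) (sym (left-base x))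
    ; cycle-is-δ     = λ c closed b → let (x , x-base , δx) = cycle-is-δ (c ∘ ε.from) closed b in
        x , trans (left-base x) x-base , λ e → trans (δx (ε.to e)) (cong c (ε.strictlyInverseʳ e))
    ; cut-is-∂       = λ g orthogonal →
        let (y , y-base , ∂y) = cut-is-∂ (g ∘ ε.from) (λ z → trans
              (sumE-cong (λ e → cong (λ e′ → g (ε.from e) ∧ δ z e′) (sym (ε.strictlyInverseˡ e)))) (orthogonal z)) in
        y , y-base , λ e → trans (∂≡ y e) (trans (∂y (ε.to e)) (cong g (ε.strictlyInverseʳ e)))
    ; separate       = λ e → let (x , z , sep) = separate (ε.to e) in x , z , λ e′ → trans (sep (ε.to e′)) (E-≟-to e e′)
    }

  module _ (size≡ : size′ ≡ size) where
    private
      P′ = renumbered size≡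
      form≡ : ∀ A x z → Genus.form P′ A x z ≡ Genus.form P (A ∘ ε.from) x z
      form≡ A x z = sumE-cong (λ e → cong (λ e′ → (A (ε.from e) ∧ δ x e′) ∧ δ z e′) (ε.strictlyInverseˡ e))

    rankOne-back : ∀ {A} → Genus.RankOne P′ A → Genus.RankOne P (A ∘ ε.from)
    rankOne-back {A} (φ , add , nonzero , factor) = φ , add , nonzero , λ x z → trans (sym (form≡ A x z)) (factor x z)

    rankOne-there : ∀ {A} → Genus.RankOne P (A ∘ ε.from) → Genus.RankOne P′ A
    rankOne-there {A} (φ , add , nonzero , factor) = φ , add , nonzero , λ x z → trans (form≡ A x z) (factor x z)

-- The rim as a list of faces

-- The steps of the walk from `a` through `L` to `b`; `rimEdges` is the instance that starts and
-- ends at `v zero`.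
pairs : ∀ {A : Set} → A → List A → A → List (A × A)
pairs a L b = List.zip (a ∷ L) (L List.++ b ∷ [])

pairs-++ : ∀ {A : Set} (a : A) L b M c → pairs a (L List.++ b ∷ M) c ≡ pairs a L b List.++ pairs b M c
pairs-++ a []      b M c = refl
pairs-++ a (x ∷ L) b M c = cong ((a , x) ∷_) (pairs-++ x L b M c)

pairs-reverse : ∀ {A : Set} (b : A) L c → pairs b (List.reverse L) c ≡ List.reverse (List.map swap (pairs c L b))
pairs-reverse b []      c = refl
pairs-reverse b (x ∷ L) c = begin
  pairs b (List.reverse (x ∷ L)) c                                     ≡⟨ cong (λ M → pairs b M c) (Listₚ.unfold-reverse x L) ⟩
  pairs b (List.reverse L List.++ x ∷ []) c                            ≡⟨ pairs-++ b (List.reverse L) x [] c ⟩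
  pairs b (List.reverse L) x List.++ (x , c) ∷ []                      ≡⟨ cong (List._++ (x , c) ∷ []) (pairs-reverse b L x) ⟩
  List.reverse (List.map swap (pairs x L b)) List.++ (x , c) ∷ []      ≡⟨ Listₚ.unfold-reverse (x , c) (List.map swap (pairs x L b)) ⟨
  List.reverse (List.map swap (pairs c (x ∷ L) b))                     ∎
  where open ≡-Reasoning

filterᵇ-map : ∀ {A B : Set} (p : B → Bool) (f : A → B) L → List.filterᵇ p (List.map f L) ≡ List.map f (List.filterᵇ (p ∘ f) L)
filterᵇ-map p f []      = refl
filterᵇ-map p f (x ∷ L) with p (f x)
... | true  = cong (f x ∷_) (filterᵇ-map p f L)
... | false = filterᵇ-map p f L

map-filterᵇ-tabulate : ∀ {ℓ} {A : Set} (p : Fin (suc ℓ) → Bool) (g : Fin (suc ℓ) → A) →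
  List.map g (List.filterᵇ p (List.tabulate suc)) ≡ List.map (g ∘ suc) (List.filterᵇ (p ∘ suc) (List.allFin ℓ))
map-filterᵇ-tabulate {ℓ} p g = trans
  (cong (List.map g) (trans (cong (List.filterᵇ p) (sym (Listₚ.map-tabulate id suc))) (filterᵇ-map p suc (List.allFin ℓ))))
  (sym (Listₚ.map-∘ _))

on : Side → Side → Bool
on above = isAbove
on below = isBelow

on⁻ : ∀ s x → on s x ≡ true → s ≡ x
on⁻ above above _ = refl
on⁻ below below _ = refl

off⁻ : ∀ s x → on s x ≡ false → s ≢ x
off⁻ above above () refl
off⁻ below below () refl

facesOn : ∀ {ℓ} → Side → Vec Side ℓ → List (Fin (ℓ + 2))
facesOn s []       = lastFace s ∷ []
facesOn s (x ∷ xs) = (if on s x then zero ∷_ else id) (List.map suc (facesOn s xs))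

facesOn-side : ∀ {ℓ} s (xs : Vec Side ℓ) → All.All (λ w → sideOf xs w ≡ s) (facesOn s xs)
facesOn-side above [] = refl ∷ []
facesOn-side below [] = refl ∷ []
facesOn-side s (x ∷ xs) with on s x in eq
... | true  = sym (on⁻ s x eq) ∷ Allₚ.map⁺ (facesOn-side s xs)
... | false = Allₚ.map⁺ (facesOn-side s xs)

facesOn-unique : ∀ {ℓ} s (xs : Vec Side ℓ) → Unique (facesOn s xs)
facesOn-unique s [] = [] ∷ []
facesOn-unique s (x ∷ xs) with on s x
... | true  = Allₚ.map⁺ (All.universal (λ _ ()) (facesOn s xs)) ∷ Uniqueₚ.map⁺ Finₚ.suc-injective (facesOn-unique s xs)
... | false = Uniqueₚ.map⁺ Finₚ.suc-injective (facesOn-unique s xs)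

on-refl : ∀ s → on s s ≡ true
on-refl above = refl
on-refl below = refl

facesOn-complete : ∀ {ℓ} (xs : Vec Side ℓ) w → w ∈ facesOn (sideOf xs w) xs
facesOn-complete []       0F      = here refl
facesOn-complete []       1F      = here refl
facesOn-complete (x ∷ xs) zero    rewrite on-refl x = here refl
facesOn-complete (x ∷ xs) (suc w) with on (sideOf xs w) x
... | true  = there (∈-map⁺ suc (facesOn-complete xs w))
... | false = ∈-map⁺ suc (facesOn-complete xs w)

leftVertex-same : ∀ {ℓ} {A : Set} (a : A) g x (xs : Vec Side ℓ) {w} → sideOf xs w ≡ x →
                  leftVertex a g (x ∷ xs) (suc w) ≡ leftVertex (g zero) (g ∘ suc) xs w
leftVertex-same a g x xs {w} eq with leftLeaf xs w
... | just j  = refl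
... | nothing rewrite dec-true (sideOf xs w ≟ˢ x) eq = refl

leftVertex-other : ∀ {ℓ} {A : Set} (a : A) g x (xs : Vec Side ℓ) {w} → sideOf xs w ≢ x →
                   leftVertex a g (x ∷ xs) (suc w) ≡ leftVertex a (g ∘ suc) xs w
leftVertex-other a g x xs {w} ne with leftLeaf xs w
... | just j  = refl
... | nothing rewrite dec-false (sideOf xs w ≟ˢ x) ne = refl

rightVertex-suc : ∀ {ℓ} {A : Set} (g : Fin (suc ℓ) → A) z w → rightVertex g z (suc w) ≡ rightVertex {ℓ} (g ∘ suc) z w
rightVertex-suc {ℓ} g z w with splitAt ℓ w
... | inj₁ _ = refl
... | inj₂ _ = refl

-- Induction from the west: a leaf on side `s` closes the first rim edge and is the start of the
-- remaining ones, a leaf on the other side is skipped.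
pairs-facesOn : ∀ {ℓ} {A : Set} s (xs : Vec Side ℓ) (a : A) g z →
  pairs a (List.map g (List.filterᵇ (λ i → on s (lookup xs i)) (List.allFin ℓ))) z
    ≡ List.map (λ w → leftVertex a g xs w , rightVertex g z w) (facesOn s xs)
pairs-facesOn above [] a g z = refl
pairs-facesOn below [] a g z = refl
pairs-facesOn {suc ℓ} {A} s (x ∷ xs) a g z with on s x in eq
... | true  = cong ((a , g zero) ∷_) (begin
  pairs (g zero) (List.map g (List.filterᵇ (λ i → on s (lookup (x ∷ xs) i)) (List.tabulate suc))) z
    ≡⟨ cong (λ L → pairs (g zero) L z) (map-filterᵇ-tabulate _ g) ⟩
  pairs (g zero) (List.map (g ∘ suc) (List.filterᵇ (λ i → on s (lookup xs i)) (List.allFin ℓ))) z ≡⟨ pairs-facesOn s xs (g zero) (g ∘ suc) z ⟩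
  List.map (λ w → leftVertex (g zero) (g ∘ suc) xs w , rightVertex (g ∘ suc) z w) (facesOn s xs)
    ≡⟨ Listₚ.map-cong-local (All.map (λ {w} side → cong₂ _,_ (leftVertex-same a g x xs (trans side (on⁻ s x eq))) (rightVertex-suc g z w)) (facesOn-side s xs)) ⟨
  List.map (ends ∘ suc) (facesOn s xs)                                                          ≡⟨ Listₚ.map-∘ (facesOn s xs) ⟩
  List.map ends (List.map suc (facesOn s xs))                                                   ∎)
  where
  open ≡-Reasoning
  ends : Fin (suc ℓ + 2) → A × A
  ends w = leftVertex a g (x ∷ xs) w , rightVertex g z w
... | false = begin
  pairs a (List.map g (List.filterᵇ (λ i → on s (lookup (x ∷ xs) i)) (List.tabulate suc))) z
    ≡⟨ cong (λ L → pairs a L z) (map-filterᵇ-tabulate _ g) ⟩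
  pairs a (List.map (g ∘ suc) (List.filterᵇ (λ i → on s (lookup xs i)) (List.allFin ℓ))) z     ≡⟨ pairs-facesOn s xs a (g ∘ suc) z ⟩
  List.map (λ w → leftVertex a (g ∘ suc) xs w , rightVertex (g ∘ suc) z w) (facesOn s xs)
    ≡⟨ Listₚ.map-cong-local (All.map (λ {w} side → cong₂ _,_ (leftVertex-other a g x xs (off⁻ s x eq ∘ trans (sym side))) (rightVertex-suc g z w)) (facesOn-side s xs)) ⟨
  List.map (ends ∘ suc) (facesOn s xs)                                                          ≡⟨ Listₚ.map-∘ (facesOn s xs) ⟩
  List.map ends (List.map suc (facesOn s xs))                                                   ∎
  where
  open ≡-Reasoning
  ends : Fin (suc ℓ + 2) → A × A
  ends w = leftVertex a g (x ∷ xs) w , rightVertex g z w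

lookup-unique : ∀ {A : Set} {L : List A} → Unique L → ∀ {i j} → List.lookup L i ≡ List.lookup L j → i ≡ j
lookup-unique (_ ∷ _)  {zero}  {zero}  _  = refl
lookup-unique (x∉ ∷ _) {zero}  {suc j} eq = contradiction eq (All.lookup x∉ (∈-lookup j))
lookup-unique (x∉ ∷ _) {suc i} {zero}  eq = contradiction (sym eq) (All.lookup x∉ (∈-lookup i))
lookup-unique (_ ∷ un) {suc i} {suc j} eq = cong suc (lookup-unique un eq)

position↔ : ∀ {B : Set} {L : List B} → Unique L → (∀ b → b ∈ L) → Fin (List.length L) ↔ B
position↔ {L = L} unique complete = mk↔ₛ′ (List.lookup L) (λ b → Any.index (complete b)) (λ b → sym (Anyₚ.lookup-index (complete b)))
  (λ i → lookup-unique unique (sym (Anyₚ.lookup-index (complete (List.lookup L i)))))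

relabel : ∀ {A B : Set} {L : List A} {M : List B} (f : B → A) → L ≡ List.map f M → Unique M → (∀ b → b ∈ M) →
          Σ[ ρ ∈ Fin (List.length L) ↔ B ] (∀ k → List.lookup L k ≡ f (Inverse.to ρ k))
relabel {M = M} f refl unique complete = position↔ unique complete ↔-∘ casting , lookup-map M
  where
  length≡ = Listₚ.length-map f M
  casting : Fin (List.length (List.map f M)) ↔ Fin (List.length M)
  casting = mk↔ₛ′ (Fin.cast length≡) (Fin.cast (sym length≡)) (Finₚ.cast-involutive length≡ (sym length≡)) (Finₚ.cast-involutive (sym length≡) length≡)
  lookup-map : ∀ M (k : Fin (List.length (List.map f M))) → List.lookup (List.map f M) k ≡ f (List.lookup M (Fin.cast (Listₚ.length-map f M) k))
  lookup-map (b ∷ M) zero    = refl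
  lookup-map (b ∷ M) (suc k) = lookup-map M k

module HalinPlane {ℓ : ℕ} (xs : Vec Side ℓ) where
  open CaterpillarHalin xs
  open Strip xs
  open StripPlane xs

  rimFaces : List (Fin (ℓ + 2))
  rimFaces = facesOn above xs List.++ List.reverse (facesOn below xs)

  -- C is cut at `last-v`. Its lower half is traversed from east to west, so its list is reversed
  -- and its pairs are swapped, as in `rimEnds below`.
  rimEdges≡ : rimEdges ≡ List.map (λ w → rimEnds (sideOf xs w) w) rimFaces
  rimEdges≡ = begin
    rimEdges
      ≡⟨ pairs-++ first-v (leavesOn isAbove) last-v (List.reverse (leavesOn isBelow)) first-v ⟩
    pairs first-v (leavesOn isAbove) last-v List.++ pairs last-v (List.reverse (leavesOn isBelow)) first-v
      ≡⟨ cong₂ List._++_ (pairs-facesOn above xs first-v _ last-v) (trans (pairs-reverse last-v (leavesOn isBelow) first-v)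
           (cong (λ L → List.reverse (List.map swap L)) (pairs-facesOn below xs first-v _ last-v))) ⟩
    List.map (rimEnds above) (facesOn above xs) List.++ List.reverse (List.map swap (List.map (rimEnds above) (facesOn below xs)))
      ≡⟨ cong (λ L → List.map (rimEnds above) (facesOn above xs) List.++ List.reverse L) (sym (Listₚ.map-∘ (facesOn below xs))) ⟩
    List.map (rimEnds above) (facesOn above xs) List.++ List.reverse (List.map (rimEnds below) (facesOn below xs))
      ≡⟨ cong₂ (λ L M → L List.++ List.reverse M) (by-side above) (by-side below) ⟩
    List.map rimEnds′ (facesOn above xs) List.++ List.reverse (List.map rimEnds′ (facesOn below xs))
      ≡⟨ cong (List.map rimEnds′ (facesOn above xs) List.++_) (sym (Listₚ.reverse-map rimEnds′ (facesOn below xs))) ⟩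
    List.map rimEnds′ (facesOn above xs) List.++ List.map rimEnds′ (List.reverse (facesOn below xs))
      ≡⟨ Listₚ.map-++ rimEnds′ (facesOn above xs) _ ⟨
    List.map rimEnds′ rimFaces ∎
    where
    open ≡-Reasoning
    rimEnds′ : Fin (ℓ + 2) → Vertex × Vertex
    rimEnds′ w = rimEnds (sideOf xs w) w
    by-side : ∀ s → List.map (rimEnds s) (facesOn s xs) ≡ List.map rimEnds′ (facesOn s xs)
    by-side s = Listₚ.map-cong-local (All.map (λ {w} side → cong (λ s → rimEnds s w) (sym side)) (facesOn-side s xs))

  rimFaces-unique : Unique rimFaces
  rimFaces-unique = Uniqueₚ.++⁺ (facesOn-unique above xs)
    (Unique-resp-↭ (setoid _) (↭⇒↭ₛ (↭-sym (↭-reverse _))) (facesOn-unique below xs))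
    λ { (a∈ , b∈) → case trans (sym (All.lookup (facesOn-side above xs) a∈))
          (All.lookup (facesOn-side below xs) (∈-resp-↭ (↭-reverse _) b∈)) of λ () }

  rimFaces-complete : ∀ w → w ∈ rimFaces
  rimFaces-complete w with sideOf xs w | facesOn-complete xs w
  ... | above | w∈ = ∈-++⁺ˡ w∈
  ... | below | w∈ = ∈-++⁺ʳ (facesOn above xs) (∈-resp-↭ (↭-sym (↭-reverse _)) w∈)

  rimFace : Fin (List.length rimEdges) ↔ Fin (ℓ + 2)
  rimFace = proj₁ (relabel _ rimEdges≡ rimFaces-unique rimFaces-complete)

  stripEdge : Edge ↔ StripEdge
  stripEdge = ↔-id _ ⊎-↔ (↔-id _ ⊎-↔ rimFace)

  edgeEnds≡ : ∀ e → edgeEnds e ≡ stripEnds (Inverse.to stripEdge e)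
  edgeEnds≡ (pathEdge i) = refl
  edgeEnds≡ (leafEdge j) = refl
  edgeEnds≡ (rimEdge k)  = proj₂ (relabel _ rimEdges≡ rimFaces-unique rimFaces-complete) k

  size≡ : Graph.size graph ≡ Graph.size strip
  size≡ = cong (λ n → suc ℓ + (ℓ + n)) (↔⇒≡ rimFace)

  module Halin = Renumbering stripPlane (Graph.E-finite graph) edgeEnds stripEdge edgeEnds≡

  halinPlane : PlaneCubic graph
  halinPlane = Halin.renumbered size≡

-- Factorisations of rank one: single edges and tetrahedra of the dual graph

StripCode : ℕ → Set
StripCode ℓ = (Fin (suc ℓ) ⊎ Fin ℓ ⊎ Fin (ℓ + 2)) ⊎ Fin ℓ

pattern path i = inj₁ i
pattern leg j  = inj₂ (inj₁ j)
pattern rim w  = inj₂ (inj₂ w)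

StripEdges : ℕ → Set
StripEdges ℓ = Fin (suc ℓ) ⊎ Fin ℓ ⊎ Fin (ℓ + 2)

sameEdge : ∀ {ℓ} → StripEdges ℓ → StripEdges ℓ → Bool
sameEdge (path i) (path j) = indicator i j
sameEdge (leg i)  (leg j)  = indicator i j
sameEdge (rim w)  (rim w′) = indicator w w′
sameEdge _        _        = false

sameEdge-refl : ∀ {ℓ} (e : StripEdges ℓ) → sameEdge e e ≡ true
sameEdge-refl (path i) = indicator-same i
sameEdge-refl (leg j)  = indicator-same j
sameEdge-refl (rim w)  = indicator-same w

sameEdge⁻ : ∀ {ℓ} (e e′ : StripEdges ℓ) → sameEdge e e′ ≡ true → e ≡ e′
sameEdge⁻ (path i) (path j) eq = cong (λ i → path i) (sym (indicator⁻ i j eq))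
sameEdge⁻ (leg i)  (leg j)  eq = cong (λ i → leg i) (sym (indicator⁻ i j eq))
sameEdge⁻ (rim w)  (rim w′) eq = cong (λ w → rim w) (sym (indicator⁻ w w′ eq))

oppositeFace : ∀ {ℓ} → Vec Side ℓ → Fin ℓ → Fin (ℓ + 2)
oppositeFace xs j = facing (opposite (lookup xs j)) xs (suc j)

-- The six edges joining the outer face and the three faces around the path
-- vertex of leaf j.
tetrahedron : ∀ {ℓ} → Vec Side ℓ → Fin ℓ → StripEdges ℓ → Bool
tetrahedron xs j (path i) = indicator (inject₁ j) i xor indicator (suc j) i
tetrahedron xs j (leg i)  = indicator j i
tetrahedron xs j (rim w)  = indicator (j ↑ˡ 2) w xor (indicator (leafFaceʳ xs j) w xor indicator (oppositeFace xs j) w)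

twists : ∀ {ℓ} → Vec Side ℓ → StripCode ℓ → StripEdges ℓ → Bool
twists xs (inj₁ e) = sameEdge e
twists xs (inj₂ j) = tetrahedron xs j

inject₁≢suc : ∀ {n} (j : Fin n) → inject₁ j ≢ suc j
inject₁≢suc (suc j) eq = inject₁≢suc j (Finₚ.suc-injective eq)

tetrahedron-big : ∀ {ℓ} (xs : Vec Side ℓ) j e → ¬ (∀ e′ → sameEdge e e′ ≡ tetrahedron xs j e′)
tetrahedron-big xs j e eq with sameEdge⁻ e (leg j) (trans (eq (leg j)) (indicator-same j))
... | refl = case trans (eq (path (suc j))) (cong₂ _xor_ (indicator-other {w = inject₁ j} (inject₁≢suc j ∘ sym)) (indicator-same (suc j))) of λ ()

twists-injective : ∀ {ℓ} (xs : Vec Side ℓ) {c c′} → (∀ e → twists xs c e ≡ twists xs c′ e) → c ≡ c′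
twists-injective xs {inj₁ e} {inj₁ e′} eq = cong inj₁ (sym (sameEdge⁻ e′ e (trans (sym (eq e)) (sameEdge-refl e))))
twists-injective xs {inj₁ e} {inj₂ j}  eq = ⊥-elim (tetrahedron-big xs j e eq)
twists-injective xs {inj₂ i} {inj₁ e}  eq = ⊥-elim (tetrahedron-big xs i e (sym ∘ eq))
twists-injective xs {inj₂ i} {inj₂ j}  eq = cong inj₂ (indicator⁻ j i (trans (sym (eq (leg i))) (indicator-same i)))

-- ω is the value at the outer face.
weight : ∀ {ℓ} → Vec Side ℓ → Bool → (Fin (ℓ + 2) → Bool) → StripEdges ℓ → Bool
weight xs ω W (path i) = W (facing above xs i) ∧ W (facing below xs i)
weight xs ω W (leg j)  = W (j ↑ˡ 2) ∧ W (leafFaceʳ xs j)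
weight xs ω W (rim w)  = ω ∧ W w

Joins : ∀ {A : Set} → A → A → A → A → Set
Joins a b w w′ = (a ≡ w × b ≡ w′) ⊎ (a ≡ w′ × b ≡ w)

-- Adjacency of inner faces in the dual graph.
Near : ∀ {ℓ} → Vec Side ℓ → Fin (ℓ + 2) → Fin (ℓ + 2) → Set
Near xs w w′ = (∃[ i ] Joins (facing above xs i) (facing below xs i) w w′) ⊎ (∃[ j ] Joins (j ↑ˡ 2) (leafFaceʳ xs j) w w′)

-- A new leaf in front of the strip adds one inner face. Its leaf edge joins it to the face that was
-- first on its side, the first path edge to the first one on the other side.
near-zero : ∀ {ℓ} x (xs : Vec Side ℓ) {w} → Near (x ∷ xs) zero (suc w) → w ≡ first x xs ⊎ w ≡ first (opposite x) xs
near-zero above xs (inj₁ (zero , inj₁ (_ , refl)))  = inj₂ refl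
near-zero below xs (inj₁ (zero , inj₂ (refl , _)))  = inj₂ refl
near-zero x     xs (inj₂ (zero , inj₁ (_ , refl)))  = inj₁ refl
near-zero above xs (inj₁ (zero , inj₂ (() , _)))
near-zero below xs (inj₁ (zero , inj₁ (() , _)))
near-zero x     xs (inj₁ (suc i , inj₁ (() , _)))
near-zero x     xs (inj₁ (suc i , inj₂ (_ , ())))
near-zero x     xs (inj₂ (zero , inj₂ (() , _)))
near-zero x     xs (inj₂ (suc j , inj₁ (() , _)))
near-zero x     xs (inj₂ (suc j , inj₂ (_ , ())))

joins-pred : ∀ {n} {a b w w′ : Fin n} → Joins (Fin.suc a) (suc b) (suc w) (suc w′) → Joins a b w w′
joins-pred (inj₁ (p , q)) = inj₁ (Finₚ.suc-injective p , Finₚ.suc-injective q)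
joins-pred (inj₂ (p , q)) = inj₂ (Finₚ.suc-injective p , Finₚ.suc-injective q)

near-suc : ∀ {ℓ} x (xs : Vec Side ℓ) {w w′} → Near (x ∷ xs) (suc w) (suc w′) → Near xs w w′
near-suc x     xs (inj₁ (suc i , joins)) = inj₁ (i , joins-pred joins)
near-suc x     xs (inj₂ (suc j , joins)) = inj₂ (j , joins-pred joins)
near-suc above xs (inj₁ (zero , inj₁ (() , _)))
near-suc above xs (inj₁ (zero , inj₂ (() , _)))
near-suc below xs (inj₁ (zero , inj₁ (_ , ())))
near-suc below xs (inj₁ (zero , inj₂ (_ , ())))
near-suc x     xs (inj₂ (zero , inj₁ (() , _)))
near-suc x     xs (inj₂ (zero , inj₂ (() , _)))

first-distinct : ∀ {ℓ} x (xs : Vec Side ℓ) → first x xs ≢ first (opposite x) xs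
first-distinct above xs eq = case trans (sym (sideOf-first above xs)) (trans (cong (sideOf xs) eq) (sideOf-first below xs)) of λ ()
first-distinct below xs eq = case trans (sym (sideOf-first below xs)) (trans (cong (sideOf xs) eq) (sideOf-first above xs)) of λ ()

-- The situation when the clique contains the newest face: its other inner faces are among the two
-- neighbours `p` and `q`.
module TwoFaces {ℓ} (x : Side) (xs : Vec Side ℓ) (W : Fin (ℓ + 2) → Bool)
  (off : ∀ w → w ≢ first x xs → w ≢ first (opposite x) xs → W w ≡ false) where

  p q : Fin (ℓ + 2)
  p = first x xs
  q = first (opposite x) xs

  two-points : ∀ w → W w ≡ (indicator p w ∧ W p) xor (indicator q w ∧ W q)
  two-points w with w Fin.≟ p | w Fin.≟ q
  ... | yes refl | _ = sym (trans
          (cong₂ (λ a b → (a ∧ W p) xor (b ∧ W q)) (indicator-same p) (indicator-other {w = q} (first-distinct x xs)))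
          (Boolₚ.xor-identityʳ (W p)))
  ... | no w≢p | yes refl = sym (cong₂ (λ a b → (a ∧ W p) xor (b ∧ W q)) (indicator-other {w = p} w≢p) (indicator-same q))
  ... | no w≢p | no w≢q = trans (off w w≢p w≢q)
          (sym (cong₂ (λ a b → (a ∧ W p) xor (b ∧ W q)) (indicator-other {w = p} w≢p) (indicator-other {w = q} w≢q)))

  sum-two-points : xorSum W ≡ W p xor W q
  sum-two-points = begin
    xorSum W                                                                              ≡⟨ sum-cong-≗ two-points ⟩
    xorSum (λ w → (indicator p w ∧ W p) xor (indicator q w ∧ W q))                        ≡⟨ ∑-distrib-+ (λ w → indicator p w ∧ W p) (λ w → indicator q w ∧ W q) ⟩
    xorSum (λ w → indicator p w ∧ W p) xor xorSum (λ w → indicator q w ∧ W q)                ≡⟨ cong₂ _xor_ (at p) (at q) ⟩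
    W p xor W q                                                                        ∎
    where
    open ≡-Reasoning
    at : ∀ r → xorSum (λ w → indicator r w ∧ W r) ≡ W r
    at r = trans (sum-point (λ w → indicator r w ∧ W r) r (λ i i≢r → cong (_∧ W r) (indicator-other i≢r)))
                 (cong (_∧ W r) (indicator-same r))

  supported : ∀ w → W w ≡ true → w ≡ first (sideOf xs w) xs
  supported w eq with w Fin.≟ p | w Fin.≟ q
  ... | yes refl | _        = cong (λ s → first s xs) (sym (sideOf-first x xs))
  ... | no _     | yes refl = cong (λ s → first s xs) (sym (sideOf-first (opposite x) xs))
  ... | no w≢p   | no w≢q   = case trans (sym eq) (off w w≢p w≢q) of λ ()

  facing-supported : ∀ s i → W (facing s xs i) ≡ true → facing s xs i ≡ first s xs
  facing-supported s i eq = trans (supported _ eq) (cong (λ s → first s xs) (sideOf-facing s xs i))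

  path-weight : ∀ i → W (facing above xs i) ∧ W (facing below xs i) ≡ (W p ∧ W q) ∧ indicator zero i
  path-weight zero = trans (by-side x) (sym (Boolₚ.∧-identityʳ (W p ∧ W q)))
    where
    by-side : ∀ s → W (first above xs) ∧ W (first below xs) ≡ W (first s xs) ∧ W (first (opposite s) xs)
    by-side above = refl
    by-side below = Boolₚ.∧-comm (W (first above xs)) _
  path-weight (suc i) = trans (Boolₚ.¬-not not-both) (sym (Boolₚ.∧-zeroʳ (W p ∧ W q)))
    where
    not-both : W (facing above xs (suc i)) ∧ W (facing below xs (suc i)) ≢ true
    not-both eq with ∧≡true {W (facing above xs (suc i))} eq
    ... | a , b = case facing-injective xs {suc i} {zero} (facing-supported above (suc i) a) (facing-supported below (suc i) b) of λ ()

  -- A leaf edge joins two faces on one side, whereas the support has at most one face on each.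
  leg-weight : ∀ j → W (j ↑ˡ 2) ∧ W (leafFaceʳ xs j) ≡ false
  leg-weight j = Boolₚ.¬-not not-both
    where
    not-both : W (j ↑ˡ 2) ∧ W (leafFaceʳ xs j) ≢ true
    not-both eq with ∧≡true {W (j ↑ˡ 2)} eq
    ... | a , b = ℕₚ.<⇒≢ (leafFace-< xs j) (cong toℕ (trans (supported _ a) (trans (cong (λ s → first s xs) (leafFace-sides xs j))
                    (sym (facing-supported (lookup xs j) (suc j) b)))))

Classified : ∀ {ℓ} → Vec Side ℓ → Bool → (Fin (ℓ + 2) → Bool) → Set
Classified {ℓ} xs ω W = ∃[ c ] (∀ e → weight xs ω W e ≡ twists xs c e)

shiftCode : ∀ {ℓ} → StripCode ℓ → StripCode (suc ℓ)
shiftCode (inj₁ (path i)) = inj₁ (path (suc i))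
shiftCode (inj₁ (leg j))  = inj₁ (leg (suc j))
shiftCode (inj₁ (rim w))  = inj₁ (rim (suc w))
shiftCode (inj₂ j)        = inj₂ (suc j)

classify-shift : ∀ {ℓ} x (xs : Vec Side ℓ) ω W → W zero ≡ false → Classified xs ω (W ∘ suc) → Classified (x ∷ xs) ω W
classify-shift x xs ω W W0 (c , eq) = shiftCode c , λ e → trans (old e) (new c eq e)
  where
  extended : StripEdges _ → Bool
  extended (path zero)    = false
  extended (path (suc i)) = weight xs ω (W ∘ suc) (path i)
  extended (leg zero)     = false
  extended (leg (suc j))  = weight xs ω (W ∘ suc) (leg j)
  extended (rim zero)     = false
  extended (rim (suc w))  = weight xs ω (W ∘ suc) (rim w)
  first-path : ∀ x → W (first above (x ∷ xs)) ∧ W (first below (x ∷ xs)) ≡ false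
  first-path above = cong (_∧ W (suc (first below xs))) W0
  first-path below = trans (cong (W (suc (first above xs)) ∧_) W0) (Boolₚ.∧-zeroʳ _)
  old : ∀ e → weight (x ∷ xs) ω W e ≡ extended e
  old (path zero)    = first-path x
  old (path (suc i)) = refl
  old (leg zero)     = cong (_∧ W (suc (first x xs))) W0
  old (leg (suc j))  = refl
  old (rim zero)     = trans (cong (ω ∧_) W0) (Boolₚ.∧-zeroʳ ω)
  old (rim (suc w))  = refl
  new : ∀ c → (∀ e → weight xs ω (W ∘ suc) e ≡ twists xs c e) → ∀ e → extended e ≡ twists (x ∷ xs) (shiftCode c) e
  new (inj₁ (path i)) eq (path zero)    = refl
  new (inj₁ (path i)) eq (path (suc k)) = eq (path k)
  new (inj₁ (path i)) eq (leg zero)     = refl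
  new (inj₁ (path i)) eq (leg (suc k))  = eq (leg k)
  new (inj₁ (path i)) eq (rim zero)     = refl
  new (inj₁ (path i)) eq (rim (suc k))  = eq (rim k)
  new (inj₁ (leg j))  eq (path zero)    = refl
  new (inj₁ (leg j))  eq (path (suc k)) = eq (path k)
  new (inj₁ (leg j))  eq (leg zero)     = refl
  new (inj₁ (leg j))  eq (leg (suc k))  = eq (leg k)
  new (inj₁ (leg j))  eq (rim zero)     = refl
  new (inj₁ (leg j))  eq (rim (suc k))  = eq (rim k)
  new (inj₁ (rim w))  eq (path zero)    = refl
  new (inj₁ (rim w))  eq (path (suc k)) = eq (path k)
  new (inj₁ (rim w))  eq (leg zero)     = refl
  new (inj₁ (rim w))  eq (leg (suc k))  = eq (leg k)
  new (inj₁ (rim w))  eq (rim zero)     = refl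
  new (inj₁ (rim w))  eq (rim (suc k))  = eq (rim k)
  new (inj₂ j)        eq (path zero)    = refl
  new (inj₂ j)        eq (path (suc k)) = eq (path k)
  new (inj₂ j)        eq (leg zero)     = refl
  new (inj₂ j)        eq (leg (suc k))  = eq (leg k)
  new (inj₂ j)        eq (rim zero)     = refl
  new (inj₂ j)        eq (rim (suc k))  = eq (rim k)

-- Parity leaves four supports containing the face zero: those of the three edges
-- at that face and the tetrahedron on it.
classify-first : ∀ {ℓ} x (xs : Vec Side ℓ) ω W → W zero ≡ true →
  (∀ w → w ≢ first x xs → w ≢ first (opposite x) xs → W (suc w) ≡ false) →
  ω xor (true xor xorSum (W ∘ suc)) ≡ false → Classified (x ∷ xs) ω W
classify-first x xs ω W W0 off even = by-cases (W (suc p)) (W (suc q)) refl refl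
  where
  open TwoFaces x xs (W ∘ suc) off
  ω≡ : ω ≡ not (W (suc p) xor W (suc q))
  ω≡ = trans (xor≡false⇒≡ even) (cong not sum-two-points)
  -- The arguments tell whether `p` and `q` belong to the clique. By parity the outer face belongs
  -- to it exactly when they agree.
  code : Bool → Bool → StripCode _
  code false false = inj₁ (rim zero)
  code true  false = inj₁ (leg zero)
  code false true  = inj₁ (path zero)
  code true  true  = inj₂ zero
  first-path : ∀ x (p q : Bool) → W (suc (first x xs)) ≡ p → W (suc (first (opposite x) xs)) ≡ q →
               W (first above (x ∷ xs)) ∧ W (first below (x ∷ xs)) ≡ q
  first-path above p q P Q = cong₂ _∧_ W0 Q
  first-path below p q P Q = trans (cong₂ _∧_ Q W0) (Boolₚ.∧-identityʳ q)
  extended : Bool → Bool → StripEdges _ → Bool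
  extended a b (path zero)    = b
  extended a b (path (suc i)) = (a ∧ b) ∧ indicator zero i
  extended a b (leg zero)     = a
  extended a b (leg (suc j))  = false
  extended a b (rim zero)     = not (a xor b)
  extended a b (rim (suc w))  = not (a xor b) ∧ ((indicator p w ∧ a) xor (indicator q w ∧ b))
  old : ∀ {a b} → W (suc p) ≡ a → W (suc q) ≡ b → ∀ e → weight (x ∷ xs) ω W e ≡ extended a b e
  old {a} {b} P Q (path zero)    = first-path x a b P Q
  old P Q (path (suc i)) = trans (path-weight i) (cong₂ (λ a b → (a ∧ b) ∧ indicator zero i) P Q)
  old P Q (leg zero)     = cong₂ _∧_ W0 P
  old P Q (leg (suc j))  = leg-weight j
  old P Q (rim zero)     = trans (cong₂ _∧_ (trans ω≡ (cong₂ (λ a b → not (a xor b)) P Q)) W0) (Boolₚ.∧-identityʳ _)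
  old P Q (rim (suc w))  = cong₂ _∧_ (trans ω≡ (cong₂ (λ a b → not (a xor b)) P Q))
    (trans (two-points w) (cong₂ (λ a b → (indicator p w ∧ a) xor (indicator q w ∧ b)) P Q))
  new : ∀ a b e → extended a b e ≡ twists (x ∷ xs) (code a b) e
  new false false (path zero)    = refl
  new false false (path (suc i)) = refl
  new false false (leg zero)     = refl
  new false false (leg (suc j))  = refl
  new false false (rim zero)     = refl
  new false false (rim (suc w))  = cong₂ _xor_ (Boolₚ.∧-zeroʳ (indicator p w)) (Boolₚ.∧-zeroʳ (indicator q w))
  new true  false (path zero)    = refl
  new true  false (path (suc i)) = refl
  new true  false (leg zero)     = refl
  new true  false (leg (suc j))  = refl
  new true  false (rim zero)     = refl
  new true  false (rim (suc w))  = refl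
  new false true  (path zero)    = refl
  new false true  (path (suc i)) = refl
  new false true  (leg zero)     = refl
  new false true  (leg (suc j))  = refl
  new false true  (rim zero)     = refl
  new false true  (rim (suc w))  = refl
  new true  true  (path zero)    = refl
  new true  true  (path (suc i)) = refl
  new true  true  (leg zero)     = refl
  new true  true  (leg (suc j))  = refl
  new true  true  (rim zero)     = refl
  new true  true  (rim (suc w))  = cong₂ _xor_ (Boolₚ.∧-identityʳ (indicator p w)) (Boolₚ.∧-identityʳ (indicator q w))
  by-cases : ∀ a b → W (suc p) ≡ a → W (suc q) ≡ b → Classified (x ∷ xs) ω W
  by-cases a b P Q = code a b , λ e → trans (old P Q e) (new a b e)

-- Without leaves the dual graph is a triangle, so a nonempty even support is an edge.
classify-base : ∀ a b {ω} {W : Fin 2 → Bool} → W 0F ≡ a → W 1F ≡ b → ω ≡ a xor b → (∃[ w ] W w ≡ true) → Classified [] ω W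
classify-base false false P Q _ (0F , eq) = case trans (sym P) eq of λ ()
classify-base false false P Q _ (1F , eq) = case trans (sym Q) eq of λ ()
classify-base true  false P Q refl _ = inj₁ (rim 0F) , λ { (path zero) → cong₂ _∧_ P Q ; (rim 0F) → P ; (rim 1F) → Q }
classify-base false true  P Q refl _ = inj₁ (rim 1F) , λ { (path zero) → cong₂ _∧_ P Q ; (rim 0F) → P ; (rim 1F) → Q }
classify-base true  true  P Q refl _ = inj₁ (path zero) , λ { (path zero) → cong₂ _∧_ P Q ; (rim 0F) → refl ; (rim 1F) → refl }

-- The support of `ω` and `W` is a nonempty even clique. The outer face is joined to all others, so
-- adjacency is demanded of inner faces only, and by parity a nonempty support contains one. The
-- newest face is removed until it belongs to the clique.
classify : ∀ {ℓ} (xs : Vec Side ℓ) ω W →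
  (∀ w w′ → w ≢ w′ → W w ≡ true → W w′ ≡ true → Near xs w w′) →
  ω xor xorSum W ≡ false → (∃[ w ] W w ≡ true) → Classified xs ω W
classify [] ω W near even some = classify-base (W 0F) (W 1F) refl refl
  (trans (xor≡false⇒≡ even) (cong (W 0F xor_) (Boolₚ.xor-identityʳ (W 1F)))) some
classify (x ∷ xs) ω W near even (w₀ , Ww₀) with W zero in W0
... | true  = classify-first x xs ω W W0 off even
  where
  off : ∀ w → w ≢ first x xs → w ≢ first (opposite x) xs → W (suc w) ≡ false
  off w w≢p w≢q = Boolₚ.¬-not λ Ww → [ w≢p , w≢q ]′ (near-zero x xs (near zero (suc w) (λ ()) W0 Ww))
... | false = classify-shift x xs ω W W0 (classify xs ω (W ∘ suc)
  (λ w w′ w≢w′ a b → near-suc x xs (near (suc w) (suc w′) (w≢w′ ∘ Finₚ.suc-injective) a b)) even (later w₀ Ww₀))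
  where
  later : ∀ w → W w ≡ true → ∃[ w ] W (suc w) ≡ true
  later zero    eq = case trans (sym W0) eq of λ ()
  later (suc w) eq = w , eq

-- Rank one forms of the strip

sum-true : ∀ {n} (f : Fin n → Bool) → xorSum f ≡ true → ∃[ i ] f i ≡ true
sum-true {suc n} f eq with f zero in f0
... | true  = zero , f0
... | false with sum-true (f ∘ suc) eq
...   | i , fi = suc i , fi

module StripRankOne {ℓ : ℕ} (xs : Vec Side ℓ) where
  open CaterpillarHalin xs using (Vertex; v; u)
  open Strip xs using (strip)
  open StripPlane xs
  open PlaneCubic stripPlane using (δ; sumE)
  open PlaneCubicProperties stripPlane using (sumE-cong; sumE-xor; sumE-point)
  open Genus stripPlane

  δ-additive : ∀ e → Additive (λ x → δ x e)
  δ-additive e = (λ x≗z → δ-cong x≗z e) , λ x z → δ-⊕ x z e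

  form-⊕ : ∀ A B x z → form (λ e → A e xor B e) x z ≡ form A x z xor form B x z
  form-⊕ A B x z = trans
    (sumE-cong λ e → solve 4 (λ a b p q → ((a :+ b) :* p) :* q := ((a :* p) :* q) :+ ((b :* p) :* q)) refl (A e) (B e) (δ x e) (δ z e))
    (sumE-xor (λ e → (A e ∧ δ x e) ∧ δ z e) (λ e → (B e ∧ δ x e) ∧ δ z e))

  form-edge : ∀ e x z → form (sameEdge e) x z ≡ δ x e ∧ δ z e
  form-edge e x z = trans (sumE-cong λ e′ → trans (Boolₚ.∧-assoc (sameEdge e e′) (δ x e′) (δ z e′)) (cong (_∧ (δ x e′ ∧ δ z e′)) (same≡ e′)))
    (sumE-point (λ e → δ x e ∧ δ z e) e)
    where
    same≡ : ∀ e′ → sameEdge e e′ ≡ does (E-≟ strip e e′)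
    same≡ e′ = does-unique (E-≟ strip e e′) (λ { refl → sameEdge-refl e }) (sameEdge⁻ e e′)

  edge-rankOne : ∀ e → RankOne (sameEdge e)
  edge-rankOne e = (λ x → δ x e) , δ-additive e , (indicator l , on-e) , form-edge e
    where
    l = proj₁ (dualEnds e)
    on-e : δ (indicator l) e ≡ true
    on-e = trans (δ-dualEnds (indicator l) e) (cong₂ _xor_ (indicator-same l) (indicator-other {w = l} (dualEnds-distinct e ∘ sym)))

  module _ (j : Fin ℓ) where
    private
      n p q : F
      n = suc (j ↑ˡ 2)
      p = suc (leafFaceʳ xs j)
      q = suc (oppositeFace xs j)

      φ : (F → Bool) → Bool
      φ x = x zero xor (x n xor (x p xor x q))

      φ-additive : Additive φ
      φ-additive = (λ eq → cong₂ _xor_ (eq zero) (cong₂ _xor_ (eq n) (cong₂ _xor_ (eq p) (eq q))))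
        , λ x z → solve 8 (λ a b c d a′ b′ c′ d′ → (a :+ a′) :+ ((b :+ b′) :+ ((c :+ c′) :+ (d :+ d′))) := (a :+ (b :+ (c :+ d))) :+ (a′ :+ (b′ :+ (c′ :+ d′))))
            refl (x zero) (x n) (x p) (x q) (z zero) (z n) (z p) (z q)

      before after : ∀ (x : F → Bool) → Side → Bool
      before x s = x (suc (facing s xs (inject₁ j)))
      after x s  = x (suc (facing s xs (suc j)))

      sort-sides : ∀ (h : Side → Bool) s → h above xor h below ≡ h s xor h (opposite s)
      sort-sides h above = refl
      sort-sides h below = Boolₚ.xor-comm (h above) (h below)

      δ-before : ∀ x → δ x (path (inject₁ j)) ≡ x n xor x q
      δ-before x = trans (sort-sides (before x) (lookup xs j))
        (cong₂ (λ a b → x (suc a) xor x (suc b)) (facing-leaf xs j) (facing-stays xs j))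

      δ-after : ∀ x → δ x (path (suc j)) ≡ x p xor x q
      δ-after x = sort-sides (after x) (lookup xs j)

      δ-leg : ∀ x → δ x (leg j) ≡ x n xor x p
      δ-leg x = δ-dualEnds x (leg j)

      e₁ e₂ e₃ e₄ e₅ e₆ : StripEdges ℓ
      e₁ = path (inject₁ j)
      e₂ = path (suc j)
      e₃ = leg j
      e₄ = rim (j ↑ˡ 2)
      e₅ = rim (leafFaceʳ xs j)
      e₆ = rim (oppositeFace xs j)

      _⊞_ : (StripEdges ℓ → Bool) → (StripEdges ℓ → Bool) → StripEdges ℓ → Bool
      (A ⊞ B) e = A e xor B e
      infixr 5 _⊞_

      six : StripEdges ℓ → Bool
      six = sameEdge e₁ ⊞ sameEdge e₂ ⊞ sameEdge e₃ ⊞ sameEdge e₄ ⊞ sameEdge e₅ ⊞ sameEdge e₆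

      tetrahedron≡six : ∀ e → tetrahedron xs j e ≡ six e
      tetrahedron≡six (path i) = cong (indicator (inject₁ j) i xor_) (sym (Boolₚ.xor-identityʳ (indicator (suc j) i)))
      tetrahedron≡six (leg i)  = sym (Boolₚ.xor-identityʳ (indicator j i))
      tetrahedron≡six (rim w)  = refl

      -- The Laplacian of a tetrahedron is the all-one matrix over GF(2), because every vertex has
      -- odd degree three.
      form-six : ∀ x z → form six x z ≡ φ x ∧ φ z
      form-six x z = begin
        form six x z
          ≡⟨ split e₁ (sameEdge e₂ ⊞ sameEdge e₃ ⊞ sameEdge e₄ ⊞ sameEdge e₅ ⊞ sameEdge e₆)
             (split e₂ (sameEdge e₃ ⊞ sameEdge e₄ ⊞ sameEdge e₅ ⊞ sameEdge e₆)
             (split e₃ (sameEdge e₄ ⊞ sameEdge e₅ ⊞ sameEdge e₆)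
             (split e₄ (sameEdge e₅ ⊞ sameEdge e₆)
             (split e₅ (sameEdge e₆) (form-edge e₆ x z))))) ⟩
        (δ x e₁ ∧ δ z e₁) xor ((δ x e₂ ∧ δ z e₂) xor ((δ x e₃ ∧ δ z e₃) xor ((δ x e₄ ∧ δ z e₄) xor ((δ x e₅ ∧ δ z e₅) xor (δ x e₆ ∧ δ z e₆)))))
          ≡⟨ cong₂ _xor_ (cong₂ _∧_ (δ-before x) (δ-before z)) (cong₂ _xor_ (cong₂ _∧_ (δ-after x) (δ-after z)) (cong (_xor ((δ x e₄ ∧ δ z e₄) xor ((δ x e₅ ∧ δ z e₅) xor (δ x e₆ ∧ δ z e₆)))) (cong₂ _∧_ (δ-leg x) (δ-leg z)))) ⟩
        ((x n xor x q) ∧ (z n xor z q)) xor (((x p xor x q) ∧ (z p xor z q)) xor (((x n xor x p) ∧ (z n xor z p)) xor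
          (((x zero xor x n) ∧ (z zero xor z n)) xor (((x zero xor x p) ∧ (z zero xor z p)) xor ((x zero xor x q) ∧ (z zero xor z q))))))
          ≡⟨ solve 8 (λ o n p q o′ n′ p′ q′ →
               ((n :+ q) :* (n′ :+ q′)) :+ (((p :+ q) :* (p′ :+ q′)) :+ (((n :+ p) :* (n′ :+ p′)) :+
                 (((o :+ n) :* (o′ :+ n′)) :+ (((o :+ p) :* (o′ :+ p′)) :+ ((o :+ q) :* (o′ :+ q′))))))
               := (o :+ (n :+ (p :+ q))) :* (o′ :+ (n′ :+ (p′ :+ q′))))
             refl (x zero) (x n) (x p) (x q) (z zero) (z n) (z p) (z q) ⟩
        φ x ∧ φ z ∎
        where
        open ≡-Reasoning
        split : ∀ e B {b} → form B x z ≡ b → form (sameEdge e ⊞ B) x z ≡ (δ x e ∧ δ z e) xor b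
        split e B eq = trans (form-⊕ (sameEdge e) B x z) (cong₂ _xor_ (form-edge e x z) eq)

    tetrahedron-rankOne : RankOne (tetrahedron xs j)
    tetrahedron-rankOne = φ , φ-additive , (indicator zero , refl) , λ x z → trans (form-A-cong tetrahedron≡six x z) (form-six x z)

  twists-rankOne : ∀ c → RankOne (twists xs c)
  twists-rankOne (inj₁ e) = edge-rankOne e
  twists-rankOne (inj₂ j) = tetrahedron-rankOne j

  rankOne-cong : ∀ {A A′} → (∀ e → A e ≡ A′ e) → RankOne A → RankOne A′
  rankOne-cong eq (φ , add , some , factor) = φ , add , some , λ x z → trans (sym (form-A-cong eq x z)) (factor x z)

  -- The vector w of the factorisation is `W`. A nonzero entry for two different faces needs an edge
  -- of A between them, whence a clique; conversely `form-separate` recovers A from w.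
  rankOne-twists : ∀ {A} → RankOne A → ∃[ c ] (∀ e → A e ≡ twists xs c e)
  rankOne-twists {A} rankOne@(φ , φ-add , (x₀ , φx₀) , factor) with classify xs (W zero) (W ∘ suc) near even some
    where
    W : F → Bool
    W w = φ (indicator w)
    near : ∀ w w′ → w ≢ w′ → W (suc w) ≡ true → W (suc w′) ≡ true → Near xs w w′
    near w w′ w≢w′ Ww Ww′ with sum-true (joint ∘ edgeAt) (trans (factor (indicator (suc w)) (indicator (suc w′))) (cong₂ _∧_ Ww Ww′))
      where
      edgeAt = Inverse.from (PlaneCubic.enumerate stripPlane)
      joint : StripEdges ℓ → Bool
      joint e = (A e ∧ δ (indicator (suc w)) e) ∧ δ (indicator (suc w′)) e
    ... | i , eq = common (Inverse.from (PlaneCubic.enumerate stripPlane) i) eq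
      where
      between : ∀ e → proj₁ (dualEnds e) ≡ suc w ⊎ proj₂ (dualEnds e) ≡ suc w →
                      proj₁ (dualEnds e) ≡ suc w′ ⊎ proj₂ (dualEnds e) ≡ suc w′ → Near xs w w′
      between e        (inj₁ a) (inj₁ b) = contradiction (Finₚ.suc-injective (trans (sym a) b)) w≢w′
      between e        (inj₂ a) (inj₂ b) = contradiction (Finₚ.suc-injective (trans (sym a) b)) w≢w′
      between (path i) (inj₁ a) (inj₂ b) = inj₁ (i , inj₁ (Finₚ.suc-injective a , Finₚ.suc-injective b))
      between (path i) (inj₂ a) (inj₁ b) = inj₁ (i , inj₂ (Finₚ.suc-injective b , Finₚ.suc-injective a))
      between (leg j)  (inj₁ a) (inj₂ b) = inj₂ (j , inj₁ (Finₚ.suc-injective a , Finₚ.suc-injective b))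
      between (leg j)  (inj₂ a) (inj₁ b) = inj₂ (j , inj₂ (Finₚ.suc-injective b , Finₚ.suc-injective a))
      between (rim k)  (inj₁ ()) (inj₂ b)
      between (rim k)  (inj₂ a) (inj₁ ())
      common : ∀ e → (A e ∧ δ (indicator (suc w)) e) ∧ δ (indicator (suc w′)) e ≡ true → Near xs w w′
      common e eq with ∧≡true {A e ∧ δ (indicator (suc w)) e} eq
      ... | eq₁ , at-w′ = between e (incident e (proj₂ (∧≡true {A e} eq₁))) (incident e at-w′)
    even : W zero xor xorSum (W ∘ suc) ≡ false
    even = trans (sym (additive-expand φ-add (λ _ → true))) (rankOne-const {A} rankOne)
    some : ∃[ w ] W (suc w) ≡ true
    some with sum-true (λ w → x₀ w ∧ W w) (trans (sym (additive-expand φ-add x₀)) φx₀)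
    ... | suc w , eq = w , proj₂ (∧≡true {x₀ (suc w)} eq)
    -- If only the outer face is known to lie in the support, parity provides an inner one.
    ... | zero  , eq = sum-true (W ∘ suc) (trans (sym (xor≡false⇒≡ even)) (proj₂ (∧≡true {x₀ zero} eq)))
  ... | c , weight≡ = c , λ e → trans (A≡weight e) (weight≡ e)
    where
    A≡ : ∀ e → A e ≡ φ (indicator (proj₁ (dualEnds e))) ∧ φ (indicator (proj₂ (dualEnds e)))
    A≡ e = trans (sym (form-separate A e)) (factor (indicator (proj₁ (dualEnds e))) (indicator (proj₂ (dualEnds e))))
    A≡weight : ∀ e → A e ≡ weight xs (φ (indicator zero)) (λ w → φ (indicator (suc w))) e
    A≡weight (path i) = A≡ (path i)
    A≡weight (leg j)  = A≡ (leg j)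
    A≡weight (rim w)  = A≡ (rim w)

-- The numbers of embeddings of Euler genus 0 and 1

module HalinEmbeddings {ℓ : ℕ} (xs : Vec Side ℓ) {T : CaterpillarHalin.Edge xs → Bool}
                       (tree : IsSpanningTree (CaterpillarHalin.graph xs) T) where
  open CaterpillarHalin xs using (graph; Edge)
  open Strip xs using (StripEdge↔Fin)
  open HalinPlane xs
  open StripRankOne xs
  open Genus halinPlane
  open Twisting halinPlane using (twist)
  open Counting halinPlane tree using (number-of-embeddings)
  private module ε = Inverse stripEdge

  embeddings-genus-zero : NumberOfEmbeddings graph T 0 2
  embeddings-genus-zero = number-of-embeddings {n = 1} (↔-sym Finₚ.1↔⊤) (λ _ _ → false) (λ _ → refl)
    (λ R genus → tt , genus-zero⇒ {R} genus) (λ R _ untwisted → genus-zero⇐ {R} untwisted)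

  embeddings-genus-one : NumberOfEmbeddings graph T 1 (2 * ((suc ℓ + (ℓ + (ℓ + 2))) + ℓ))
  embeddings-genus-one = number-of-embeddings Code↔Fin (λ c e → twists xs c (ε.to e)) injective complete sound
    where
    Code↔Fin : StripCode ℓ ↔ Fin ((suc ℓ + (ℓ + (ℓ + 2))) + ℓ)
    Code↔Fin = ↔-sym Finₚ.+↔⊎ ↔-∘ (StripEdge↔Fin ⊎-↔ ↔-id _)
    to-from : ∀ c e → twists xs c (ε.to (ε.from e)) ≡ twists xs c e
    to-from c e = cong (twists xs c) (ε.strictlyInverseˡ e)
    injective : ∀ {c c′} → (∀ e → twists xs c (ε.to e) ≡ twists xs c′ (ε.to e)) → c ≡ c′
    injective {c} {c′} eq = twists-injective xs (λ e → trans (sym (to-from c e)) (trans (eq (ε.from e)) (to-from c′ e)))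
    complete : ∀ R → HasEulerGenus graph R 1 → ∃[ c ] (∀ e → twist R e ≡ twists xs c (ε.to e))
    complete R genus = proj₁ found , λ e → trans (cong (twist R) (sym (ε.strictlyInverseʳ e))) (proj₂ found (ε.to e))
      where
      found : ∃[ c ] (∀ e → twist R (ε.from e) ≡ twists xs c e)
      found = rankOne-twists {twist R ∘ ε.from} (Halin.rankOne-back size≡ {twist R} (genus-one⇒ {R} genus))
    sound : ∀ R c → (∀ e → twist R e ≡ twists xs c (ε.to e)) → HasEulerGenus graph R 1
    sound R c eq = genus-one⇐ {R} (Halin.rankOne-there size≡ {twist R}
      (rankOne-cong {twists xs c} {twist R ∘ ε.from} (λ e → sym (trans (eq (ε.from e)) (to-from c e))) (twists-rankOne c)))

-- The number of leaves in terms of the block sizes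

open ℕSolver.+-*-Solver renaming (solve to solveℕ; _:=_ to _:≡_; _:+_ to _⊕_; _:*_ to _⊛_; con to conℕ)

record Raised {k} (ms ns : Vec ℕ k) : Set where
  constructor raised
  field sum≡ : sum ns ≡ sum ms + (k ∸ 1)

-- The function afterFirst is local to blocks and has no name here: the underscore
-- is solved to it from the use in step, where with-abstraction makes all its
-- arguments distinct variables.
mutual
  raised-afterFirst : ∀ n (m : ℕ) (ms : Vec ℕ n) j (ns : Vec ℕ j) → Raised {j} ns _
  step : ∀ k m m₁ m₂ (ms : Vec ℕ k) → Raised (m₂ ∷ ms) (Vec.tail (Vec.tail (blocks (m ∷ m₁ ∷ m₂ ∷ ms))))
  step k m m₁ m₂ ms with ℕ.suc (ℕ.suc k) | m₁ Vec.∷ m₂ Vec.∷ ms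
  ... | n | w with ℕ.suc k | m₂ Vec.∷ ms
  ... | j | w₂ = raised-afterFirst n m w j w₂
  raised-afterFirst n m ms .0 [] = raised refl
  raised-afterFirst n m ms .1 (a ∷ []) = raised (sym (ℕₚ.+-identityʳ (a + 0)))
  raised-afterFirst n m ms (suc (suc j)) (a ∷ b ∷ ns) = raised (trans
    (cong (_+_ (suc a)) (Raised.sum≡ (raised-afterFirst n m ms (suc j) (b ∷ ns))))
    (solveℕ 3 (λ a s j → (conℕ 1 ⊕ a) ⊕ (s ⊕ j) :≡ (a ⊕ s) ⊕ (conℕ 1 ⊕ j)) refl a (sum (b ∷ ns)) j))

sum-blocks : ∀ {k} (m : Vec ℕ (2 + k)) → sum (blocks m) ≡ sum m + k
sum-blocks (m ∷ m₁ ∷ []) = sym (ℕₚ.+-identityʳ _)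
sum-blocks {suc k} (m ∷ m₁ ∷ m₂ ∷ ms) = trans
  (cong (λ s → m + (suc m₁ + s)) (Raised.sum≡ (step k m m₁ m₂ ms)))
  (solveℕ 4 (λ m m₁ s k → m ⊕ ((conℕ 1 ⊕ m₁) ⊕ (s ⊕ k)) :≡ (m ⊕ (m₁ ⊕ s)) ⊕ (conℕ 1 ⊕ k)) refl m m₁ (sum (m₂ ∷ ms)) k)

theorem3p6 : (k : ℕ) → 2 ≤ k → (m : Vec ℕ k) → All (1 ≤_) m →
    (T : Graph.E (H m) → Bool) → IsSpanningTree (H m) T →
    NumberOfEmbeddings (H m) T 0 2 ×
    NumberOfEmbeddings (H m) T 1 (8 * (sum m + k) ∸ 10)
theorem3p6 (suc (suc k)) (ℕ.s≤s (ℕ.s≤s _)) m _ T tree =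
  embeddings-genus-zero , subst (NumberOfEmbeddings (H m) T 1) count embeddings-genus-one
  where
  open HalinEmbeddings (alternate above (blocks m)) tree
  ℓ = sum (blocks m)
  count : 2 * ((suc ℓ + (ℓ + (ℓ + 2))) + ℓ) ≡ 8 * (sum m + suc (suc k)) ∸ 10
  -- The 4ℓ + 3 codes count twice, and 2 (4ℓ + 3) + 10 = 8 (ℓ + 2). Raising all entries but the
  -- first and the last makes ℓ + 2 the sum of the entries of `m` plus their number.
  count = trans (sym (ℕₚ.m+n∸n≡m (2 * ((suc ℓ + (ℓ + (ℓ + 2))) + ℓ)) 10)) (cong (_∸ 10) (trans
    (solveℕ 1 (λ n → (conℕ 2 ⊛ (((conℕ 1 ⊕ n) ⊕ (n ⊕ (n ⊕ conℕ 2))) ⊕ n)) ⊕ conℕ 10 :≡ conℕ 8 ⊛ (n ⊕ conℕ 2)) refl ℓ)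
    (cong (8 *_) (trans (cong (λ t → t + 2) (sum-blocks m)) (solveℕ 2 (λ s k → (s ⊕ k) ⊕ conℕ 2 :≡ s ⊕ (conℕ 2 ⊕ k)) refl (sum m) k)))))
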